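{- Let $d\ge 2$ be an integer and set $t_d:=2^{d-1}-1$. There exist constants $C_d,c_d>0$ depending only on $d$ such that the following holds. Let $m\ge 1$, let $A\subset\mathbb{Z}^m$ be finite and nonempty, and suppose that $A$ contains a $d$-dimensional spherical Freiman model $D$, i.e. a nonempty subset $D\subseteq A$ that is Freiman isomorphic, of some order $h\geq 2$, to a subset $S\subseteq \mathcal{F}_{d,R^2}$ for some positive integer $R$. Put $\alpha:=|D|/|A|$. Then for every $\eta\in(0,1)$ there are affine subspaces $P_1,\dots,P_J\subset\mathbb{R}^d$, each of dimension at most one, such that $$\Big|S\cap\bigcup_{j=1}^J P_j\Big|\ge (1-\eta)|S|,\qquad J\le C_d\Big(\eta^{ -2}\frac{\|A\|^2}{\alpha}\Big)^{t_d}.$$ Consequently, $$\|A\|\ge c_d\,|A|^{1/(2t_d)}\,\alpha^{(t_d+1)/(2t_d)}.$$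
   Context: For a finite set $A\subset\mathbb{Z}^m$, the Fourier $L^1$ norm is $\|A\|:=\int_{\mathbb{T}^m}\big|\sum_{a\in A}e(a\cdot t)\big|\,dt$, where $e(x)=e^{2\pi i x}$ and $\mathbb{T}=\mathbb{R}/\mathbb{Z}$. For a positive integer $R$, $\mathcal{F}_{d,R^2}:=\{x\in\mathbb{Z}^d: |x|^2=R^2\}$ (Euclidean norm). A map $\phi:D\to D'$ between subsets of abelian groups is a Freiman $h$-homomorphism if $d_1+\cdots+d_h=d_{h+1}+\cdots+d_{2h}$ with all $d_i\in D$ implies $\phi(d_1)+\cdots+\phi(d_h)=\phi(d_{h+1})+\cdots+\phi(d_{2h})$. A Freiman $h$-isomorphism is a bijection for which this implication holds in both directions. -}

module Defs where

open import Algebra.Apartness.Bundles using (HeytingCommutativeRing; HeytingField)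
open import Algebra.Bundles using (CommutativeRing)
import Algebra.Apartness.Properties.HeytingCommutativeRing as HeytingProperties
import Algebra.Definitions.RawMonoid as RawMonoidDefinitions
import Algebra.Properties.Ring as RingProperties
import Algebra.Properties.Semiring.Exp as SemiringExp
import Algebra.Properties.Semiring.Mult as SemiringMult
open import Data.Fin.Base using (Fin; toℕ)
open import Data.Integer.Base as ℤ using (ℤ; +_; -[1+_])
open import Data.List.Base as List using (List; []; _∷_; length)
open import Data.List.Membership.Propositional using () renaming (_∈_ to _∈ˡ_)
open import Data.List.Relation.Unary.Unique.Propositional using (Unique)
open import Data.Nat.Base as ℕ using (ℕ; zero; suc; _!; _∸_)
import Data.Nat.Properties as ℕ
open import Data.Product.Base using (Σ-syntax; ∃-syntax; _×_; _,_; proj₁; proj₂)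
open import Data.Sum.Base using (_⊎_; inj₁; inj₂)
open import Data.Vec.Base as Vec using (Vec; []; _∷_; lookup)
open import Data.Vec.Functional using (Vector)
open import Data.Vec.Relation.Unary.All using (All)
open import Function.Bundles using (_⇔_; Equivalence)
open import Level using (_⊔_) renaming (suc to lsuc)
open import Relation.Binary.Core using (Rel)
open import Relation.Binary.PropositionalEquality.Core using (_≡_)
open import Relation.Binary.Structures using (IsStrictPartialOrder)
open import Relation.Nullary.Negation using (¬_)

record FiniteSet {a} (X : Set a) : Set a where
  field
    elements : List X
    unique   : Unique elements

module _ {a} {X : Set a} where

  infix 4 _∈_ _⊆_

  _∈_ : X → FiniteSet X → Set a
  x ∈ A = x ∈ˡ FiniteSet.elements A

  _⊆_ : FiniteSet X → FiniteSet X → Set a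
  A ⊆ B = ∀ {x} → x ∈ A → x ∈ B

  Nonempty : FiniteSet X → Set a
  Nonempty A = ∃[ x ] x ∈ A

  card : FiniteSet X → ℕ
  card A = length (FiniteSet.elements A)

ℤ^_ : ℕ → Set
ℤ^ n = Vec ℤ n

sumVectors : ∀ {n k} → Vec (ℤ^ n) k → ℤ^ n
sumVectors = Vec.foldr′ (Vec.zipWith ℤ._+_) (Vec.replicate _ (+ 0))

normSq : ∀ {n} → ℤ^ n → ℤ
normSq x = Vec.foldr′ ℤ._+_ (+ 0) (Vec.map (λ a → a ℤ.* a) x)

OnSphere : ∀ {d} → ℕ → ℤ^ d → Set
OnSphere R x = normSq x ≡ + (R ℕ.^ 2)

-- A map D → S is given by a function on the ambient group; only its
-- values on D matter.
IsFreimanHom : ∀ {m d} → ℕ → FiniteSet (ℤ^ m) → (ℤ^ m → ℤ^ d) → Set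
IsFreimanHom h D φ = (x y : Vec (ℤ^ _) h) → All (_∈ D) x → All (_∈ D) y →
  sumVectors x ≡ sumVectors y →
  sumVectors (Vec.map φ x) ≡ sumVectors (Vec.map φ y)

record IsFreimanIso {m d} (h : ℕ) (D : FiniteSet (ℤ^ m)) (S : FiniteSet (ℤ^ d))
                    (φ : ℤ^ m → ℤ^ d) : Set where
  field
    mapsTo     : ∀ {x} → x ∈ D → φ x ∈ S
    injective  : ∀ {x y} → x ∈ D → y ∈ D → φ x ≡ φ y → x ≡ y
    surjective : ∀ {s} → s ∈ S → ∃[ x ] (x ∈ D × φ x ≡ s)
    hom        : IsFreimanHom h D φ
    reflects   : (x y : Vec (ℤ^ m) h) → All (_∈ D) x → All (_∈ D) y →
                 sumVectors (Vec.map φ x) ≡ sumVectors (Vec.map φ y) →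
                 sumVectors x ≡ sumVectors y

record SphericalModel (d : ℕ) {m : ℕ} (A : FiniteSet (ℤ^ m)) : Set where
  field
    D          : FiniteSet (ℤ^ m)
    D⊆A        : D ⊆ A
    D-nonempty : Nonempty D
    S          : FiniteSet (ℤ^ d)
    R          : ℕ
    R-positive : 0 ℕ.< R
    S-onSphere : ∀ {x} → x ∈ S → OnSphere R x
    order      : ℕ
    order≥2    : 2 ℕ.≤ order
    φ          : ℤ^ m → ℤ^ d
    φ-iso      : IsFreimanIso order D S φ

-- t_d
exponent : ℕ → ℕ
exponent d = 2 ℕ.^ (d ∸ 1) ∸ 1

-- The real numbers, axiomatised as an Archimedean ordered field in which
-- Cauchy sequences converge.  Classically this determines ℝ up to
-- isomorphism.  The order is not assumed decidable, so that constructive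
-- models such as the Cauchy reals are included.

record RealField c ℓ₁ ℓ₂ : Set (lsuc (c ⊔ ℓ₁ ⊔ ℓ₂)) where
  field
    heytingField : HeytingField c ℓ₁ ℓ₂

  open HeytingField heytingField public

  commutativeRing : CommutativeRing c ℓ₁
  commutativeRing = HeytingCommutativeRing.commutativeRing heytingCommutativeRing

  open CommutativeRing commutativeRing public using (semiring; ring; +-rawMonoid)
  open SemiringMult semiring public using () renaming (_×_ to _·_)
  open SemiringExp semiring public using (_^_)
  open RawMonoidDefinitions +-rawMonoid public using (sum)

  fromℕ : ℕ → Carrier
  fromℕ n = n · 1#

  infix 4 _<_
  field
    _<_                  : Rel Carrier ℓ₂
    isStrictPartialOrder : IsStrictPartialOrder _≈_ _<_
    #⇔<⊎>                : ∀ {x y} → (x # y) ⇔ (x < y ⊎ y < x)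
    +-monoˡ-<            : ∀ {x y} z → x < y → x + z < y + z
    *-pos                : ∀ {x y} → 0# < x → 0# < y → 0# < x * y

  infix 4 _≤_
  _≤_ : Rel Carrier ℓ₂
  x ≤ y = ¬ (y < x)

  -- ∣ x - y ∣ < ε
  Within : Carrier → Carrier → Carrier → Set ℓ₂
  Within ε x y = (x - y < ε) × (y - x < ε)

  IsCauchy : (ℕ → Carrier) → Set (c ⊔ ℓ₂)
  IsCauchy u = ∀ ε → 0# < ε →
    ∃[ N ] (∀ m n → N ℕ.≤ m → N ℕ.≤ n → Within ε (u m) (u n))

  infix 4 _⟶_
  _⟶_ : (ℕ → Carrier) → Carrier → Set (c ⊔ ℓ₂)
  u ⟶ l = ∀ ε → 0# < ε → ∃[ N ] (∀ n → N ℕ.≤ n → Within ε (u n) l)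

  field
    archimedean : ∀ x → ∃[ n ] x < fromℕ n
    complete    : ∀ u → IsCauchy u → ∃[ l ] u ⟶ l

module Analysis {c ℓ₁ ℓ₂} (ℝ : RealField c ℓ₁ ℓ₂) where

  open RealField ℝ public
  open HeytingProperties heytingCommutativeRing using (x-0≈x; 1#0; x#0y#0→xy#0; invertibleʳ⇒#)
  open RingProperties ring using (-‿involutive; -‿distribˡ-*)
  open IsStrictPartialOrder isStrictPartialOrder
    using () renaming (<-respʳ-≈ to <-respʳ; <-respˡ-≈ to <-respˡ; trans to <-trans)

  inv : ∀ x → x # 0# → Carrier
  inv x x#0 = proj₁ (#⇒invertible x#0)

  inv#0 : ∀ x (x#0 : x # 0#) → inv x x#0 # 0#
  inv#0 x x#0 = invertibleʳ⇒# (x - 0# ,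
    trans (*-congʳ (x-0≈x _)) (proj₁ (proj₂ (#⇒invertible x#0))))

  pos⇒#0 : ∀ {x} → 0# < x → x # 0#
  pos⇒#0 0<x = Equivalence.from #⇔<⊎> (inj₂ 0<x)

  0<1 : 0# < 1#
  0<1 with Equivalence.to #⇔<⊎> 1#0
  ... | inj₂ 0<1 = 0<1
  ... | inj₁ 1<0 = <-respʳ -1*-1≈1 (*-pos 0<-1 0<-1)
    where
    0<-1 : 0# < - 1#
    0<-1 = <-respʳ (+-identityˡ _) (<-respˡ (-‿inverseʳ _) (+-monoˡ-< (- 1#) 1<0))
    -1*-1≈1 : - 1# * - 1# ≈ 1#
    -1*-1≈1 = trans (sym (-‿distribˡ-* _ _)) (trans (-‿cong (*-identityˡ _)) (-‿involutive _))

  0<fromℕ : ∀ n → .{{ℕ.NonZero n}} → 0# < fromℕ n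
  0<fromℕ (suc zero)    = <-respʳ (sym (+-identityʳ _)) 0<1
  0<fromℕ (suc (suc n)) = <-trans (0<fromℕ (suc n))
    (<-respˡ (+-identityˡ _) (+-monoˡ-< (fromℕ (suc n)) 0<1))

  fromℕ#0 : ∀ n → .{{ℕ.NonZero n}} → fromℕ n # 0#
  fromℕ#0 n = pos⇒#0 (0<fromℕ n)

  fromℤ : ℤ → Carrier
  fromℤ (+ n)    = fromℕ n
  fromℤ -[1+ n ] = - fromℕ (suc n)

  card#0 : ∀ {a} {X : Set a} (A : FiniteSet X) → Nonempty A → fromℕ (card A) # 0#
  card#0 A (_ , x∈A) with FiniteSet.elements A
  card#0 A (_ , ()) | []
  card#0 A (_ , _)  | x ∷ xs = fromℕ#0 (suc (length xs))

  -- y = x ^ (p / q), for x ≥ 0 and q ≥ 1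
  IsRationalPower : Carrier → ℕ → ℕ → Carrier → Set (ℓ₁ ⊔ ℓ₂)
  IsRationalPower x p q y = 0# ≤ y × y ^ q ≈ x ^ p

  ℂ : Set c
  ℂ = Carrier × Carrier

  0ℂ 1ℂ : ℂ
  0ℂ = 0# , 0#
  1ℂ = 1# , 0#

  infixl 6 _+ℂ_
  infixl 7 _*ℂ_
  infixr 8 _^ℂ_

  _+ℂ_ _*ℂ_ : ℂ → ℂ → ℂ
  (a , b) +ℂ (a′ , b′) = a + a′ , b + b′
  (a , b) *ℂ (a′ , b′) = a * a′ - b * b′ , a * b′ + b * a′

  _^ℂ_ : ℂ → ℕ → ℂ
  z ^ℂ zero  = 1ℂ
  z ^ℂ suc n = z *ℂ z ^ℂ n

  IsModulus : ℂ → Carrier → Set (ℓ₁ ⊔ ℓ₂)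
  IsModulus (a , b) r = 0# ≤ r × r ^ 2 ≈ a ^ 2 + b ^ 2

  expPartialSum : ℂ → ℕ → ℂ
  expPartialSum z zero    = 0ℂ
  expPartialSum z (suc n) = expPartialSum z n +ℂ (1/n! , 0#) *ℂ z ^ℂ n
    where
    1/n! : Carrier
    1/n! = inv (fromℕ (n !)) (fromℕ#0 (n !) {{n ℕ.!≢0}})

  IsExp : (ℂ → ℂ) → Set (c ⊔ ℓ₂)
  IsExp exp = ∀ z →
    ((λ n → proj₁ (expPartialSum z n)) ⟶ proj₁ (exp z)) ×
    ((λ n → proj₂ (expPartialSum z n)) ⟶ proj₂ (exp z))

  -- π is the least positive zero of sin x = Im exp (i x).
  IsPi : (ℂ → ℂ) → Carrier → Set (c ⊔ ℓ₁ ⊔ ℓ₂)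
  IsPi exp π = 0# < π × sin π ≈ 0# × (∀ x → 0# < x → x < π → ¬ (sin x ≈ 0#))
    where
    sin : Carrier → Carrier
    sin x = proj₂ (exp (0# , x))

  sumGrid : ∀ n m → (Vec (Fin n) m → Carrier) → Carrier
  sumGrid n zero    f = f []
  sumGrid n (suc m) f = sum (λ i → sumGrid n m (λ j → f (i ∷ j)))

  mesh : ℕ → Carrier
  mesh n = inv (fromℕ (suc n)) (fromℕ#0 (suc n))

  -- One sample point in each of the (suc n) ^ m cells of the uniform grid.
  IsTagging : ∀ n m → (Vec (Fin (suc n)) m → Vector Carrier m) → Set ℓ₂
  IsTagging n m τ = ∀ j i →
    fromℕ (toℕ (lookup j i)) * mesh n ≤ τ j i ×
    τ j i ≤ fromℕ (suc (toℕ (lookup j i))) * mesh n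

  -- The Riemann integral over [0,1]^m, a fundamental domain for 𝕋^m.
  -- Arbitrary sample points are allowed, so uniform grids suffice to
  -- characterise Riemann integrability.
  IsIntegral : ∀ m → (Vector Carrier m → Carrier) → Carrier → Set (c ⊔ ℓ₂)
  IsIntegral m f I = ∀ ε → 0# < ε → ∃[ N ] (∀ n → N ℕ.≤ n →
    ∀ τ → IsTagging n m τ →
    Within ε (mesh n ^ m * sumGrid (suc n) m (λ j → f (τ j))) I)

  dot : ∀ {m} → ℤ^ m → Vector Carrier m → Carrier
  dot a t = sum (λ i → fromℤ (lookup a i) * t i)

  -- The functions exp and ∣Â∣ and the number π are uniquely determined by
  -- the properties accompanying them.
  record IsFourierL1Norm {m} (A : FiniteSet (ℤ^ m)) (N : Carrier) : Set (c ⊔ ℓ₁ ⊔ ℓ₂) where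
    field
      exp    : ℂ → ℂ
      isExp  : IsExp exp
      π      : Carrier
      isPi   : IsPi exp π

    e : Carrier → ℂ
    e x = exp (0# , fromℕ 2 * π * x)

    Â : Vector Carrier m → ℂ
    Â t = List.foldr _+ℂ_ 0ℂ (List.map (λ a → e (dot a t)) (FiniteSet.elements A))

    field
      ∣Â∣        : Vector Carrier m → Carrier
      isModulus  : ∀ t → IsModulus (Â t) (∣Â∣ t)
      isIntegral : IsIntegral m ∣Â∣ N

  -- Given by a point and a basis of the direction space; in particular
  -- nonempty, so dim ≤ 1 means a point or a line.
  record AffineSubspace (d : ℕ) : Set (c ⊔ ℓ₁) where
    field
      dim         : ℕ
      point       : Vector Carrier d
      basis       : Vector (Vector Carrier d) dim
      independent : ∀ (s : Vector Carrier dim) →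
                    (∀ i → sum (λ k → s k * basis k i) ≈ 0#) → ∀ k → s k ≈ 0#

  open AffineSubspace public using (dim)

  infix 4 _∈ᴬ_
  _∈ᴬ_ : ∀ {d} → ℤ^ d → AffineSubspace d → Set (c ⊔ ℓ₁)
  x ∈ᴬ P = Σ[ s ∈ Vector Carrier (dim P) ]
    (∀ i → fromℤ (lookup x i) ≈ point i + sum (λ k → s k * basis k i))
    where open AffineSubspace P using (point; basis)

  -- T = S ∩ ⋃ⱼ Pⱼ
  IsIntersection : ∀ {d J} → FiniteSet (ℤ^ d) → FiniteSet (ℤ^ d) →
                   (Fin J → AffineSubspace d) → Set (c ⊔ ℓ₁)
  IsIntersection T S P = ∀ x → (x ∈ T) ⇔ (x ∈ S × ∃[ j ] x ∈ᴬ P j)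

  module _ {d m} {A : FiniteSet (ℤ^ m)} (A≢∅ : Nonempty A) (M : SphericalModel d A) where

    open SphericalModel M using (D; D-nonempty)

    density : Carrier
    density = fromℕ (card D) * inv (fromℕ (card A)) (card#0 A A≢∅)

    density#0 : density # 0#
    density#0 = x#0y#0→xy#0 (card#0 D D-nonempty) (inv#0 _ _)

{-# OPTIONS --safe #-}

-- Put N = ‖A‖ and E(L) = #{(x,y,z,w) ∈ L⁴ : x + y = z + w}.  Hölder's inequality
-- for L ⊆ A gives |L|⁴ ≤ E(L) |A| N².  It is proved for Riemann sums over the
-- points of a grid with spacing 1/q: for q large the characters are exactly
-- orthogonal there, because e(1/q) is a primitive q-th root of unity.
--
-- A Freiman homomorphism does not decrease E, so the same inequality holds for
-- sets L of points of the sphere.  There, for fixed x ≠ z, the equation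
-- x + y = z + w confines w to a hyperplane orthogonal to x − z, so some such
-- hyperplane section L′ of L satisfies |L|² ≤ 2 |A| N² |L′|.  After d − 1
-- sections the points lie on a line, which meets the sphere at most twice;
-- hence |D|^(t+1) ≤ 2 (2 |A| N²)^t.
--
-- This bounds |S| itself by the required number of subspaces, so S can be
-- covered by single points and η plays no role.

module Submission where

open import Defs
open import Algebra.Bundles using (CommutativeRing; RawRing)
import Algebra.Properties.AbelianGroup as AbelianGroupProperties
import Algebra.Properties.CommutativeSemigroup as CommutativeSemigroup
import Algebra.Properties.CommutativeSemiring.Exp as CommutativeSemiringExp
import Algebra.Properties.Ring as RingProps
import Algebra.Properties.Semiring.Mult as SemiringMult
import Algebra.Properties.Semiring.Sum as SemiringSum
import Algebra.Solver.Ring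
open import Algebra.Solver.Ring.AlmostCommutativeRing using (fromCommutativeRing; _-Raw-AlmostCommutative⟶_)
open import Data.Fin.Base as Fin using (Fin; zero; suc; toℕ; punchIn)
import Data.Fin.Properties as Fin
open import Data.Integer.Base as ℤ using (ℤ; +_; -[1+_])
import Data.Integer.Properties as ℤ
open import Data.Integer.Solver using (module +-*-Solver)
open import Data.List.Base as List using (List; []; _∷_; length; _++_; cartesianProduct; cartesianProductWith; filter)
open import Data.List.Membership.Propositional using () renaming (_∈_ to _∈ˡ_)
open import Data.List.Membership.Propositional.Properties
  using (∈-cartesianProduct⁺; ∈-cartesianProduct⁻; ∈-filter⁻; ∈-lookup; ∈-map⁺; ∈-map⁻)
import Data.List.Properties as List
open import Data.List.Relation.Unary.All as All using (All; []; _∷_)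
import Data.List.Relation.Unary.All.Properties as All
open import Data.List.Relation.Unary.AllPairs using (AllPairs; []; _∷_)
open import Data.List.Relation.Unary.Any as Any using (here; there)
open import Data.List.Relation.Unary.Any.Properties using (lookup-index)
open import Data.List.Relation.Unary.Unique.Propositional using (Unique)
import Data.List.Relation.Unary.Unique.Propositional.Properties as Unique
open import Data.Maybe.Base using (Maybe; just; nothing)
open import Data.Nat.Base as ℕ using (ℕ; zero; suc; _!)
import Data.Nat.ListAction as ℕ
import Data.Nat.ListAction.Properties as ℕ
import Data.Nat.Properties as ℕ
open import Data.Product.Base using (Σ-syntax; ∃-syntax; _×_; _,_; proj₁; proj₂)
open import Data.Sum.Base using (_⊎_; inj₁; inj₂; [_,_]′)
open import Data.Vec.Base as Vec using (Vec; []; _∷_; lookup)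
open import Data.Vec.Functional using (Vector; insertAt)
open import Data.Vec.Functional.Properties using (insertAt-lookup; insertAt-punchIn)
import Data.Vec.Properties as Vec
import Data.Vec.Relation.Unary.All as AllV
open import Function.Base using (_∘_)
open import Function.Bundles using (Equivalence; mk⇔)
open import Level using (_⊔_)
open import Relation.Binary.PropositionalEquality as ≡ using (_≡_; _≢_)
import Relation.Binary.Reasoning.Setoid as SetoidReasoning
open import Relation.Binary.Structures using (IsStrictPartialOrder)
open import Relation.Nullary.Decidable.Core using (Dec; yes; no; ¬?)
open import Relation.Nullary.Negation using (¬_; contradiction)

-- The reals are axiomatic and their order is undecidable: `≤` is a negated `<`, moduli enter
-- through their squares, and `exp` is known only by its series, so its functional equation has to
-- be derived. Hölder's inequality is two applications of Cauchy-Schwarz. With F = |Â| and G =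
-- |L̂|², averaged over the grid, |L|² ≤ avg(FG) · avg(F) and avg(FG)² ≤ avg(G²) · avg(F²) = E(L)
-- |A|. The inequality is needed for every section, not only for the whole model. Each section is
-- therefore pulled back to a list in D ⊆ A before the Fourier estimate is applied. If K bounds the
-- sizes of the sections, then E(L) ≤ |L|² (1 + K): the 1 comes from the pairs x = z. With Y = 2 |A|
-- N² this gives |L|² ≤ Y |L′|. Every section doubles the exponent, whence |L|^(2^(d-1)) ≤ 2
-- Y^(2^(d-1) - 1), which is the origin of t. That d - 1 sections leave only a line is a rank count.
-- The normals x - z are pairwise orthogonal, because the points still available agree on all
-- earlier normals, and ℤ^d has no d + 1 nonzero pairwise orthogonal vectors.

-- Ring solving with integer coefficients.

module IntegerCoefficients {c ℓ} (R : CommutativeRing c ℓ) where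

  open CommutativeRing R
  open RingProps ring
  open SemiringMult semiring renaming (_×_ to _·_)
  open SetoidReasoning setoid

  ⟦_⟧ : ℤ → Carrier
  ⟦ + n ⟧      = n · 1#
  ⟦ -[1+ n ] ⟧ = - (suc n · 1#)

  ⟦⟧-neg : ∀ i → ⟦ ℤ.- i ⟧ ≈ - ⟦ i ⟧
  ⟦⟧-neg (+ zero)  = sym -0#≈0#
  ⟦⟧-neg (+ suc n) = refl
  ⟦⟧-neg -[1+ n ]  = sym (-‿involutive _)

  ⟦⟧-⊖ : ∀ m n → ⟦ m ℤ.⊖ n ⟧ ≈ m · 1# - n · 1#
  ⟦⟧-⊖ m       zero    = sym (trans (+-congˡ -0#≈0#) (+-identityʳ _))
  ⟦⟧-⊖ zero    (suc n) = sym (+-identityˡ _)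
  ⟦⟧-⊖ (suc m) (suc n) = begin
    ⟦ suc m ℤ.⊖ suc n ⟧                   ≡⟨ ≡.cong ⟦_⟧ (ℤ.[1+m]⊖[1+n]≡m⊖n m n) ⟩
    ⟦ m ℤ.⊖ n ⟧                           ≈⟨ ⟦⟧-⊖ m n ⟩
    m · 1# - n · 1#                       ≈⟨ +-congʳ (+-identityˡ _) ⟨
    0# + m · 1# - n · 1#                  ≈⟨ +-congʳ (+-congʳ (-‿inverseʳ 1#)) ⟨
    1# - 1# + m · 1# - n · 1#             ≈⟨ +-congʳ (+-assoc _ _ _) ⟩
    1# + (- 1# + m · 1#) - n · 1#         ≈⟨ +-congʳ (+-congˡ (+-comm _ _)) ⟩
    1# + (m · 1# - 1#) - n · 1#           ≈⟨ +-congʳ (+-assoc _ _ _) ⟨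
    1# + m · 1# - 1# - n · 1#             ≈⟨ +-assoc _ _ _ ⟩
    1# + m · 1# + (- 1# - n · 1#)         ≈⟨ +-congˡ (-‿+-comm _ _) ⟩
    1# + m · 1# - (1# + n · 1#)           ∎

  ⟦⟧-+ : ∀ i j → ⟦ i ℤ.+ j ⟧ ≈ ⟦ i ⟧ + ⟦ j ⟧
  ⟦⟧-+ (+ m)    (+ n)    = ×-homo-+ 1# m n
  ⟦⟧-+ (+ m)    -[1+ n ] = ⟦⟧-⊖ m (suc n)
  ⟦⟧-+ -[1+ m ] (+ n)    = trans (⟦⟧-⊖ n (suc m)) (+-comm _ _)
  ⟦⟧-+ -[1+ m ] -[1+ n ] = begin
    - ((2 ℕ.+ (m ℕ.+ n)) · 1#)      ≡⟨ ≡.cong (λ k → - (k · 1#)) (≡.cong suc (≡.sym (ℕ.+-suc m n))) ⟩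
    - ((suc m ℕ.+ suc n) · 1#)      ≈⟨ -‿cong (×-homo-+ 1# (suc m) (suc n)) ⟩
    - (suc m · 1# + suc n · 1#)     ≈⟨ -‿+-comm _ _ ⟨
    - (suc m · 1#) - suc n · 1#     ∎

  ⟦⟧-*⁺ : ∀ m j → ⟦ + m ℤ.* j ⟧ ≈ m · 1# * ⟦ j ⟧
  ⟦⟧-*⁺ m (+ n)    = trans (reflexive (≡.cong ⟦_⟧ (≡.sym (ℤ.pos-* m n)))) (×1-homo-* m n)
  ⟦⟧-*⁺ m -[1+ n ] = begin
    ⟦ + m ℤ.* -[1+ n ] ⟧            ≡⟨ ≡.cong ⟦_⟧ (ℤ.neg-distribʳ-* (+ m) (+ suc n)) ⟨
    ⟦ ℤ.- (+ m ℤ.* + suc n) ⟧       ≈⟨ ⟦⟧-neg (+ m ℤ.* + suc n) ⟩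
    - ⟦ + m ℤ.* + suc n ⟧           ≈⟨ -‿cong (⟦⟧-*⁺ m (+ suc n)) ⟩
    - (m · 1# * (suc n · 1#))       ≈⟨ -‿distribʳ-* _ _ ⟩
    m · 1# * - (suc n · 1#)         ∎

  ⟦⟧-* : ∀ i j → ⟦ i ℤ.* j ⟧ ≈ ⟦ i ⟧ * ⟦ j ⟧
  ⟦⟧-* (+ m)    j = ⟦⟧-*⁺ m j
  ⟦⟧-* -[1+ m ] j = begin
    ⟦ -[1+ m ] ℤ.* j ⟧          ≡⟨ ≡.cong ⟦_⟧ (ℤ.neg-distribˡ-* (+ suc m) j) ⟨
    ⟦ ℤ.- (+ suc m ℤ.* j) ⟧     ≈⟨ ⟦⟧-neg (+ suc m ℤ.* j) ⟩
    - ⟦ + suc m ℤ.* j ⟧         ≈⟨ -‿cong (⟦⟧-*⁺ (suc m) j) ⟩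
    - (suc m · 1# * ⟦ j ⟧)      ≈⟨ -‿distribˡ-* _ _ ⟩
    - (suc m · 1#) * ⟦ j ⟧      ∎

  -- Differs from ⟦_⟧ only in avoiding 1# + 0#, so that the solver's constant 1
  -- is definitionally 1#.
  ⟦_⟧′ : ℤ → Carrier
  ⟦ + 1 ⟧′      = 1#
  ⟦ + n ⟧′      = n · 1#
  ⟦ -[1+ 0 ] ⟧′ = - 1#
  ⟦ -[1+ n ] ⟧′ = - (suc n · 1#)

  ⟦⟧′≈⟦⟧ : ∀ i → ⟦ i ⟧′ ≈ ⟦ i ⟧
  ⟦⟧′≈⟦⟧ (+ 0)           = refl
  ⟦⟧′≈⟦⟧ (+ 1)           = sym (+-identityʳ 1#)
  ⟦⟧′≈⟦⟧ (+ suc (suc n)) = refl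
  ⟦⟧′≈⟦⟧ -[1+ 0 ]        = -‿cong (sym (+-identityʳ 1#))
  ⟦⟧′≈⟦⟧ -[1+ suc n ]    = refl

  private
    ℤ-rawRing : RawRing _ _
    ℤ-rawRing = CommutativeRing.rawRing ℤ.+-*-commutativeRing

    morphism : ℤ-rawRing -Raw-AlmostCommutative⟶ fromCommutativeRing R
    morphism = record
      { ⟦_⟧    = ⟦_⟧′
      ; +-homo = λ i j → trans (⟦⟧′≈⟦⟧ (i ℤ.+ j)) (trans (⟦⟧-+ i j) (sym (+-cong (⟦⟧′≈⟦⟧ i) (⟦⟧′≈⟦⟧ j))))
      ; *-homo = λ i j → trans (⟦⟧′≈⟦⟧ (i ℤ.* j)) (trans (⟦⟧-* i j) (sym (*-cong (⟦⟧′≈⟦⟧ i) (⟦⟧′≈⟦⟧ j))))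
      ; -‿homo = λ i → trans (⟦⟧′≈⟦⟧ (ℤ.- i)) (trans (⟦⟧-neg i) (sym (-‿cong (⟦⟧′≈⟦⟧ i))))
      ; 0-homo = refl
      ; 1-homo = refl
      }

    coeff≟ : ∀ i j → Maybe (⟦ i ⟧′ ≈ ⟦ j ⟧′)
    coeff≟ i j with i ℤ.≟ j
    ... | yes i≡j = just (reflexive (≡.cong ⟦_⟧′ i≡j))
    ... | no  _   = nothing

  open Algebra.Solver.Ring ℤ-rawRing (fromCommutativeRing R) morphism coeff≟ public
    using (Polynomial; solve; _:=_; _:+_; _:*_; _:-_; :-_; con; _:^_)

  0R 1R 2R : ∀ {n} → Polynomial n
  0R = con (+ 0)
  1R = con (+ 1)
  2R = con (+ 2)

-- Stated over an abstract ring and later instantiated at ℂ, so that the solver never sees complex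
-- operations unfolded into pairs of reals.
module RingIdentities {c ℓ} (R : CommutativeRing c ℓ) where

  open CommutativeRing R
  open IntegerCoefficients R

  x≈x-0 : ∀ x → x ≈ x - 0#
  x≈x-0 = solve 1 (λ x → x := x :- 0R) refl

  0≈0*x-0 : ∀ x → 0# ≈ 0# * x - 0#
  0≈0*x-0 = solve 1 (λ x → 0R := 0R :* x :- 0R) refl

  x≈[x-y]+y : ∀ x y → x ≈ (x - y) + y
  x≈[x-y]+y = solve 2 (λ x y → x := (x :- y) :+ y) refl

  x≈y-[y-x] : ∀ x y → x ≈ y - (y - x)
  x≈y-[y-x] = solve 2 (λ x y → x := y :- (y :- x)) refl

  [x+y]-x≈y : ∀ x y → (x + y) - x ≈ y
  [x+y]-x≈y = solve 2 (λ x y → (x :+ y) :- x := y) refl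

  [x+y]-y≈x : ∀ x y → (x + y) - y ≈ x
  [x+y]-y≈x = solve 2 (λ x y → (x :+ y) :- y := x) refl

  -[x-y]≈-x--y : ∀ x y → - (x - y) ≈ - x - - y
  -[x-y]≈-x--y = solve 2 (λ x y → :- (x :- y) := :- x :- :- y) refl

  -[x-y]+[x-z]≈y-z : ∀ x y z → - (x - y) + (x - z) ≈ y - z
  -[x-y]+[x-z]≈y-z = solve 3 (λ x y z → :- (x :- y) :+ (x :- z) := y :- z) refl

  [x-z]-[y-z]≈x-y : ∀ x y z → (x - z) - (y - z) ≈ x - y
  [x-z]-[y-z]≈x-y = solve 3 (λ x y z → (x :- z) :- (y :- z) := x :- y) refl

  y-z≈[x+y]-[x+z] : ∀ x y z → y - z ≈ (x + y) - (x + z)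
  y-z≈[x+y]-[x+z] = solve 3 (λ x y z → y :- z := (x :+ y) :- (x :+ z)) refl

  [x-y]+[z-w]≈[x+z]-[y+w] : ∀ x y z w → (x - y) + (z - w) ≈ (x + z) - (y + w)
  [x-y]+[z-w]≈[x+z]-[y+w] = solve 4 (λ x y z w → (x :- y) :+ (z :- w) := (x :+ z) :- (y :+ w)) refl

  product-difference : ∀ u v l m → (u - l) * ((v - m) + m) + l * (v - m) ≈ u * v - l * m
  product-difference = solve 4 (λ u v l m → (u :- l) :* ((v :- m) :+ m) :+ l :* (v :- m) := u :* v :- l :* m) refl

  corner-step : ∀ a s t p q → a * (s - t) + (p * s - q) ≈ (a + p) * s - (a * t + q)
  corner-step = solve 5 (λ a s t p q → a :* (s :- t) :+ (p :* s :- q) := (a :+ p) :* s :- (a :* t :+ q)) refl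

  [x-1]*y≈x*y-y : ∀ x y → (x - 1#) * y ≈ x * y - y
  [x-1]*y≈x*y-y = solve 2 (λ x y → (x :- 1R) :* y := x :* y :- y) refl

  *-rotate : ∀ x y z w → (x * y) * (z * w) ≈ x * (z * (y * w))
  *-rotate = solve 4 (λ x y z w → (x :* y) :* (z :* w) := x :* (z :* (y :* w))) refl

  *-interchange : ∀ x y z w → (x * y) * (z * w) ≈ (x * z) * (y * w)
  *-interchange = solve 4 (λ x y z w → (x :* y) :* (z :* w) := (x :* z) :* (y :* w)) refl

-- Ordered field arithmetic without a decidable order.

module Order {c ℓ₁ ℓ₂} (ℝ : RealField c ℓ₁ ℓ₂) where

  open Analysis ℝ public
  module Coeff = IntegerCoefficients commutativeRing
  open Coeff public using (solve; _:=_; _:+_; _:*_; _:-_; :-_; _:^_; 0R; 1R; 2R)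
  open IsStrictPartialOrder isStrictPartialOrder public
    using () renaming (<-respʳ-≈ to <-respʳ; <-respˡ-≈ to <-respˡ; trans to <-trans; irrefl to <-irrefl)
  open CommutativeRing commutativeRing public using (commutativeSemiring)
  open SemiringMult semiring public using (×-homo-+; ×1-homo-*)

  <-asym : ∀ {x y} → x < y → ¬ y < x
  <-asym x<y y<x = <-irrefl refl (<-trans x<y y<x)

  <⇒≤ : ∀ {x y} → x < y → x ≤ y
  <⇒≤ = <-asym

  <⇒# : ∀ {x y} → x < y → x # y
  <⇒# x<y = Equivalence.from #⇔<⊎> (inj₁ x<y)

  #⇒<⊎> : ∀ {x y} → x # y → x < y ⊎ y < x
  #⇒<⊎> = Equivalence.to #⇔<⊎>

  -- The substitute for trichotomy: cotransitivity of apartness. It is what makes the negatively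
  -- defined `≤` compose with `<`.
  <-cotrans : ∀ {x y} → x < y → ∀ z → x < z ⊎ z < y
  <-cotrans x<y z with #-cotrans (<⇒# x<y) z
  ... | inj₁ x#z = [ inj₁ , (λ z<x → inj₂ (<-trans z<x x<y)) ]′ (#⇒<⊎> x#z)
  ... | inj₂ z#y = [ inj₂ , (λ y<z → inj₁ (<-trans x<y y<z)) ]′ (#⇒<⊎> z#y)

  ≤-<-trans : ∀ {x y z} → x ≤ y → y < z → x < z
  ≤-<-trans {x} x≤y y<z = [ (λ y<x → contradiction y<x x≤y) , (λ x<z → x<z) ]′ (<-cotrans y<z x)

  <-≤-trans : ∀ {x y z} → x < y → y ≤ z → x < z
  <-≤-trans {z = z} x<y y≤z = [ (λ x<z → x<z) , (λ z<y → contradiction z<y y≤z) ]′ (<-cotrans x<y z)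

  ≤-trans : ∀ {x y z} → x ≤ y → y ≤ z → x ≤ z
  ≤-trans x≤y y≤z z<x = y≤z (<-≤-trans z<x x≤y)

  ≤-refl : ∀ {x} → x ≤ x
  ≤-refl = <-irrefl refl

  ≤-reflexive : ∀ {x y} → x ≈ y → x ≤ y
  ≤-reflexive x≈y y<x = <-irrefl (sym x≈y) y<x

  ≤-resp : ∀ {x x′ y y′} → x ≈ x′ → y ≈ y′ → x ≤ y → x′ ≤ y′
  ≤-resp x≈x′ y≈y′ x≤y = ≤-trans (≤-reflexive (sym x≈x′)) (≤-trans x≤y (≤-reflexive y≈y′))

  ≤-antisym : ∀ {x y} → x ≤ y → y ≤ x → x ≈ y
  ≤-antisym x≤y y≤x = proj₁ (tight _ _) (λ x#y → [ y≤x , x≤y ]′ (#⇒<⊎> x#y))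

  ¬#⇒≈ : ∀ {x y} → ¬ x # y → x ≈ y
  ¬#⇒≈ = proj₁ (tight _ _)

  <⇒0<- : ∀ {x y} → x < y → 0# < y - x
  <⇒0<- {x} x<y = <-respˡ (-‿inverseʳ x) (+-monoˡ-< (- x) x<y)

  0<-⇒< : ∀ {x y} → 0# < y - x → x < y
  0<-⇒< {x} {y} 0<y-x = <-respʳ (solve 2 (λ x y → (y :- x) :+ x := y) refl x y)
    (<-respˡ (+-identityˡ x) (+-monoˡ-< x 0<y-x))

  ≤⇒0≤- : ∀ {x y} → x ≤ y → 0# ≤ y - x
  ≤⇒0≤- {x} {y} x≤y y-x<0 = x≤y (<-respʳ (+-identityˡ x)
    (<-respˡ (solve 2 (λ x y → (y :- x) :+ x := y) refl x y) (+-monoˡ-< x y-x<0)))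

  0≤-⇒≤ : ∀ {x y} → 0# ≤ y - x → x ≤ y
  0≤-⇒≤ {x} {y} 0≤y-x y<x = 0≤y-x (<-respʳ (-‿inverseʳ x) (+-monoˡ-< (- x) y<x))

  <-by : ∀ {x y e} → 0# < e → y - x ≈ e → x < y
  <-by 0<e eq = 0<-⇒< (<-respʳ (sym eq) 0<e)

  ≤-by : ∀ {x y e} → 0# ≤ e → y - x ≈ e → x ≤ y
  ≤-by 0≤e eq = 0≤-⇒≤ (≤-trans 0≤e (≤-reflexive (sym eq)))

  +-nonneg : ∀ {x y} → 0# ≤ x → 0# ≤ y → 0# ≤ x + y
  +-nonneg {x} {y} 0≤x 0≤y x+y<0 with <-cotrans x+y<0 x
  ... | inj₂ x<0   = 0≤x x<0
  ... | inj₁ x+y<x = 0≤y (<-by (<⇒0<- x+y<x) (solve 2 (λ x y → 0R :- y := x :- (x :+ y)) refl x y))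

  +-pos-nonneg : ∀ {x y} → 0# < x → 0# ≤ y → 0# < x + y
  +-pos-nonneg {x} {y} 0<x 0≤y = <-≤-trans 0<x (≤-by 0≤y (solve 2 (λ x y → (x :+ y) :- x := y) refl x y))

  +-mono-≤ : ∀ {x y u v} → x ≤ y → u ≤ v → x + u ≤ y + v
  +-mono-≤ {x} {y} {u} {v} x≤y u≤v = ≤-by (+-nonneg (≤⇒0≤- x≤y) (≤⇒0≤- u≤v))
    (solve 4 (λ x y u v → (y :+ v) :- (x :+ u) := (y :- x) :+ (v :- u)) refl x y u v)

  neg-pos : ∀ {x} → x < 0# → 0# < - x
  neg-pos {x} x<0 = <-respʳ (+-identityˡ (- x)) (<⇒0<- x<0)

  -- If `z` inverts `x * y`, then `y * z` inverts `x`, and invertible elements are apart from zero.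
  *#0⇒#0 : ∀ {x y} → x * y # 0# → x # 0#
  *#0⇒#0 {x} {y} xy#0 = invertible⇒# (y * z , left , trans (*-comm _ _) left)
    where
    z = proj₁ (#⇒invertible xy#0)
    left : y * z * (x - 0#) ≈ 1#
    left = trans (solve 3 (λ x y z → (y :* z) :* (x :- 0R) := z :* ((x :* y) :- 0R)) refl x y z)
                 (proj₁ (proj₂ (#⇒invertible xy#0)))

  #-respˡ : ∀ {x y z} → x ≈ y → x # z → y # z
  #-respˡ x≈y x#z = [ (λ l → Equivalence.from #⇔<⊎> (inj₁ (<-respˡ x≈y l)))
                    , (λ l → Equivalence.from #⇔<⊎> (inj₂ (<-respʳ x≈y l))) ]′ (#⇒<⊎> x#z)

  nonneg#0⇒pos : ∀ {x} → 0# ≤ x → x # 0# → 0# < x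
  nonneg#0⇒pos 0≤x x#0 = [ (λ x<0 → contradiction x<0 0≤x) , (λ 0<x → 0<x) ]′ (#⇒<⊎> x#0)

  -- No case split on the signs is available. Assuming `x * y < 0#`, both factors are apart from
  -- zero, hence positive, and their product is positive after all.
  *-nonneg : ∀ {x y} → 0# ≤ x → 0# ≤ y → 0# ≤ x * y
  *-nonneg {x} {y} 0≤x 0≤y xy<0 = <-asym xy<0 (*-pos
    (nonneg#0⇒pos 0≤x (*#0⇒#0 (<⇒# xy<0)))
    (nonneg#0⇒pos 0≤y (*#0⇒#0 (#-respˡ (*-comm x y) (<⇒# xy<0)))))

  sq-pos : ∀ {x} → x # 0# → 0# < x * x
  sq-pos {x} x#0 with #⇒<⊎> x#0
  ... | inj₂ 0<x = *-pos 0<x 0<x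
  ... | inj₁ x<0 = <-respʳ (solve 1 (λ x → (:- x) :* (:- x) := x :* x) refl x) (*-pos (neg-pos x<0) (neg-pos x<0))

  sq-nonneg : ∀ x → 0# ≤ x * x
  sq-nonneg x xx<0 = <-asym xx<0 (sq-pos (*#0⇒#0 (<⇒# xx<0)))

  *-monoˡ-≤ : ∀ {x y} z → 0# ≤ z → x ≤ y → z * x ≤ z * y
  *-monoˡ-≤ {x} {y} z 0≤z x≤y = ≤-by (*-nonneg 0≤z (≤⇒0≤- x≤y))
    (solve 3 (λ x y z → (z :* y) :- (z :* x) := z :* (y :- x)) refl x y z)

  *-mono-≤ : ∀ {x y u v} → 0# ≤ x → 0# ≤ u → x ≤ y → u ≤ v → x * u ≤ y * v
  *-mono-≤ {x} {y} {u} {v} 0≤x 0≤u x≤y u≤v = ≤-by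
    (+-nonneg (*-nonneg (≤⇒0≤- x≤y) (≤-trans 0≤u u≤v)) (*-nonneg 0≤x (≤⇒0≤- u≤v)))
    (solve 4 (λ x y u v → (y :* v) :- (x :* u) := ((y :- x) :* v) :+ (x :* (v :- u))) refl x y u v)

  *-monoˡ-< : ∀ {x y} z → 0# < z → x < y → z * x < z * y
  *-monoˡ-< {x} {y} z 0<z x<y = <-by (*-pos 0<z (<⇒0<- x<y))
    (solve 3 (λ x y z → (z :* y) :- (z :* x) := z :* (y :- x)) refl x y z)

  *-cancelˡ-≤ : ∀ {x y} z → 0# < z → z * x ≤ z * y → x ≤ y
  *-cancelˡ-≤ z 0<z zx≤zy y<x = zx≤zy (*-monoˡ-< z 0<z y<x)

  sq-cancel-≤ : ∀ {x y} → 0# ≤ y → x * x ≤ y * y → x ≤ y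
  sq-cancel-≤ {x} {y} 0≤y xx≤yy y<x = xx≤yy (≤-<-trans (*-monoˡ-≤ y 0≤y (<⇒≤ y<x))
    (<-respˡ (*-comm x y) (*-monoˡ-< x (≤-<-trans 0≤y y<x) y<x)))

  sq≈0⇒≈0 : ∀ {x} → x * x ≈ 0# → x ≈ 0#
  sq≈0⇒≈0 xx≈0 = ¬#⇒≈ (λ x#0 → <-irrefl (sym xx≈0) (sq-pos x#0))

  ^-nonneg : ∀ {x} n → 0# ≤ x → 0# ≤ x ^ n
  ^-nonneg zero    0≤x = <⇒≤ 0<1
  ^-nonneg (suc n) 0≤x = *-nonneg 0≤x (^-nonneg n 0≤x)

  ^-pos : ∀ {x} n → 0# < x → 0# < x ^ n
  ^-pos zero    0<x = 0<1
  ^-pos (suc n) 0<x = *-pos 0<x (^-pos n 0<x)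

  ^-mono-≤ : ∀ {x y} n → 0# ≤ x → x ≤ y → x ^ n ≤ y ^ n
  ^-mono-≤ zero    0≤x x≤y = ≤-refl
  ^-mono-≤ (suc n) 0≤x x≤y = *-mono-≤ 0≤x (^-nonneg n 0≤x) x≤y (^-mono-≤ n 0≤x x≤y)

  ^-mono-< : ∀ {x y} n → .{{ℕ.NonZero n}} → 0# ≤ x → x < y → x ^ n < y ^ n
  ^-mono-< {x} {y} (suc n) 0≤x x<y = ≤-<-trans (*-monoˡ-≤ x 0≤x (^-mono-≤ n 0≤x (<⇒≤ x<y)))
    (<-respʳ (*-comm _ _) (<-respˡ (*-comm _ _) (*-monoˡ-< (y ^ n) (^-pos n (≤-<-trans 0≤x x<y)) x<y)))

  ^-cancel-≤ : ∀ {x y} n → .{{ℕ.NonZero n}} → 0# ≤ y → x ^ n ≤ y ^ n → x ≤ y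
  ^-cancel-≤ n 0≤y xⁿ≤yⁿ y<x = xⁿ≤yⁿ (^-mono-< n 0≤y y<x)

  1≤^ : ∀ {x} n → 1# ≤ x → 1# ≤ x ^ n
  1≤^ zero    1≤x = ≤-refl
  1≤^ (suc n) 1≤x = ≤-trans (≤-reflexive (sym (*-identityˡ 1#)))
    (*-mono-≤ (<⇒≤ 0<1) (<⇒≤ 0<1) 1≤x (1≤^ n 1≤x))

  inv-* : ∀ x (x#0 : x # 0#) → inv x x#0 * x ≈ 1#
  inv-* x x#0 = trans (*-congˡ (solve 1 (λ x → x := x :- 0R) refl x)) (proj₁ (proj₂ (#⇒invertible x#0)))

  inv-pos : ∀ {x} (x#0 : x # 0#) → 0# < x → 0# < inv x x#0
  inv-pos {x} x#0 0<x with #⇒<⊎> (inv#0 x x#0)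
  ... | inj₂ 0<x⁻¹ = 0<x⁻¹
  ... | inj₁ x⁻¹<0 = contradiction
    (<-respʳ (trans (solve 2 (λ x y → (:- y) :* x := :- (y :* x)) refl x (inv x x#0)) (-‿cong (inv-* x x#0)))
             (*-pos (neg-pos x⁻¹<0) 0<x))
    (λ 0<-1 → <-asym 0<-1 (<-by 0<1 (solve 0 (0R :- (:- 1R) := 1R) refl)))

  fromℕ-nonneg : ∀ n → 0# ≤ fromℕ n
  fromℕ-nonneg zero    = ≤-refl
  fromℕ-nonneg (suc n) = <⇒≤ (0<fromℕ (suc n))

  fromℕ-mono-≤ : ∀ {m n} → m ℕ.≤ n → fromℕ m ≤ fromℕ n
  fromℕ-mono-≤ {n = n} ℕ.z≤n = fromℕ-nonneg n
  fromℕ-mono-≤ (ℕ.s≤s m≤n)   = +-mono-≤ ≤-refl (fromℕ-mono-≤ m≤n)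

  fromℕ-+ : ∀ m n → fromℕ (m ℕ.+ n) ≈ fromℕ m + fromℕ n
  fromℕ-+ = ×-homo-+ 1#

  fromℕ-* : ∀ m n → fromℕ (m ℕ.* n) ≈ fromℕ m * fromℕ n
  fromℕ-* = ×1-homo-*

  fromℤ≡⟦⟧ : ∀ k → fromℤ k ≡ Coeff.⟦ k ⟧
  fromℤ≡⟦⟧ (+ n)    = ≡.refl
  fromℤ≡⟦⟧ -[1+ n ] = ≡.refl

  fromℤ-+ : ∀ i j → fromℤ (i ℤ.+ j) ≈ fromℤ i + fromℤ j
  fromℤ-+ i j rewrite fromℤ≡⟦⟧ (i ℤ.+ j) | fromℤ≡⟦⟧ i | fromℤ≡⟦⟧ j = Coeff.⟦⟧-+ i j

  fromℤ-* : ∀ i j → fromℤ (i ℤ.* j) ≈ fromℤ i * fromℤ j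
  fromℤ-* i j rewrite fromℤ≡⟦⟧ (i ℤ.* j) | fromℤ≡⟦⟧ i | fromℤ≡⟦⟧ j = Coeff.⟦⟧-* i j

  -- If `y < x` with gap δ, the choice ε = δ / (1 + δ + K) satisfies ε ≤ 1 and ε K < δ,
  -- contradicting the hypothesis.
  ≤-up-to : ∀ {x y} K → 0# ≤ K → (∀ ε → 0# < ε → ε ≤ 1# → x ≤ y + ε * K) → x ≤ y
  ≤-up-to {x} {y} K 0≤K bound y<x = bound ε 0<ε ε≤1 y+εK<x
    where
    δ = x - y
    0<δ = <⇒0<- y<x
    b = 1# + δ + K
    0<b : 0# < b
    0<b = +-pos-nonneg (+-pos-nonneg 0<1 (<⇒≤ 0<δ)) 0≤K
    b#0 = pos⇒#0 0<b
    b⁻¹ = inv b b#0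
    0<b⁻¹ = inv-pos b#0 0<b
    ε = b⁻¹ * δ
    0<ε = *-pos 0<b⁻¹ 0<δ
    ε≤1 : ε ≤ 1#
    ε≤1 = ≤-trans (*-monoˡ-≤ {δ} {b} b⁻¹ (<⇒≤ 0<b⁻¹)
            (≤-by (+-nonneg (<⇒≤ 0<1) 0≤K)
              (solve 2 (λ d k → ((1R :+ d) :+ k) :- d := 1R :+ k) refl δ K)))
          (≤-reflexive (inv-* b b#0))
    εb≈δ : ε * b ≈ δ
    εb≈δ = trans (solve 3 (λ i d b → (i :* d) :* b := (i :* b) :* d) refl b⁻¹ δ b)
             (trans (*-congʳ (inv-* b b#0)) (*-identityˡ δ))
    y+εK<x : y + ε * K < x
    y+εK<x = <-by (+-pos-nonneg 0<ε (*-nonneg (<⇒≤ 0<ε) (<⇒≤ 0<δ)))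
      (trans (solve 4 (λ x y e k → x :- (y :+ (e :* k)) := (x :- y) :- (e :* k)) refl x y ε K)
        (trans (+-congʳ (sym εb≈δ))
          (solve 3 (λ e d k → (e :* ((1R :+ d) :+ k)) :- (e :* k) := e :+ (e :* d)) refl ε δ K)))

-- Complex numbers, norm bounds and limits.

module Complex {c ℓ₁ ℓ₂} (ℝ : RealField c ℓ₁ ℓ₂) where

  open Order ℝ public

  infix 4 _≈ℂ_

  record _≈ℂ_ (z w : ℂ) : Set ℓ₁ where
    constructor _,_
    field
      re≈ : proj₁ z ≈ proj₁ w
      im≈ : proj₂ z ≈ proj₂ w

  open _≈ℂ_ public

  -ℂ_ : ℂ → ℂ
  -ℂ (a , b) = - a , - b

  ℂ-commutativeRing : CommutativeRing c ℓ₁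
  ℂ-commutativeRing = record
    { Carrier = ℂ
    ; _≈_ = _≈ℂ_
    ; _+_ = _+ℂ_
    ; _*_ = _*ℂ_
    ; -_  = -ℂ_
    ; 0#  = 0ℂ
    ; 1#  = 1ℂ
    ; isCommutativeRing = record
      { isRing = record
        { +-isAbelianGroup = record
          { isGroup = record
            { isMonoid = record
              { isSemigroup = record
                { isMagma = record
                  { isEquivalence = record
                    { refl  = refl , refl
                    ; sym   = λ p → sym (re≈ p) , sym (im≈ p)
                    ; trans = λ p q → trans (re≈ p) (re≈ q) , trans (im≈ p) (im≈ q)
                    }
                  ; ∙-cong = λ p q → +-cong (re≈ p) (re≈ q) , +-cong (im≈ p) (im≈ q)
                  }
                ; assoc = λ _ _ _ → +-assoc _ _ _ , +-assoc _ _ _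
                }
              ; identity = (λ _ → +-identityˡ _ , +-identityˡ _) , (λ _ → +-identityʳ _ , +-identityʳ _)
              }
            ; inverse = (λ _ → -‿inverseˡ _ , -‿inverseˡ _) , (λ _ → -‿inverseʳ _ , -‿inverseʳ _)
            ; ⁻¹-cong = λ p → -‿cong (re≈ p) , -‿cong (im≈ p)
            }
          ; comm = λ _ _ → +-comm _ _ , +-comm _ _
          }
        ; *-cong = λ p q →
            +-cong (*-cong (re≈ p) (re≈ q)) (-‿cong (*-cong (im≈ p) (im≈ q))) ,
            +-cong (*-cong (re≈ p) (im≈ q)) (*-cong (im≈ p) (re≈ q))
        ; *-assoc = λ (a , b) (c , d) (e , f) →
            solve 6 (λ a b c d e f →
              ((a :* c) :- (b :* d)) :* e :- ((a :* d) :+ (b :* c)) :* f :=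
              a :* ((c :* e) :- (d :* f)) :- b :* ((c :* f) :+ (d :* e))) refl a b c d e f ,
            solve 6 (λ a b c d e f →
              ((a :* c) :- (b :* d)) :* f :+ ((a :* d) :+ (b :* c)) :* e :=
              a :* ((c :* f) :+ (d :* e)) :+ b :* ((c :* e) :- (d :* f))) refl a b c d e f
        ; *-identity =
            (λ (a , b) → solve 2 (λ a b → (1R :* a) :- (0R :* b) := a) refl a b ,
                         solve 2 (λ a b → (1R :* b) :+ (0R :* a) := b) refl a b) ,
            (λ (a , b) → solve 2 (λ a b → (a :* 1R) :- (b :* 0R) := a) refl a b ,
                         solve 2 (λ a b → (a :* 0R) :+ (b :* 1R) := b) refl a b)
        ; distrib =
            (λ (a , b) (c , d) (e , f) →
              solve 6 (λ a b c d e f → a :* (c :+ e) :- b :* (d :+ f) :=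
                ((a :* c) :- (b :* d)) :+ ((a :* e) :- (b :* f))) refl a b c d e f ,
              solve 6 (λ a b c d e f → a :* (d :+ f) :+ b :* (c :+ e) :=
                ((a :* d) :+ (b :* c)) :+ ((a :* f) :+ (b :* e))) refl a b c d e f) ,
            (λ (a , b) (c , d) (e , f) →
              solve 6 (λ a b c d e f → (c :+ e) :* a :- (d :+ f) :* b :=
                ((c :* a) :- (d :* b)) :+ ((e :* a) :- (f :* b))) refl a b c d e f ,
              solve 6 (λ a b c d e f → (c :+ e) :* b :+ (d :+ f) :* a :=
                ((c :* b) :+ (d :* a)) :+ ((e :* b) :+ (f :* a))) refl a b c d e f)
        }
      ; *-comm = λ (a , b) (c , d) →
          solve 4 (λ a b c d → (a :* c) :- (b :* d) := (c :* a) :- (d :* b)) refl a b c d ,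
          solve 4 (λ a b c d → (a :* d) :+ (b :* c) := (c :* b) :+ (d :* a)) refl a b c d
      }
    }

  module C = CommutativeRing ℂ-commutativeRing
  module I = RingIdentities ℂ-commutativeRing

  fromℝ : Carrier → ℂ
  fromℝ x = x , 0#

  conj : ℂ → ℂ
  conj (a , b) = a , - b

  ∥_∥² : ℂ → Carrier
  ∥ a , b ∥² = a * a + b * b

  ∥∥²-cong : ∀ {z w} → z ≈ℂ w → ∥ z ∥² ≈ ∥ w ∥²
  ∥∥²-cong p = +-cong (*-cong (re≈ p) (re≈ p)) (*-cong (im≈ p) (im≈ p))

  ∥∥²-nonneg : ∀ z → 0# ≤ ∥ z ∥²
  ∥∥²-nonneg (a , b) = +-nonneg (sq-nonneg a) (sq-nonneg b)

  ∥∥²-* : ∀ z w → ∥ z *ℂ w ∥² ≈ ∥ z ∥² * ∥ w ∥²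
  ∥∥²-* (a , b) (c , d) = solve 4 (λ a b c d →
    ((a :* c) :- (b :* d)) :* ((a :* c) :- (b :* d)) :+ ((a :* d) :+ (b :* c)) :* ((a :* d) :+ (b :* c)) :=
    ((a :* a) :+ (b :* b)) :* ((c :* c) :+ (d :* d))) refl a b c d

  ∥∥²≈0⇒≈0 : ∀ {z} → ∥ z ∥² ≈ 0# → z ≈ℂ 0ℂ
  ∥∥²≈0⇒≈0 {a , b} eq =
    sq≈0⇒≈0 (≤-antisym (≤-trans (≤-by (sq-nonneg b) (solve 2 (λ a b → ((a :* a) :+ (b :* b)) :- (a :* a) := b :* b) refl a b)) (≤-reflexive eq)) (sq-nonneg a)) ,
    sq≈0⇒≈0 (≤-antisym (≤-trans (≤-by (sq-nonneg a) (solve 2 (λ a b → ((a :* a) :+ (b :* b)) :- (b :* b) := a :* a) refl a b)) (≤-reflexive eq)) (sq-nonneg b))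

  infix 4 _≼_

  -- ∣ z ∣ ≤ r, without square roots.
  record _≼_ (z : ℂ) (r : Carrier) : Set (c ⊔ ℓ₁ ⊔ ℓ₂) where
    constructor _,_
    field
      radius-nonneg : 0# ≤ r
      norm≤         : ∥ z ∥² ≤ r * r

  open _≼_ public

  ≼-resp : ∀ {z w r s} → z ≈ℂ w → r ≈ s → z ≼ r → w ≼ s
  ≼-resp z≈w r≈s (0≤r , z≤r) =
    ≤-resp refl r≈s 0≤r , ≤-resp (∥∥²-cong z≈w) (*-cong r≈s r≈s) z≤r

  ≼-mono : ∀ {z r s} → z ≼ r → r ≤ s → z ≼ s
  ≼-mono (0≤r , z≤r) r≤s = ≤-trans 0≤r r≤s , ≤-trans z≤r (*-mono-≤ 0≤r 0≤r r≤s r≤s)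

  ≼-0 : 0ℂ ≼ 0#
  ≼-0 = ≤-refl , ≤-reflexive (solve 0 ((0R :* 0R) :+ (0R :* 0R) := 0R :* 0R) refl)

  ≼-1 : 1ℂ ≼ 1#
  ≼-1 = <⇒≤ 0<1 , ≤-reflexive (solve 0 ((1R :* 1R) :+ (0R :* 0R) := 1R :* 1R) refl)

  ≼-fromℝ : ∀ {x} → 0# ≤ x → fromℝ x ≼ x
  ≼-fromℝ {x} 0≤x = 0≤x , ≤-reflexive (solve 1 (λ x → (x :* x) :+ (0R :* 0R) := x :* x) refl x)

  ≼-* : ∀ {z w r s} → z ≼ r → w ≼ s → z *ℂ w ≼ r * s
  ≼-* {z} {w} {r} {s} (0≤r , z≤r) (0≤s , w≤s) = *-nonneg 0≤r 0≤s ,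
    ≤-resp (sym (∥∥²-* z w)) (solve 2 (λ r s → (r :* r) :* (s :* s) := (r :* s) :* (r :* s)) refl r s)
      (*-mono-≤ (∥∥²-nonneg z) (∥∥²-nonneg w) z≤r w≤s)

  -- The triangle inequality: the gap between (r + s)² and ∥z + w∥² is the sum of the gaps for `z`
  -- and `w` and twice the gap in `inner`.
  ≼-+ : ∀ {z w r s} → z ≼ r → w ≼ s → z +ℂ w ≼ r + s
  ≼-+ {z@(a , b)} {w@(c , d)} {r} {s} (0≤r , z≤r) (0≤s , w≤s) = +-nonneg 0≤r 0≤s ,
    ≤-by (+-nonneg (+-nonneg (≤⇒0≤- z≤r) (≤⇒0≤- w≤s)) (+-nonneg (≤⇒0≤- inner) (≤⇒0≤- inner)))
      (solve 6 (λ a b c d r s →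
        ((r :+ s) :* (r :+ s)) :- (((a :+ c) :* (a :+ c)) :+ ((b :+ d) :* (b :+ d))) :=
        (((r :* r) :- ((a :* a) :+ (b :* b))) :+ ((s :* s) :- ((c :* c) :+ (d :* d)))) :+
        (((r :* s) :- ((a :* c) :+ (b :* d))) :+ ((r :* s) :- ((a :* c) :+ (b :* d))))) refl a b c d r s)
    where
    -- Cauchy-Schwarz by Lagrange's identity: ∥z∥² ∥w∥² - (ac + bd)² = (ad - bc)².
    inner : a * c + b * d ≤ r * s
    inner = sq-cancel-≤ (*-nonneg 0≤r 0≤s) (≤-trans
      (≤-by (sq-nonneg (a * d - b * c)) (solve 4 (λ a b c d →
        (((a :* a) :+ (b :* b)) :* ((c :* c) :+ (d :* d))) :- (((a :* c) :+ (b :* d)) :* ((a :* c) :+ (b :* d))) :=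
        ((a :* d) :- (b :* c)) :* ((a :* d) :- (b :* c))) refl a b c d))
      (≤-resp refl (solve 2 (λ r s → (r :* r) :* (s :* s) := (r :* s) :* (r :* s)) refl r s)
        (*-mono-≤ (∥∥²-nonneg z) (∥∥²-nonneg w) z≤r w≤s)))

  ≼-neg : ∀ {z r} → z ≼ r → -ℂ z ≼ r
  ≼-neg {a , b} (0≤r , z≤r) = 0≤r , ≤-resp (solve 2 (λ a b → (a :* a) :+ (b :* b) := ((:- a) :* (:- a)) :+ ((:- b) :* (:- b))) refl a b) refl z≤r

  -- A crude radius, since n ≤ (1 + n)² for n ≥ 0; it avoids taking a square root of ∥z∥².
  ≼-bound : ∀ z → z ≼ 1# + ∥ z ∥²
  ≼-bound z = +-nonneg (<⇒≤ 0<1) n≥0 ,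
    ≤-by (+-nonneg (+-nonneg (<⇒≤ 0<1) n≥0) (*-nonneg n≥0 n≥0))
      (solve 1 (λ n → ((1R :+ n) :* (1R :+ n)) :- n := (1R :+ n) :+ (n :* n)) refl ∥ z ∥²)
    where n≥0 = ∥∥²-nonneg z

  -- Convergence up to an unspecified constant factor, which is what
  -- survives the limit laws without any epsilon bookkeeping.
  Lim : (ℕ → ℂ) → ℂ → Set (c ⊔ ℓ₁ ⊔ ℓ₂)
  Lim u l = ∃[ K ] (0# ≤ K × (∀ ε → 0# < ε → ε ≤ 1# → ∃[ N ] (∀ n → N ℕ.≤ n → u n +ℂ -ℂ l ≼ ε * K)))

  Lim-cong : ∀ {u v l} → (∀ n → u n ≈ℂ v n) → Lim u l → Lim v l
  Lim-cong u≈v (K , 0≤K , h) = K , 0≤K , λ ε 0<ε ε≤1 →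
    proj₁ (h ε 0<ε ε≤1) , λ n N≤n → ≼-resp (C.+-congʳ (u≈v n)) refl (proj₂ (h ε 0<ε ε≤1) n N≤n)

  Lim-unique : ∀ {u l m} → Lim u l → Lim u m → l ≈ℂ m
  Lim-unique {u} {l} {m} (K , 0≤K , h) (K′ , 0≤K′ , h′) =
    C.trans (I.x≈[x-y]+y l m)
      (C.trans (C.+-congʳ (∥∥²≈0⇒≈0 (≤-antisym
        (≤-up-to (L * L) (*-nonneg 0≤L 0≤L) bound) (∥∥²-nonneg _)))) (C.+-identityˡ m))
    where
    L = K + K′
    0≤L = +-nonneg 0≤K 0≤K′
    -- The squared distance is at most ε² L²; ε ≤ 1 makes this linear in ε, as `≤-up-to` requires.
    bound : ∀ ε → 0# < ε → ε ≤ 1# → ∥ l +ℂ -ℂ m ∥² ≤ 0# + ε * (L * L)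
    bound ε 0<ε ε≤1 = ≤-trans (norm≤ d)
      (≤-trans (≤-reflexive (solve 3 (λ e k k′ → ((e :* k) :+ (e :* k′)) :* ((e :* k) :+ (e :* k′)) := e :* (e :* ((k :+ k′) :* (k :+ k′)))) refl ε K K′))
      (≤-trans (*-monoˡ-≤ ε (<⇒≤ 0<ε)
        (≤-trans (*-mono-≤ (<⇒≤ 0<ε) (*-nonneg 0≤L 0≤L) ε≤1 ≤-refl) (≤-reflexive (*-identityˡ _))))
        (≤-reflexive (sym (+-identityˡ _)))))
      where
      N = proj₁ (h ε 0<ε ε≤1)
      N′ = proj₁ (h′ ε 0<ε ε≤1)
      n = N ℕ.+ N′
      d : l +ℂ -ℂ m ≼ ε * K + ε * K′
      d = ≼-resp (I.-[x-y]+[x-z]≈y-z (u n) l m) refl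
            (≼-+ (≼-neg (proj₂ (h ε 0<ε ε≤1) n (ℕ.m≤m+n N N′))) (proj₂ (h′ ε 0<ε ε≤1) n (ℕ.m≤n+m N′ N)))

  Lim-+ : ∀ {u v l m} → Lim u l → Lim v m → Lim (λ n → u n +ℂ v n) (l +ℂ m)
  Lim-+ {u} {v} {l} {m} (K , 0≤K , h) (K′ , 0≤K′ , h′) = K + K′ , +-nonneg 0≤K 0≤K′ , λ ε 0<ε ε≤1 →
    let N = proj₁ (h ε 0<ε ε≤1) ; N′ = proj₁ (h′ ε 0<ε ε≤1) in
    N ℕ.+ N′ , λ n N+N′≤n → ≼-resp
      (I.[x-y]+[z-w]≈[x+z]-[y+w] (u n) l (v n) m)
      (sym (distribˡ ε K K′))
      (≼-+ (proj₂ (h ε 0<ε ε≤1) n (ℕ.≤-trans (ℕ.m≤m+n N N′) N+N′≤n))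
           (proj₂ (h′ ε 0<ε ε≤1) n (ℕ.≤-trans (ℕ.m≤n+m N′ N) N+N′≤n)))

  Lim-neg : ∀ {u l} → Lim u l → Lim (λ n → -ℂ u n) (-ℂ l)
  Lim-neg {u} {l} (K , 0≤K , h) = K , 0≤K , λ ε 0<ε ε≤1 →
    proj₁ (h ε 0<ε ε≤1) , λ n N≤n → ≼-resp
      (I.-[x-y]≈-x--y (u n) l)
      refl (≼-neg (proj₂ (h ε 0<ε ε≤1) n N≤n))

  Lim-* : ∀ {u v l m} → Lim u l → Lim v m → Lim (λ n → u n *ℂ v n) (l *ℂ m)
  Lim-* {u} {v} {l} {m} (K , 0≤K , h) (K′ , 0≤K′ , h′) = K * (K′ + B) + A * K′ ,
    +-nonneg (*-nonneg 0≤K (+-nonneg 0≤K′ 0≤B)) (*-nonneg (radius-nonneg (≼-bound l)) 0≤K′) ,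
    λ ε 0<ε ε≤1 →
      let N = proj₁ (h ε 0<ε ε≤1) ; N′ = proj₁ (h′ ε 0<ε ε≤1) in
      N ℕ.+ N′ , λ n N+N′≤n →
        let du = proj₂ (h ε 0<ε ε≤1) n (ℕ.≤-trans (ℕ.m≤m+n N N′) N+N′≤n)
            dv = proj₂ (h′ ε 0<ε ε≤1) n (ℕ.≤-trans (ℕ.m≤n+m N′ N) N+N′≤n)
            -- The second error is also bounded by K′ alone, because ε ≤ 1. This keeps the product
            -- of the two errors linear in ε.
            dv′ = ≼-mono dv (≤-trans (*-mono-≤ (<⇒≤ 0<ε) 0≤K′ ε≤1 ≤-refl) (≤-reflexive (*-identityˡ K′)))
        in ≼-resp
          (I.product-difference (u n) (v n) l m)
          (solve 5 (λ e k k′ a b → ((e :* k) :* (k′ :+ b)) :+ (a :* (e :* k′)) := e :* ((k :* (k′ :+ b)) :+ (a :* k′))) refl ε K K′ A B)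
          (≼-+ (≼-* du (≼-+ dv′ (≼-bound m))) (≼-* (≼-bound l) dv))
    where
    A = 1# + ∥ l ∥²
    B = 1# + ∥ m ∥²
    0≤B = radius-nonneg (≼-bound m)

  sq-≤ : ∀ {x ε} → x ≤ ε → - x ≤ ε → x * x ≤ ε * ε
  sq-≤ {x} {ε} x≤ε -x≤ε = ≤-by (*-nonneg (≤⇒0≤- x≤ε) (≤⇒0≤- -x≤ε))
    (solve 2 (λ x e → (e :* e) :- (x :* x) := (e :- x) :* (e :- (:- x))) refl x ε)

  Within⇒sq-≤ : ∀ {ε x y} → Within ε x y → (x - y) * (x - y) ≤ ε * ε
  Within⇒sq-≤ {ε} {x} {y} (l , r) = sq-≤ (<⇒≤ l) (≤-trans (≤-reflexive (solve 2 (λ x y → :- (x :- y) := y :- x) refl x y)) (<⇒≤ r))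

  -- The constant 2 absorbs the two components: ε² + ε² ≤ (2ε)².
  ⟶⇒Lim : ∀ {u : ℕ → ℂ} {l} → (λ n → proj₁ (u n)) ⟶ proj₁ l → (λ n → proj₂ (u n)) ⟶ proj₂ l → Lim u l
  ⟶⇒Lim {u} {l} hr hi = fromℕ 2 , fromℕ-nonneg 2 , λ ε 0<ε ε≤1 →
    let N = proj₁ (hr ε 0<ε) ; N′ = proj₁ (hi ε 0<ε) in
    N ℕ.+ N′ , λ n N+N′≤n → *-nonneg (<⇒≤ 0<ε) (fromℕ-nonneg 2) ,
      ≤-trans (+-mono-≤ (Within⇒sq-≤ (proj₂ (hr ε 0<ε) n (ℕ.≤-trans (ℕ.m≤m+n N N′) N+N′≤n)))
                        (Within⇒sq-≤ (proj₂ (hi ε 0<ε) n (ℕ.≤-trans (ℕ.m≤n+m N′ N) N+N′≤n))))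
        (≤-by (+-nonneg (sq-nonneg ε) (sq-nonneg ε))
          (solve 1 (λ e → ((e :* 2R) :* (e :* 2R)) :- ((e :* e) :+ (e :* e)) := (e :* e) :+ (e :* e)) refl ε))

-- Cauchy products and the coefficients of the exponential series.

module Series {c ℓ} (R : CommutativeRing c ℓ) where

  open CommutativeRing R
  open SemiringMult semiring renaming (_×_ to _·_)
  open IntegerCoefficients R
  open SetoidReasoning setoid

  partialSum : (ℕ → Carrier) → ℕ → Carrier
  partialSum f zero    = 0#
  partialSum f (suc n) = f 0 + partialSum (f ∘ suc) n

  partialSum-last : ∀ f n → partialSum f (suc n) ≈ partialSum f n + f n
  partialSum-last f zero    = +-comm _ _
  partialSum-last f (suc n) = trans (+-congˡ (partialSum-last (f ∘ suc) n)) (sym (+-assoc _ _ _))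

  partialSum-cong : ∀ {f g} → (∀ n → f n ≈ g n) → ∀ n → partialSum f n ≈ partialSum g n
  partialSum-cong f≈g zero    = refl
  partialSum-cong f≈g (suc n) = +-cong (f≈g 0) (partialSum-cong (f≈g ∘ suc) n)

  convolution : (f g : ℕ → Carrier) → ℕ → Carrier
  convolution f g zero    = f 0 * g 0
  convolution f g (suc n) = f 0 * g (suc n) + convolution (f ∘ suc) g n

  -- The sum of `f i * g j` over i + j < n, arranged by rows. `triangle-last` peels off the
  -- antidiagonals instead, which are the terms of the Cauchy product.
  triangle : (f g : ℕ → Carrier) → ℕ → Carrier
  triangle f g zero    = 0#
  triangle f g (suc n) = f 0 * partialSum g (suc n) + triangle (f ∘ suc) g n

  triangle-last : ∀ f g n → triangle f g (suc n) ≈ triangle f g n + convolution f g n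
  triangle-last f g zero = solve 2 (λ a b → a :* (b :+ 0R) :+ 0R := 0R :+ a :* b) refl (f 0) (g 0)
  triangle-last f g (suc n) = begin
    f 0 * partialSum g (2 ℕ.+ n) + triangle (f ∘ suc) g (suc n)
      ≈⟨ +-cong (*-congˡ (partialSum-last g (suc n))) (triangle-last (f ∘ suc) g n) ⟩
    f 0 * (partialSum g (suc n) + g (suc n)) + (triangle (f ∘ suc) g n + convolution (f ∘ suc) g n)
      ≈⟨ solve 5 (λ a s b t d → a :* (s :+ b) :+ (t :+ d) := (a :* s :+ t) :+ (a :* b :+ d)) refl _ _ _ _ _ ⟩
    (f 0 * partialSum g (suc n) + triangle (f ∘ suc) g n) + (f 0 * g (suc n) + convolution (f ∘ suc) g n) ∎

  partialSum-convolution : ∀ f g n → partialSum (convolution f g) n ≈ triangle f g n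
  partialSum-convolution f g zero    = refl
  partialSum-convolution f g (suc n) = begin
    partialSum (convolution f g) (suc n)                  ≈⟨ partialSum-last _ n ⟩
    partialSum (convolution f g) n + convolution f g n    ≈⟨ +-congʳ (partialSum-convolution f g n) ⟩
    triangle f g n + convolution f g n                    ≈⟨ triangle-last f g n ⟨
    triangle f g (suc n)                                  ∎

  convolution-cong : ∀ {f f′ g g′} → (∀ n → f n ≈ f′ n) → (∀ n → g n ≈ g′ n) →
                     ∀ n → convolution f g n ≈ convolution f′ g′ n
  convolution-cong p q zero    = *-cong (p 0) (q 0)
  convolution-cong p q (suc n) = +-cong (*-cong (p 0) (q (suc n))) (convolution-cong (p ∘ suc) q n)

  convolution-last : ∀ f g n → convolution f g (suc n) ≈ convolution f (g ∘ suc) n + f (suc n) * g 0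
  convolution-last f g zero    = refl
  convolution-last f g (suc n) = trans (+-congˡ (convolution-last (f ∘ suc) g n)) (sym (+-assoc _ _ _))

  convolution-*ˡ : ∀ a f g n → convolution (λ k → a * f k) g n ≈ a * convolution f g n
  convolution-*ˡ a f g zero    = *-assoc _ _ _
  convolution-*ˡ a f g (suc n) = trans (+-cong (*-assoc _ _ _) (convolution-*ˡ a (f ∘ suc) g n)) (sym (distribˡ _ _ _))

  convolution-*ʳ : ∀ a f g n → convolution f (λ k → a * g k) n ≈ a * convolution f g n
  convolution-*ʳ a f g zero    = solve 3 (λ a b d → b :* (a :* d) := a :* (b :* d)) refl a (f 0) (g 0)
  convolution-*ʳ a f g (suc n) = trans
    (+-cong (solve 3 (λ a b d → b :* (a :* d) := a :* (b :* d)) refl a (f 0) (g (suc n))) (convolution-*ʳ a (f ∘ suc) g n))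
    (sym (distribˡ _ _ _))

  -- The Euler operator X d/dX acting on coefficient sequences; `convolution-θ` is its Leibniz rule.
  θ : (ℕ → Carrier) → ℕ → Carrier
  θ f n = n · 1# * f n

  convolution-θ : ∀ f g n → convolution (θ f) g n + convolution f (θ g) n ≈ n · 1# * convolution f g n
  convolution-θ f g zero = solve 2 (λ a b → (0R :* a) :* b :+ a :* (0R :* b) := 0R :* (a :* b)) refl (f 0) (g 0)
  convolution-θ f g (suc n) = begin
    (0# * f 0 * g (suc n) + convolution (θ f ∘ suc) g n) + (f 0 * (suc n · 1# * g (suc n)) + convolution f′ (θ g) n)
      ≈⟨ +-congʳ (+-congˡ shifted) ⟩
    (0# * f 0 * g (suc n) + (convolution f′ g n + convolution (θ f′) g n)) + (f 0 * (suc n · 1# * g (suc n)) + convolution f′ (θ g) n)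
      ≈⟨ solve 6 (λ a b d s p q → ((0R :* a) :* b :+ (d :+ p)) :+ (a :* (s :* b) :+ q) := a :* (s :* b) :+ d :+ (p :+ q)) refl
           (f 0) (g (suc n)) (convolution f′ g n) (suc n · 1#) (convolution (θ f′) g n) (convolution f′ (θ g) n) ⟩
    f 0 * (suc n · 1# * g (suc n)) + convolution f′ g n + (convolution (θ f′) g n + convolution f′ (θ g) n)
      ≈⟨ +-congˡ (convolution-θ f′ g n) ⟩
    f 0 * (suc n · 1# * g (suc n)) + convolution f′ g n + n · 1# * convolution f′ g n
      ≈⟨ solve 4 (λ a b d s → a :* ((1R :+ s) :* b) :+ d :+ s :* d := (1R :+ s) :* (a :* b :+ d)) refl
           (f 0) (g (suc n)) (convolution f′ g n) (n · 1#) ⟩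
    suc n · 1# * (f 0 * g (suc n) + convolution f′ g n) ∎
    where
    f′ = f ∘ suc
    convolution-+ : ∀ h k n → convolution (λ i → h i + k i) g n ≈ convolution h g n + convolution k g n
    convolution-+ h k zero = distribʳ _ _ _
    convolution-+ h k (suc n) = trans (+-cong (distribʳ _ _ _) (convolution-+ (h ∘ suc) (k ∘ suc) n))
      (solve 4 (λ a b d e → (a :+ b) :+ (d :+ e) := (a :+ d) :+ (b :+ e)) refl _ _ _ _)
    -- Shifting raises the weight by one: (k + 1) f(k + 1) = f′ k + k f′ k.
    shifted : convolution (θ f ∘ suc) g n ≈ convolution f′ g n + convolution (θ f′) g n
    shifted = trans (convolution-cong (λ k → solve 2 (λ s a → (1R :+ s) :* a := a :+ s :* a) refl (k · 1#) (f′ k)) (λ _ → refl) n)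
                    (convolution-+ f′ (θ f′) n)

  -- `u n` stands for 1/(n + 1), so that `term x n` is xⁿ/n!. With `u` as a parameter one
  -- development serves both ℝ and ℂ.
  module ExpTerms (u : ℕ → Carrier) (u-inverse : ∀ n → u n * (suc n · 1#) ≈ 1#) where

    term : Carrier → ℕ → Carrier
    term x zero    = 1#
    term x (suc n) = u n * (x * term x n)

    term-cong : ∀ {x y} → x ≈ y → ∀ n → term x n ≈ term y n
    term-cong x≈y zero    = refl
    term-cong x≈y (suc n) = *-congˡ (*-cong x≈y (term-cong x≈y n))

    θ-term : ∀ x n → θ (term x) (suc n) ≈ x * term x n
    θ-term x n = trans (sym (*-assoc _ _ _)) (trans (*-congʳ (trans (*-comm _ _) (u-inverse n))) (*-identityˡ _))

    -- Both sides c satisfy (n + 1) c(n + 1) = (x + y) c(n), because θ is a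
    -- derivation for convolution.
    term-convolution : ∀ x y n → convolution (term x) (term y) n ≈ term (x + y) n
    term-convolution x y zero    = *-identityˡ 1#
    term-convolution x y (suc n) = begin
      convolution (term x) (term y) (suc n)
        ≈⟨ *-identityˡ _ ⟨
      1# * convolution (term x) (term y) (suc n)
        ≈⟨ *-congʳ (u-inverse n) ⟨
      u n * (suc n · 1#) * convolution (term x) (term y) (suc n)
        ≈⟨ *-assoc _ _ _ ⟩
      u n * (suc n · 1# * convolution (term x) (term y) (suc n))
        ≈⟨ *-congˡ (convolution-θ (term x) (term y) (suc n)) ⟨
      u n * (convolution (θ (term x)) (term y) (suc n) + convolution (term x) (θ (term y)) (suc n))
        ≈⟨ *-congˡ (+-cong left right) ⟩
      u n * (x * convolution (term x) (term y) n + y * convolution (term x) (term y) n)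
        ≈⟨ *-congˡ (distribʳ _ _ _) ⟨
      u n * ((x + y) * convolution (term x) (term y) n)
        ≈⟨ *-congˡ (*-congˡ (term-convolution x y n)) ⟩
      u n * ((x + y) * term (x + y) n) ∎
      where
      left : convolution (θ (term x)) (term y) (suc n) ≈ x * convolution (term x) (term y) n
      left = begin
        0# * 1# * term y (suc n) + convolution (θ (term x) ∘ suc) (term y) n
          ≈⟨ solve 2 (λ a b → (0R :* 1R) :* a :+ b := b) refl _ _ ⟩
        convolution (θ (term x) ∘ suc) (term y) n
          ≈⟨ convolution-cong (θ-term x) (λ _ → refl) n ⟩
        convolution (λ k → x * term x k) (term y) n
          ≈⟨ convolution-*ˡ x (term x) (term y) n ⟩
        x * convolution (term x) (term y) n ∎
      right : convolution (term x) (θ (term y)) (suc n) ≈ y * convolution (term x) (term y) n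
      right = begin
        convolution (term x) (θ (term y)) (suc n)
          ≈⟨ convolution-last (term x) (θ (term y)) n ⟩
        convolution (term x) (θ (term y) ∘ suc) n + term x (suc n) * (0# * 1#)
          ≈⟨ solve 2 (λ a b → b :+ a :* (0R :* 1R) := b) refl _ _ ⟩
        convolution (term x) (θ (term y) ∘ suc) n
          ≈⟨ convolution-cong (λ _ → refl) (θ-term y) n ⟩
        convolution (term x) (λ k → y * term y k) n
          ≈⟨ convolution-*ʳ y (term x) (term y) n ⟩
        y * convolution (term x) (term y) n ∎

    -- The triangular part of a product of exponential partial sums is exactly a partial sum at
    -- `x + y`. Only the corner with i, j < n and i + j ≥ n is left to estimate.
    triangle-term : ∀ x y n → triangle (term x) (term y) n ≈ partialSum (term (x + y)) n
    triangle-term x y n = trans (sym (partialSum-convolution (term x) (term y) n)) (partialSum-cong (term-convolution x y) n)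

-- The functional equation of the exponential, and the unit circle.

module Exponential {c ℓ₁ ℓ₂} (ℝ : RealField c ℓ₁ ℓ₂) where

  open Complex ℝ public
  open SemiringMult C.semiring using () renaming (_×_ to _·ℂ_)
  module SR = Series commutativeRing
  module SC = Series ℂ-commutativeRing

  fromℝ-* : ∀ x y → fromℝ x *ℂ fromℝ y ≈ℂ fromℝ (x * y)
  fromℝ-* x y = solve 2 (λ x y → x :* y :- 0R :* 0R := x :* y) refl x y ,
                solve 2 (λ x y → x :* 0R :+ 0R :* y := 0R) refl x y

  fromℝ-+ : ∀ x y → fromℝ x +ℂ fromℝ y ≈ℂ fromℝ (x + y)
  fromℝ-+ x y = refl , +-identityˡ 0#

  ·ℂ1 : ∀ n → n ·ℂ 1ℂ ≈ℂ fromℝ (fromℕ n)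
  ·ℂ1 zero    = C.refl
  ·ℂ1 (suc n) = C.trans (C.+-congˡ (·ℂ1 n)) (fromℝ-+ 1# (fromℕ n))

  mesh-inverse : ∀ n → mesh n * fromℕ (suc n) ≈ 1#
  mesh-inverse n = inv-* _ _

  mesh-pos : ∀ n → 0# < mesh n
  mesh-pos n = inv-pos _ (0<fromℕ (suc n))

  open SR.ExpTerms mesh mesh-inverse using ()
    renaming (term to termR; triangle-term to triangle-termR)
  open SC.ExpTerms (λ n → fromℝ (mesh n))
    (λ n → C.trans (C.*-congˡ (·ℂ1 (suc n))) (C.trans (fromℝ-* (mesh n) (fromℕ (suc n))) (mesh-inverse n , refl))) public
    using (term; triangle-term; term-cong)

  inv-unique : ∀ {x y} (x#0 : x # 0#) → y * x ≈ 1# → y ≈ inv x x#0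
  inv-unique {x} {y} x#0 yx≈1 = begin
    y                      ≈⟨ *-identityʳ y ⟨
    y * 1#                 ≈⟨ *-congˡ (inv-* x x#0) ⟨
    y * (inv x x#0 * x)    ≈⟨ solve 3 (λ y i x → y :* (i :* x) := i :* (y :* x)) refl y (inv x x#0) x ⟩
    inv x x#0 * (y * x)    ≈⟨ *-congˡ yx≈1 ⟩
    inv x x#0 * 1#         ≈⟨ *-identityʳ _ ⟩
    inv x x#0              ∎
    where open SetoidReasoning (CommutativeRing.setoid commutativeRing)

  expTerm≈term : ∀ z n → (inv (fromℕ (n !)) (fromℕ#0 (n !) {{n ℕ.!≢0}}) , 0#) *ℂ z ^ℂ n ≈ℂ term z n
  expTerm≈term z zero    = C.trans (C.*-identityʳ _) (sym (inv-unique _ (trans (*-identityˡ _) (+-identityʳ 1#))) , refl)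
  expTerm≈term z (suc n) = begin
    fromℝ (1/! (suc n)) *ℂ (z *ℂ z ^ℂ n)
      ≈⟨ C.*-congʳ (C.sym (C.trans (fromℝ-* (mesh n) (1/! n)) (inv-unique _ inverse , refl))) ⟩
    (fromℝ (mesh n) *ℂ fromℝ (1/! n)) *ℂ (z *ℂ z ^ℂ n)
      ≈⟨ I.*-rotate
           (fromℝ (mesh n)) (fromℝ (1/! n)) z (z ^ℂ n) ⟩
    fromℝ (mesh n) *ℂ (z *ℂ (fromℝ (1/! n) *ℂ z ^ℂ n))
      ≈⟨ C.*-congˡ (C.*-congˡ (expTerm≈term z n)) ⟩
    fromℝ (mesh n) *ℂ (z *ℂ term z n) ∎
    where
    open SetoidReasoning C.setoid
    1/! : ℕ → Carrier
    1/! n = inv (fromℕ (n !)) (fromℕ#0 (n !) {{n ℕ.!≢0}})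
    inverse : mesh n * 1/! n * fromℕ (suc n !) ≈ 1#
    inverse = trans (*-congˡ (fromℕ-* (suc n) (n !)))
      (trans (solve 4 (λ m i s f → (m :* i) :* (s :* f) := (m :* s) :* (i :* f)) refl (mesh n) (1/! n) (fromℕ (suc n)) (fromℕ (n !)))
      (trans (*-cong (mesh-inverse n) (inv-* _ (fromℕ#0 (n !) {{n ℕ.!≢0}}))) (*-identityˡ 1#)))

  expPartialSum≈ : ∀ z n → expPartialSum z n ≈ℂ SC.partialSum (term z) n
  expPartialSum≈ z zero    = C.refl
  expPartialSum≈ z (suc n) = C.trans (C.+-cong (expPartialSum≈ z n) (expTerm≈term z n)) (C.sym (SC.partialSum-last (term z) n))

  ≼-tail : ∀ {g G} → (∀ n → g n ≼ G n) → ∀ {N M} → N ℕ.≤ M →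
           SC.partialSum g M +ℂ -ℂ SC.partialSum g N ≼ SR.partialSum G M - SR.partialSum G N
  ≼-tail {g} {G} g≼G {zero} {M} ℕ.z≤n = ≼-resp
    (I.x≈x-0 (SC.partialSum g M))
    (solve 1 (λ s → s := s :- 0R) refl (SR.partialSum G M))
    (≼-partialSum g≼G M)
    where
    ≼-partialSum : ∀ {g G} → (∀ n → g n ≼ G n) → ∀ n → SC.partialSum g n ≼ SR.partialSum G n
    ≼-partialSum g≼G zero    = ≼-0
    ≼-partialSum g≼G (suc n) = ≼-+ (g≼G 0) (≼-partialSum (g≼G ∘ suc) n)
  ≼-tail {g} {G} g≼G (ℕ.s≤s {N} {M} N≤M) = ≼-resp
    (I.y-z≈[x+y]-[x+z] (g 0) (SC.partialSum (g ∘ suc) M) (SC.partialSum (g ∘ suc) N))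
    (solve 3 (λ a s t → s :- t := (a :+ s) :- (a :+ t)) refl (G 0) (SR.partialSum (G ∘ suc) M) (SR.partialSum (G ∘ suc) N))
    (≼-tail (g≼G ∘ suc) N≤M)

  -- The difference consists of the terms `f i * g j` with i < N, j < M, i + j ≥ N, so termwise
  -- domination carries over. Row i contributes `f i` times a tail of `g`, which `≼-tail` bounds.
  ≼-corner : ∀ {f F g G} → (∀ n → f n ≼ F n) → (∀ n → g n ≼ G n) → ∀ {N M} → N ℕ.≤ M →
             SC.partialSum f N *ℂ SC.partialSum g M +ℂ -ℂ SC.triangle f g N ≼
             SR.partialSum F N * SR.partialSum G M - SR.triangle F G N
  ≼-corner {g = g} {G} f≼F g≼G {zero} {M} N≤M = ≼-resp
    (I.0≈0*x-0 (SC.partialSum g M))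
    (solve 1 (λ s → 0R := 0R :* s :- 0R) refl (SR.partialSum G M)) ≼-0
  ≼-corner {f} {F} {g} {G} f≼F g≼G {suc N} {M} N<M = ≼-resp
    (I.corner-step
        (f 0) (SC.partialSum g M) (SC.partialSum g (suc N)) (SC.partialSum (f ∘ suc) N) (SC.triangle (f ∘ suc) g N))
    (solve 5 (λ a s t p q → a :* (s :- t) :+ (p :* s :- q) := (a :+ p) :* s :- (a :* t :+ q)) refl
        (F 0) (SR.partialSum G M) (SR.partialSum G (suc N)) (SR.partialSum (F ∘ suc) N) (SR.triangle (F ∘ suc) G N))
    (≼-+ (≼-* (f≼F 0) (≼-tail g≼G N<M)) (≼-corner (f≼F ∘ suc) g≼G (ℕ.<⇒≤ N<M)))

  partialSum-nonneg : ∀ {F} → (∀ n → 0# ≤ F n) → ∀ n → 0# ≤ SR.partialSum F n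
  partialSum-nonneg 0≤F zero    = ≤-refl
  partialSum-nonneg 0≤F (suc n) = +-nonneg (0≤F 0) (partialSum-nonneg (0≤F ∘ suc) n)

  partialSum-mono : ∀ {F} → (∀ n → 0# ≤ F n) → ∀ {m n} → m ℕ.≤ n → SR.partialSum F m ≤ SR.partialSum F n
  partialSum-mono 0≤F {n = n} ℕ.z≤n = partialSum-nonneg 0≤F n
  partialSum-mono 0≤F (ℕ.s≤s m≤n)   = +-mono-≤ ≤-refl (partialSum-mono (0≤F ∘ suc) m≤n)

  -- From i < N and j < M follows i + j < N + M, and the additional terms of the triangle are
  -- nonnegative.
  square≤triangle : ∀ {F G} → (∀ n → 0# ≤ F n) → (∀ n → 0# ≤ G n) → ∀ N M →
                    SR.partialSum F N * SR.partialSum G M ≤ SR.triangle F G (N ℕ.+ M)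
  square≤triangle {F} {G} 0≤F 0≤G zero M = ≤-trans (≤-reflexive (zeroˡ _)) (triangle-nonneg 0≤F M)
    where
    triangle-nonneg : ∀ {F} → (∀ n → 0# ≤ F n) → ∀ n → 0# ≤ SR.triangle F G n
    triangle-nonneg 0≤F zero    = ≤-refl
    triangle-nonneg 0≤F (suc n) = +-nonneg (*-nonneg (0≤F 0) (partialSum-nonneg 0≤G (suc n))) (triangle-nonneg (0≤F ∘ suc) n)
  square≤triangle {F} {G} 0≤F 0≤G (suc N) M = ≤-trans (≤-reflexive (distribʳ _ _ _))
    (+-mono-≤ (*-monoˡ-≤ (F 0) (0≤F 0) (partialSum-mono 0≤G (ℕ.≤-trans (ℕ.m≤n+m M N) (ℕ.n≤1+n _))))
              (square≤triangle (0≤F ∘ suc) 0≤G N M))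

  termR-nonneg : ∀ {x} → 0# ≤ x → ∀ n → 0# ≤ termR x n
  termR-nonneg 0≤x zero    = <⇒≤ 0<1
  termR-nonneg 0≤x (suc n) = *-nonneg (<⇒≤ (mesh-pos n)) (*-nonneg 0≤x (termR-nonneg 0≤x n))

  term≼ : ∀ {z r} → z ≼ r → ∀ n → term z n ≼ termR r n
  term≼ z≼r zero    = ≼-1
  term≼ z≼r (suc n) = ≼-* (≼-fromℝ (<⇒≤ (mesh-pos n))) (≼-* z≼r (term≼ z≼r n))

  term-fromℝ : ∀ x n → term (fromℝ x) n ≈ℂ fromℝ (termR x n)
  term-fromℝ x zero    = C.refl
  term-fromℝ x (suc n) = C.trans (C.*-congˡ (C.trans (C.*-congˡ (term-fromℝ x n)) (fromℝ-* _ _))) (fromℝ-* _ _)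

  partialSum-fromℝ : ∀ {f F} → (∀ n → f n ≈ℂ fromℝ (F n)) → ∀ n → SC.partialSum f n ≈ℂ fromℝ (SR.partialSum F n)
  partialSum-fromℝ h zero    = C.refl
  partialSum-fromℝ h (suc n) = C.trans (C.+-cong (h 0) (partialSum-fromℝ (h ∘ suc) n)) (fromℝ-+ _ _)

  fromℝ≼⇒≤ : ∀ {x r} → fromℝ x ≼ r → x ≤ r
  fromℝ≼⇒≤ {x} (0≤r , x≤r) = sq-cancel-≤ 0≤r (≤-trans
    (≤-reflexive (solve 1 (λ x → x :* x := x :* x :+ 0R :* 0R) refl x)) x≤r)

  conj-cong : ∀ {z w} → z ≈ℂ w → conj z ≈ℂ conj w
  conj-cong p = re≈ p , -‿cong (im≈ p)

  conj-* : ∀ z w → conj z *ℂ conj w ≈ℂ conj (z *ℂ w)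
  conj-* (a , b) (c , d) =
    solve 4 (λ a b c d → a :* c :- (:- b) :* (:- d) := a :* c :- b :* d) refl a b c d ,
    solve 4 (λ a b c d → a :* (:- d) :+ (:- b) :* c := :- (a :* d :+ b :* c)) refl a b c d

  conj-+ : ∀ z w → conj z +ℂ conj w ≈ℂ conj (z +ℂ w)
  conj-+ (a , b) (c , d) = refl , solve 2 (λ b d → (:- b) :+ (:- d) := :- (b :+ d)) refl b d

  term-conj : ∀ z n → term (conj z) n ≈ℂ conj (term z n)
  term-conj z zero    = refl , solve 0 (0R := :- 0R) refl
  term-conj z (suc n) = C.trans
    (C.*-cong (refl , solve 0 (0R := :- 0R) refl) (C.trans (C.*-congˡ (term-conj z n)) (conj-* z (term z n))))
    (conj-* (fromℝ (mesh n)) (z *ℂ term z n))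

  partialSum-conj : ∀ {f g} → (∀ n → f n ≈ℂ conj (g n)) → ∀ n → SC.partialSum f n ≈ℂ conj (SC.partialSum g n)
  partialSum-conj h zero    = refl , solve 0 (0R := :- 0R) refl
  partialSum-conj h (suc n) = C.trans (C.+-cong (h 0) (partialSum-conj (h ∘ suc) n)) (conj-+ _ _)

  ≼-conj : ∀ {z r} → z ≼ r → conj z ≼ r
  ≼-conj {a , b} (0≤r , z≤r) = 0≤r , ≤-resp (solve 2 (λ a b → a :* a :+ b :* b := a :* a :+ (:- b) :* (:- b)) refl a b) refl z≤r

  Lim-conj : ∀ {u l} → Lim u l → Lim (λ n → conj (u n)) (conj l)
  Lim-conj {u} {l} (K , 0≤K , h) = K , 0≤K , λ ε 0<ε ε≤1 → proj₁ (h ε 0<ε ε≤1) , λ n N≤n →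
    ≼-resp (refl , solve 2 (λ b d → :- (b :+ (:- d)) := (:- b) :+ (:- (:- d))) refl (proj₂ (u n)) (proj₂ l)) refl
      (≼-conj (proj₂ (h ε 0<ε ε≤1) n N≤n))

  module _ (exp : ℂ → ℂ) (isExp : IsExp exp) where

    exp-Lim : ∀ z → Lim (SC.partialSum (term z)) (exp z)
    exp-Lim z = Lim-cong (expPartialSum≈ z) (⟶⇒Lim (proj₁ (isExp z)) (proj₂ (isExp z)))

    exp-cong : ∀ {z w} → z ≈ℂ w → exp z ≈ℂ exp w
    exp-cong {z} {w} z≈w = Lim-unique (exp-Lim z) (Lim-cong (SC.partialSum-cong (term-cong (C.sym z≈w))) (exp-Lim w))

    -- The error of the Cauchy product of the partial sums is dominated by a
    -- tail of the real exponential series at the sum of bounds for ∣z∣ and ∣w∣.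
    exp-+ : ∀ z w → exp (z +ℂ w) ≈ℂ exp z *ℂ exp w
    exp-+ z w = C.trans
      (I.x≈y-[y-x] (exp (z +ℂ w)) (exp z *ℂ exp w))
      (C.trans (C.+-congˡ (C.-‿cong error≈0))
        (C.sym (I.x≈x-0 (exp z *ℂ exp w))))
      where
      X = 1# + ∥ z ∥²
      Y = 1# + ∥ w ∥²
      0≤X = radius-nonneg (≼-bound z)
      0≤Y = radius-nonneg (≼-bound w)

      E : ℕ → Carrier
      E = SR.partialSum (termR (X + Y))

      error : ℕ → ℂ
      error n = SC.partialSum (term z) n *ℂ SC.partialSum (term w) n +ℂ -ℂ SC.partialSum (term (z +ℂ w)) n

      -- The n × n square of the dominating terms lies in the triangle of size 2n, whose sum is
      -- E(2n).
      error≼ : ∀ n → error n ≼ E (n ℕ.+ n) - E n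
      error≼ n = ≼-mono
        (≼-resp (C.+-congˡ (C.-‿cong (triangle-term z w n))) refl
          (≼-corner (term≼ (≼-bound z)) (term≼ (≼-bound w)) (ℕ.≤-refl {n})))
        (+-mono-≤ (≤-trans (square≤triangle (termR-nonneg 0≤X) (termR-nonneg 0≤Y) n n) (≤-reflexive (triangle-termR X Y (n ℕ.+ n))))
          (≤-reflexive (-‿cong (triangle-termR X Y n))))

      -- The dominating real series converges because `isExp` also covers the real point `X + Y`;
      -- its tails E(2n) - E(n) are then small.
      l : ℂ
      l = exp (fromℝ (X + Y))

      P : ℕ → ℂ
      P = SC.partialSum (term (fromℝ (X + Y)))

      P≈E : ∀ n → P n ≈ℂ fromℝ (E n)
      P≈E = partialSum-fromℝ (term-fromℝ (X + Y))

      P-difference : ∀ m n → P m +ℂ -ℂ P n ≈ℂ fromℝ (E m - E n)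
      P-difference m n = C.trans (C.+-cong (P≈E m) (C.-‿cong (P≈E n))) (refl , -‿inverseʳ 0#)

      E-difference≤ : ∀ {r} m n → P m +ℂ -ℂ l ≼ r → P n +ℂ -ℂ l ≼ r → E m - E n ≤ r + r
      E-difference≤ m n Pm Pn = fromℝ≼⇒≤ (≼-resp
        (C.trans (I.[x-z]-[y-z]≈x-y (P m) (P n) l) (P-difference m n)) refl (≼-+ Pm (≼-neg Pn)))

      error→0 : Lim P l → Lim error 0ℂ
      error→0 (K , 0≤K , h) = K + K , +-nonneg 0≤K 0≤K , λ ε 0<ε ε≤1 →
        proj₁ (h ε 0<ε ε≤1) , λ n N≤n → ≼-resp (I.x≈x-0 (error n)) refl
          (≼-mono (error≼ n) (≤-trans
            (E-difference≤ (n ℕ.+ n) n (proj₂ (h ε 0<ε ε≤1) (n ℕ.+ n) (ℕ.≤-trans N≤n (ℕ.m≤m+n n n))) (proj₂ (h ε 0<ε ε≤1) n N≤n))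
            (≤-reflexive (sym (distribˡ ε K K)))))

      error≈0 : exp z *ℂ exp w +ℂ -ℂ exp (z +ℂ w) ≈ℂ 0ℂ
      error≈0 = Lim-unique (Lim-+ (Lim-* (exp-Lim z) (exp-Lim w)) (Lim-neg (exp-Lim (z +ℂ w)))) (error→0 (exp-Lim (fromℝ (X + Y))))

    exp-conj : ∀ z → exp (conj z) ≈ℂ conj (exp z)
    exp-conj z = Lim-unique (exp-Lim (conj z)) (Lim-cong (λ n → C.sym (partialSum-conj (term-conj z) n)) (Lim-conj (exp-Lim z)))

    exp-0 : exp 0ℂ ≈ℂ 1ℂ
    exp-0 = Lim-unique (exp-Lim 0ℂ) (0# , ≤-refl , λ ε _ _ → 1 , λ where
        (suc n) (ℕ.s≤s _) → ≼-resp (C.sym (C.trans (C.+-congʳ (C.trans (C.+-congˡ (zeros n)) (C.+-identityʳ 1ℂ))) (C.-‿inverseʳ 1ℂ))) (sym (zeroʳ ε)) ≼-0)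
      where
      zeros : ∀ n → SC.partialSum (term 0ℂ ∘ suc) n ≈ℂ 0ℂ
      zeros n = C.trans (SC.partialSum-cong (λ k → C.trans (C.*-congˡ (C.zeroˡ _)) (C.zeroʳ _)) n) (all-0 n)
        where
        all-0 : ∀ n → SC.partialSum (λ _ → 0ℂ) n ≈ℂ 0ℂ
        all-0 zero    = C.refl
        all-0 (suc n) = C.trans (C.+-identityˡ _) (all-0 n)

    cis : Carrier → ℂ
    cis x = exp (0# , x)

    cis-cong : ∀ {x y} → x ≈ y → cis x ≈ℂ cis y
    cis-cong x≈y = exp-cong (refl , x≈y)

    cis-+ : ∀ x y → cis (x + y) ≈ℂ cis x *ℂ cis y
    cis-+ x y = C.trans (exp-cong (sym (+-identityˡ 0#) , refl)) (exp-+ (0# , x) (0# , y))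

    cis-neg : ∀ x → cis (- x) ≈ℂ conj (cis x)
    cis-neg x = exp-conj (0# , x)

    cis-unit : ∀ x → cis x *ℂ conj (cis x) ≈ℂ 1ℂ
    cis-unit x = C.trans (C.*-congˡ (C.sym (cis-neg x))) (C.trans (C.sym (cis-+ x (- x))) (C.trans (cis-cong (-‿inverseʳ x)) exp-0))

    cos sin : Carrier → Carrier
    cos x = proj₁ (cis x)
    sin x = proj₂ (cis x)

    cos²+sin²≈1 : ∀ x → cos x * cos x + sin x * sin x ≈ 1#
    cos²+sin²≈1 x = trans (solve 2 (λ a b → a :* a :+ b :* b := a :* a :- b :* (:- b)) refl (cos x) (sin x)) (re≈ (cis-unit x))

    -- With its converse below, this translates `IsPi`, which speaks of zeros of the sine, into
    -- statements about where `e` takes the value 1.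
    sin≈0⇒cis-double≈1 : ∀ {x} → sin x ≈ 0# → cis (x + x) ≈ℂ 1ℂ
    sin≈0⇒cis-double≈1 {x} sin≈0 = C.trans (cis-+ x x)
      ( trans (solve 2 (λ a b → a :* a :- b :* b := (a :* a :+ b :* b) :- 2R :* (b :* b)) refl (cos x) (sin x))
         (trans (+-cong (cos²+sin²≈1 x) (-‿cong (*-congˡ (*-congˡ sin≈0))))
           (solve 1 (λ b → 1R :- 2R :* (b :* 0R) := 1R) refl (sin x)))
      , trans (+-cong (*-congˡ sin≈0) (*-congʳ sin≈0)) (solve 1 (λ a → a :* 0R :+ 0R :* a := 0R) refl (cos x)))

    -- The real part of the hypothesis suffices: 2 sin² x = 1 - Re cis(2x).
    cis-double≈1⇒sin≈0 : ∀ {x} → cis (x + x) ≈ℂ 1ℂ → sin x ≈ 0#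
    cis-double≈1⇒sin≈0 {x} eq = sq≈0⇒≈0 (*-cancel-2 (begin
      fromℕ 2 * (sin x * sin x)
        ≈⟨ solve 2 (λ a b → 2R :* (b :* b) := (a :* a :+ b :* b) :- (a :* a :- b :* b)) refl (cos x) (sin x) ⟩
      (cos x * cos x + sin x * sin x) - (cos x * cos x - sin x * sin x)
        ≈⟨ +-cong (cos²+sin²≈1 x) (-‿cong (re≈ (C.trans (C.sym (cis-+ x x)) eq))) ⟩
      1# - 1#
        ≈⟨ -‿inverseʳ 1# ⟩
      0# ∎))
      where
      open SetoidReasoning (CommutativeRing.setoid commutativeRing)
      *-cancel-2 : ∀ {y} → fromℕ 2 * y ≈ 0# → y ≈ 0#
      *-cancel-2 {y} 2y≈0 = begin
        y                              ≈⟨ *-identityˡ y ⟨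
        1# * y                         ≈⟨ *-congʳ (mesh-inverse 1) ⟨
        mesh 1 * fromℕ 2 * y           ≈⟨ *-assoc _ _ _ ⟩
        mesh 1 * (fromℕ 2 * y)         ≈⟨ *-congˡ 2y≈0 ⟩
        mesh 1 * 0#                    ≈⟨ zeroʳ _ ⟩
        0#                             ∎

-- Counting coincidences between lists of lattice points.

_≟ᵛ_ : ∀ {n} (x y : ℤ^ n) → Dec (x ≡ y)
_≟ᵛ_ = Vec.≡-dec ℤ._≟_

δ : ∀ {n} → ℤ^ n → ℤ^ n → ℕ
δ x y with x ≟ᵛ y
... | yes _ = 1
... | no  _ = 0

matches₁ : ∀ {n} → ℤ^ n → List (ℤ^ n) → ℕ
matches₁ x []       = 0
matches₁ x (y ∷ ys) = δ x y ℕ.+ matches₁ x ys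

-- Counts with multiplicity, because it is also applied to sumsets, which are lists with
-- repetitions.
matches : ∀ {n} → List (ℤ^ n) → List (ℤ^ n) → ℕ
matches []       ys = 0
matches (x ∷ xs) ys = matches₁ x ys ℕ.+ matches xs ys

Bounded : ∀ {n} → ℕ → ℤ^ n → Set
Bounded B = AllV.All (λ a → ℤ.∣ a ∣ ℕ.≤ B)

-- Fourier analysis on the grid with spacing 1/q.

module Fourier {c ℓ₁ ℓ₂} (ℝ : RealField c ℓ₁ ℓ₂) where

  open Exponential ℝ public
  module ΣR = SemiringSum semiring
  module ΣC = SemiringSum C.semiring

  sumGridℂ : ∀ n m → (Vec (Fin n) m → ℂ) → ℂ
  sumGridℂ n zero    f = f []
  sumGridℂ n (suc m) f = ΣC.sum (λ i → sumGridℂ n m (λ j → f (i ∷ j)))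

  re-sum : ∀ {n} (f : Fin n → ℂ) → proj₁ (ΣC.sum f) ≡ sum (proj₁ ∘ f)
  re-sum {zero}  f = ≡.refl
  re-sum {suc n} f = ≡.cong (λ s → proj₁ (f Fin.zero) + s) (re-sum (f ∘ Fin.suc))

  re-sumGridℂ : ∀ n m f → proj₁ (sumGridℂ n m f) ≈ sumGrid n m (proj₁ ∘ f)
  re-sumGridℂ n zero    f = refl
  re-sumGridℂ n (suc m) f = trans (reflexive (re-sum (λ i → sumGridℂ n m (λ j → f (i ∷ j)))))
    (ΣR.sum-cong-≋ (λ i → re-sumGridℂ n m (λ j → f (i ∷ j))))

  sumGridℂ-cong : ∀ n m {f g} → (∀ j → f j ≈ℂ g j) → sumGridℂ n m f ≈ℂ sumGridℂ n m g
  sumGridℂ-cong n zero    f≈g = f≈g []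
  sumGridℂ-cong n (suc m) f≈g = ΣC.sum-cong-≋ (λ i → sumGridℂ-cong n m (λ j → f≈g (i ∷ j)))

  sumGridℂ-+ : ∀ n m f g → sumGridℂ n m (λ j → f j +ℂ g j) ≈ℂ sumGridℂ n m f +ℂ sumGridℂ n m g
  sumGridℂ-+ n zero    f g = C.refl
  sumGridℂ-+ n (suc m) f g = C.trans
    (ΣC.sum-cong-≋ (λ i → sumGridℂ-+ n m (λ j → f (i ∷ j)) (λ j → g (i ∷ j))))
    (ΣC.∑-distrib-+ (λ i → sumGridℂ n m (λ j → f (i ∷ j))) (λ i → sumGridℂ n m (λ j → g (i ∷ j))))

  sumGridℂ-* : ∀ n m z f → sumGridℂ n m (λ j → z *ℂ f j) ≈ℂ z *ℂ sumGridℂ n m f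
  sumGridℂ-* n zero    z f = C.refl
  sumGridℂ-* n (suc m) z f = C.trans (ΣC.sum-cong-≋ (λ i → sumGridℂ-* n m z (λ j → f (i ∷ j))))
    (C.sym (ΣC.*-distribˡ-sum z (λ i → sumGridℂ n m (λ j → f (i ∷ j)))))

  sumGrid-cong : ∀ n m {f g} → (∀ j → f j ≈ g j) → sumGrid n m f ≈ sumGrid n m g
  sumGrid-cong n zero    f≈g = f≈g []
  sumGrid-cong n (suc m) f≈g = ΣR.sum-cong-≋ (λ i → sumGrid-cong n m (λ j → f≈g (i ∷ j)))

  sumGrid-+ : ∀ n m f g → sumGrid n m (λ j → f j + g j) ≈ sumGrid n m f + sumGrid n m g
  sumGrid-+ n zero    f g = refl
  sumGrid-+ n (suc m) f g = trans
    (ΣR.sum-cong-≋ (λ i → sumGrid-+ n m (λ j → f (i ∷ j)) (λ j → g (i ∷ j))))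
    (ΣR.∑-distrib-+ (λ i → sumGrid n m (λ j → f (i ∷ j))) (λ i → sumGrid n m (λ j → g (i ∷ j))))

  sumGrid-* : ∀ n m x f → sumGrid n m (λ j → x * f j) ≈ x * sumGrid n m f
  sumGrid-* n zero    x f = refl
  sumGrid-* n (suc m) x f = trans (ΣR.sum-cong-≋ (λ i → sumGrid-* n m x (λ j → f (i ∷ j))))
    (sym (ΣR.*-distribˡ-sum x (λ i → sumGrid n m (λ j → f (i ∷ j)))))

  sumGrid-mono : ∀ n m {f g} → (∀ j → f j ≤ g j) → sumGrid n m f ≤ sumGrid n m g
  sumGrid-mono n zero    f≤g = f≤g []
  sumGrid-mono n (suc m) f≤g = sum-mono (λ i → sumGrid-mono n m (λ j → f≤g (i ∷ j)))
    where
    sum-mono : ∀ {k} {f g : Fin k → Carrier} → (∀ i → f i ≤ g i) → sum f ≤ sum g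
    sum-mono {zero}  f≤g = ≤-refl
    sum-mono {suc k} f≤g = +-mono-≤ (f≤g Fin.zero) (sum-mono (f≤g ∘ Fin.suc))
  
  module Average (n m : ℕ) where

    weight-nonneg : 0# ≤ mesh n ^ m
    weight-nonneg = ^-nonneg m (<⇒≤ (mesh-pos n))

    avg : (Vec (Fin (suc n)) m → Carrier) → Carrier
    avg f = mesh n ^ m * sumGrid (suc n) m f

    avg-cong : ∀ {f g} → (∀ j → f j ≈ g j) → avg f ≈ avg g
    avg-cong f≈g = *-congˡ (sumGrid-cong (suc n) m f≈g)

    avg-+ : ∀ f g → avg (λ j → f j + g j) ≈ avg f + avg g
    avg-+ f g = trans (*-congˡ (sumGrid-+ (suc n) m f g)) (distribˡ _ _ _)

    avg-* : ∀ x f → avg (λ j → x * f j) ≈ x * avg f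
    avg-* x f = trans (*-congˡ (sumGrid-* (suc n) m x f))
      (solve 3 (λ w x s → w :* (x :* s) := x :* (w :* s)) refl (mesh n ^ m) x (sumGrid (suc n) m f))

    avg-mono : ∀ {f g} → (∀ j → f j ≤ g j) → avg f ≤ avg g
    avg-mono f≤g = *-monoˡ-≤ _ weight-nonneg (sumGrid-mono (suc n) m f≤g)

    avg-nonneg : ∀ {f} → (∀ j → 0# ≤ f j) → 0# ≤ avg f
    avg-nonneg 0≤f = ≤-trans (≤-reflexive (sym (trans (avg-* 0# (λ _ → 0#)) (zeroˡ _))))
      (avg-mono (λ j → ≤-trans (≤-reflexive (zeroˡ 0#)) (0≤f j)))

    avgℂ : (Vec (Fin (suc n)) m → ℂ) → ℂ
    avgℂ f = fromℝ (mesh n ^ m) *ℂ sumGridℂ (suc n) m f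

    re-avgℂ : ∀ f → proj₁ (avgℂ f) ≈ avg (proj₁ ∘ f)
    re-avgℂ f = trans (solve 3 (λ w a b → w :* a :- 0R :* b := w :* a) refl (mesh n ^ m) _ (proj₂ (sumGridℂ (suc n) m f)))
      (*-congˡ (re-sumGridℂ (suc n) m f))

    avgℂ-cong : ∀ {f g} → (∀ j → f j ≈ℂ g j) → avgℂ f ≈ℂ avgℂ g
    avgℂ-cong f≈g = C.*-congˡ (sumGridℂ-cong (suc n) m f≈g)

    avgℂ-+ : ∀ f g → avgℂ (λ j → f j +ℂ g j) ≈ℂ avgℂ f +ℂ avgℂ g
    avgℂ-+ f g = C.trans (C.*-congˡ (sumGridℂ-+ (suc n) m f g)) (C.distribˡ _ _ _)

    avgℂ-0 : avgℂ (λ _ → 0ℂ) ≈ℂ 0ℂ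
    avgℂ-0 = C.trans (C.*-congˡ (C.trans (C.sym (sumGridℂ-cong (suc n) m (λ _ → C.zeroˡ 0ℂ)))
      (C.trans (sumGridℂ-* (suc n) m 0ℂ (λ _ → 0ℂ)) (C.zeroˡ _)))) (C.zeroʳ _)

  -- `z` is merely nonzero, which yields no inverse. But the conclusion is an equality of reals,
  -- which tightness of apartness allows to be proved by contradiction.
  integral-domainℂ : ∀ {z w} → ¬ z ≈ℂ 0ℂ → z *ℂ w ≈ℂ 0ℂ → w ≈ℂ 0ℂ
  integral-domainℂ {z} {w} z≉0 zw≈0 = ∥∥²≈0⇒≈0 (¬#⇒≈ (λ w#0 → z≉0 (∥∥²≈0⇒≈0 (¬#⇒≈ (λ z#0 →
    <-irrefl (sym product≈0) (*-pos (nonneg#0⇒pos (∥∥²-nonneg z) z#0) (nonneg#0⇒pos (∥∥²-nonneg w) w#0)))))))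
    where
    product≈0 : ∥ z ∥² * ∥ w ∥² ≈ 0#
    product≈0 = trans (sym (∥∥²-* z w)) (trans (∥∥²-cong zw≈0) (solve 0 (0R :* 0R :+ 0R :* 0R := 0R) refl))

  module Characters (exp : ℂ → ℂ) (isExp : IsExp exp) (π : Carrier) (isPi : IsPi exp π) where

    e : Carrier → ℂ
    e x = exp (0# , fromℕ 2 * π * x)

    e-cong : ∀ {x y} → x ≈ y → e x ≈ℂ e y
    e-cong x≈y = cis-cong exp isExp (*-congˡ x≈y)

    e-+ : ∀ x y → e (x + y) ≈ℂ e x *ℂ e y
    e-+ x y = C.trans (cis-cong exp isExp (distribˡ _ _ _)) (cis-+ exp isExp _ _)

    e-neg : ∀ x → e (- x) ≈ℂ conj (e x)
    e-neg x = C.trans (cis-cong exp isExp (solve 2 (λ p x → p :* (:- x) := :- (p :* x)) refl (fromℕ 2 * π) x)) (cis-neg exp isExp _)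

    e-0 : e 0# ≈ℂ 1ℂ
    e-0 = C.trans (cis-cong exp isExp (zeroʳ _)) (exp-0 exp isExp)

    e-1 : e 1# ≈ℂ 1ℂ
    e-1 = C.trans (cis-cong exp isExp (solve 1 (λ p → 2R :* p :* 1R := p :+ p) refl π))
      (sin≈0⇒cis-double≈1 exp isExp (proj₁ (proj₂ isPi)))

    e-ℕ : ∀ k → e (fromℕ k) ≈ℂ 1ℂ
    e-ℕ zero    = e-0
    e-ℕ (suc k) = C.trans (e-+ 1# (fromℕ k)) (C.trans (C.*-cong e-1 (e-ℕ k)) (C.*-identityˡ 1ℂ))

    e-ℤ : ∀ k → e (fromℤ k) ≈ℂ 1ℂ
    e-ℤ (+ n)    = e-ℕ n
    e-ℤ -[1+ n ] = C.trans (e-neg _) (C.trans (conj-cong (e-ℕ (suc n))) (refl , solve 0 (:- 0R := 0R) refl))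

    -- The minimality of π makes e(1/q) a primitive q-th root of unity.
    e≉1 : ∀ {x} → 0# < x → x < 1# → ¬ e x ≈ℂ 1ℂ
    e≉1 {x} 0<x x<1 ex≈1 = proj₂ (proj₂ isPi) (π * x)
      (*-pos 0<π 0<x)
      (<-respʳ (*-identityʳ π) (*-monoˡ-< π 0<π x<1))
      (cis-double≈1⇒sin≈0 exp isExp (C.trans
        (cis-cong exp isExp (solve 2 (λ p x → p :* x :+ p :* x := 2R :* p :* x) refl π x)) ex≈1))
      where 0<π = proj₁ isPi

    module Grid (n : ℕ) where

      q = suc n

      χ : ℤ → ℂ
      χ k = e (fromℤ k * mesh n)

      χ-+ : ∀ i j → χ (i ℤ.+ j) ≈ℂ χ i *ℂ χ j
      χ-+ i j = C.trans (e-cong (trans (*-congʳ (fromℤ-+ i j)) (distribʳ _ _ _))) (e-+ _ _)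

      χ-conj : ∀ i → χ (ℤ.- i) ≈ℂ conj (χ i)
      χ-conj i = C.trans (e-cong (trans (*-congʳ (fromℤ-neg i)) (solve 2 (λ a b → (:- a) :* b := :- (a :* b)) refl (fromℤ i) (mesh n)))) (e-neg _)
        where
        fromℤ-neg : ∀ i → fromℤ (ℤ.- i) ≈ - fromℤ i
        fromℤ-neg i rewrite fromℤ≡⟦⟧ (ℤ.- i) | fromℤ≡⟦⟧ i = Coeff.⟦⟧-neg i

      χ-0 : χ (+ 0) ≈ℂ 1ℂ
      χ-0 = C.trans (e-cong (zeroˡ _)) e-0

      χ-period : ∀ v → χ (v ℤ.* + q) ≈ℂ 1ℂ
      χ-period v = C.trans (e-cong (trans (*-congʳ (fromℤ-* v (+ q))) (trans (*-assoc _ _ _)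
        (trans (*-congˡ (trans (*-comm _ _) (mesh-inverse n))) (*-identityʳ _))))) (e-ℤ v)

      χ⁺≉1 : ∀ k → suc k ℕ.< q → ¬ χ (+ suc k) ≈ℂ 1ℂ
      χ⁺≉1 k k<q = e≉1 (*-pos (0<fromℕ (suc k)) (mesh-pos n))
        (<-respʳ (trans (*-comm _ _) (mesh-inverse n)) (<-respˡ (*-comm _ _) (<-respʳ (*-comm _ _)
          (*-monoˡ-< (mesh n) (mesh-pos n) (<-≤-trans (n<1+n (suc k)) (fromℕ-mono-≤ k<q))))))
        where
        n<1+n : ∀ k → fromℕ k < fromℕ (suc k)
        n<1+n k = <-by 0<1 (solve 1 (λ k → (1R :+ k) :- k := 1R) refl (fromℕ k))

      χ≉1 : ∀ v → v ≢ + 0 → ℤ.∣ v ∣ ℕ.< q → ¬ χ v ≈ℂ 1ℂ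
      χ≉1 (+ zero)  v≢0 _   χ≈1 = v≢0 ≡.refl
      χ≉1 (+ suc k) _   v<q χ≈1 = χ⁺≉1 k v<q χ≈1
      χ≉1 -[1+ k ]  _   v<q χ≈1 = χ⁺≉1 k v<q (C.trans (χ-conj -[1+ k ])
        (C.trans (conj-cong χ≈1) (refl , solve 0 (:- 0R := 0R) refl)))

      sumℂ-toℕ : ∀ k (f : ℕ → ℂ) → ΣC.sum {k} (f ∘ toℕ) ≈ℂ SC.partialSum f k
      sumℂ-toℕ zero    f = C.refl
      sumℂ-toℕ (suc k) f = C.+-congˡ (sumℂ-toℕ k (f ∘ suc))

      Σχ : ℤ → ℂ
      Σχ v = ΣC.sum {q} (λ i → χ (v ℤ.* + toℕ i))

      -- Multiplication by `χ v` shifts the summation index by one, and the term at index q equals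
      -- the one at index 0 by periodicity.
      Σχ-invariant : ∀ v → χ v *ℂ Σχ v ≈ℂ Σχ v
      Σχ-invariant v = begin
        χ v *ℂ Σχ v
          ≈⟨ ΣC.*-distribˡ-sum {q} (χ v) (f ∘ toℕ) ⟩
        ΣC.sum {q} (λ i → χ v *ℂ f (toℕ i))
          ≈⟨ ΣC.sum-cong-≋ {q} (λ i → C.sym (C.trans (C.reflexive (≡.cong χ (ℤ-suc (toℕ i)))) (χ-+ v _))) ⟩
        ΣC.sum {q} (f ∘ suc ∘ toℕ)
          ≈⟨ sumℂ-toℕ q (f ∘ suc) ⟩
        SC.partialSum (f ∘ suc) q
          ≈⟨ C.sym (I.[x+y]-x≈y (f 0) _) ⟩
        (f 0 +ℂ SC.partialSum (f ∘ suc) q) +ℂ -ℂ f 0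
          ≈⟨ C.+-cong (SC.partialSum-last f q) (C.-‿cong f0≈fq) ⟩
        (SC.partialSum f q +ℂ f q) +ℂ -ℂ f q
          ≈⟨ I.[x+y]-y≈x _ (f q) ⟩
        SC.partialSum f q
          ≈⟨ sumℂ-toℕ q f ⟨
        Σχ v ∎
        where
        open SetoidReasoning C.setoid
        f : ℕ → ℂ
        f k = χ (v ℤ.* + k)
        ℤ-suc : ∀ k → v ℤ.* + suc k ≡ v ℤ.+ v ℤ.* + k
        ℤ-suc k = ≡.trans (≡.cong (v ℤ.*_) (ℤ.pos-+ 1 k)) (≡.trans (ℤ.*-distribˡ-+ v (+ 1) (+ k)) (≡.cong (ℤ._+ v ℤ.* + k) (ℤ.*-identityʳ v)))
        f0≈fq : f 0 ≈ℂ f q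
        f0≈fq = C.trans (C.trans (C.reflexive (≡.cong χ (ℤ.*-zeroʳ v))) χ-0) (C.sym (χ-period v))

      -- Invariance gives (χ v - 1) Σχ v = 0, and the first factor is nonzero for 0 < |v| < q.
      Σχ≈0 : ∀ v → v ≢ + 0 → ℤ.∣ v ∣ ℕ.< q → Σχ v ≈ℂ 0ℂ
      Σχ≈0 v v≢0 v<q = integral-domainℂ {χ v +ℂ -ℂ 1ℂ}
        (λ z≈0 → χ≉1 v v≢0 v<q (C.trans (I.x≈[x-y]+y (χ v) 1ℂ)
                    (C.trans (C.+-congʳ z≈0) (C.+-identityˡ 1ℂ))))
        (C.trans (I.[x-1]*y≈x*y-y (χ v) (Σχ v))
          (C.trans (C.+-congʳ (Σχ-invariant v)) (C.-‿inverseʳ (Σχ v))))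

      Σχ0 : Σχ (+ 0) ≈ℂ fromℝ (fromℕ q)
      Σχ0 = C.trans (ΣC.sum-cong-≋ {q} (λ i → χ-0)) (C.trans (ΣC.sum-replicate q) (·ℂ1 q))

      character : ∀ {m} → ℤ^ m → Vec (Fin q) m → ℂ
      character []       []      = 1ℂ
      character (a ∷ as) (i ∷ j) = χ (a ℤ.* + toℕ i) *ℂ character as j

      character-+ : ∀ {m} (a b : ℤ^ m) j → character (Vec.zipWith ℤ._+_ a b) j ≈ℂ character a j *ℂ character b j
      character-+ []       []       []      = C.sym (C.*-identityˡ 1ℂ)
      character-+ (a ∷ as) (b ∷ bs) (i ∷ j) = C.trans
        (C.*-cong (C.trans (C.reflexive (≡.cong χ (ℤ.*-distribʳ-+ (+ toℕ i) a b))) (χ-+ (a ℤ.* + toℕ i) (b ℤ.* + toℕ i))) (character-+ as bs j))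
        (I.*-interchange _ _ _ _)

      corner : ∀ {m} → Vec (Fin q) m → Vector Carrier m
      corner j i = fromℕ (toℕ (lookup j i)) * mesh n

      e-dot : ∀ {m} (a : ℤ^ m) (j : Vec (Fin q) m) → e (dot a (corner j)) ≈ℂ character a j
      e-dot []       []      = e-0
      e-dot (a ∷ as) (i ∷ j) = C.trans (e-+ _ _) (C.*-cong
        (e-cong (trans (sym (*-assoc _ _ _)) (*-congʳ (sym (fromℤ-* a (+ toℕ i))))))
        (e-dot as j))

      corr : ∀ {m} → ℤ^ m → ℤ^ m → Vec (Fin q) m → ℂ
      corr a b j = character a j *ℂ conj (character b j)

      sumGridℂ-corr-∷ : ∀ {m} a b (as bs : ℤ^ m) →
        sumGridℂ q (suc m) (corr (a ∷ as) (b ∷ bs)) ≈ℂ Σχ (a ℤ.- b) *ℂ sumGridℂ q m (corr as bs)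
      sumGridℂ-corr-∷ {m} a b as bs = C.trans
        (ΣC.sum-cong-≋ {q} (λ i → C.trans (sumGridℂ-cong q m (λ j → factor i j)) (sumGridℂ-* q m (χ ((a ℤ.- b) ℤ.* + toℕ i)) (corr as bs))))
        (C.sym (ΣC.*-distribʳ-sum {q} (sumGridℂ q m (corr as bs)) (λ i → χ ((a ℤ.- b) ℤ.* + toℕ i))))
        where
        factor : ∀ i j → corr (a ∷ as) (b ∷ bs) (i ∷ j) ≈ℂ χ ((a ℤ.- b) ℤ.* + toℕ i) *ℂ corr as bs j
        factor i j = C.trans
          (C.*-congˡ (C.sym (conj-* (χ (b ℤ.* + toℕ i)) (character bs j))))
          (C.trans (I.*-interchange _ _ _ _)
          (C.*-congʳ (C.sym (C.trans (C.reflexive (≡.cong χ split)) (C.trans (χ-+ (a ℤ.* + toℕ i) (ℤ.- (b ℤ.* + toℕ i))) (C.*-congˡ (χ-conj (b ℤ.* + toℕ i))))))))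
          where
          split : (a ℤ.- b) ℤ.* + toℕ i ≡ a ℤ.* + toℕ i ℤ.+ ℤ.- (b ℤ.* + toℕ i)
          split = ≡.trans (ℤ.*-distribʳ-+ (+ toℕ i) a (ℤ.- b)) (≡.cong (λ x → a ℤ.* + toℕ i ℤ.+ x) (≡.sym (ℤ.neg-distribˡ-* b (+ toℕ i))))

      sumGridℂ-corr-≡ : ∀ {m} (a : ℤ^ m) → sumGridℂ q m (corr a a) ≈ℂ fromℝ (fromℕ q ^ m)
      sumGridℂ-corr-≡ [] = C.trans (C.*-identityˡ _) (refl , solve 0 (:- 0R := 0R) refl)
      sumGridℂ-corr-≡ (a ∷ as) = C.trans (sumGridℂ-corr-∷ a a as as) (C.trans
        (C.*-cong (C.trans (C.reflexive (≡.cong Σχ (ℤ.+-inverseʳ a))) Σχ0) (sumGridℂ-corr-≡ as))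
        (fromℝ-* _ _))

      hat : ∀ {m} → List (ℤ^ m) → Vec (Fin q) m → ℂ
      hat L j = List.foldr _+ℂ_ 0ℂ (List.map (λ a → character a j) L)

      module _ (B : ℕ) (2B<q : B ℕ.+ B ℕ.< q) where

        -- No aliasing: some coordinate of a - b is nonzero and of absolute value at most 2B < q, so
        -- its factor of the grid sum vanishes exactly.
        sumGridℂ-corr-≢ : ∀ {m} (a b : ℤ^ m) → a ≢ b → Bounded B a → Bounded B b → sumGridℂ q m (corr a b) ≈ℂ 0ℂ
        sumGridℂ-corr-≢ []       []       a≢b _ _ = contradiction ≡.refl a≢b
        sumGridℂ-corr-≢ (a ∷ as) (b ∷ bs) a≢b (pa AllV.∷ pas) (pb AllV.∷ pbs) with a ℤ.≟ b
        ... | yes ≡.refl = C.trans (sumGridℂ-corr-∷ a b as bs) (C.trans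
          (C.*-congˡ (sumGridℂ-corr-≢ as bs (λ as≡bs → a≢b (≡.cong (a ∷_) as≡bs)) pas pbs)) (C.zeroʳ _))
        ... | no a≢b′ = C.trans (sumGridℂ-corr-∷ a b as bs) (C.trans
          (C.*-congʳ (Σχ≈0 (a ℤ.- b) (λ a-b≡0 → a≢b′ (ℤ.i-j≡0⇒i≡j a b a-b≡0))
            (ℕ.≤-<-trans (ℤ.∣i-j∣≤∣i∣+∣j∣ a b) (ℕ.≤-<-trans (ℕ.+-mono-≤ pa pb) 2B<q)))) (C.zeroˡ _))

        module _ {m : ℕ} where

          open Average n m

          orthogonality : ∀ (a b : ℤ^ m) → Bounded B a → Bounded B b → avgℂ (corr a b) ≈ℂ fromℝ (fromℕ (δ a b))
          orthogonality a b pa pb with a ≟ᵛ b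
          ... | no a≢b = C.trans (C.*-congˡ (sumGridℂ-corr-≢ a b a≢b pa pb)) (C.zeroʳ _)
          ... | yes ≡.refl = C.trans (C.*-congˡ (sumGridℂ-corr-≡ a)) (C.trans (fromℝ-* _ _)
            (trans (mesh^-inverse m) (sym (+-identityʳ 1#)) , refl))
            where
            mesh^-inverse : ∀ m → mesh n ^ m * fromℕ q ^ m ≈ 1#
            mesh^-inverse zero    = *-identityˡ 1#
            mesh^-inverse (suc m) = trans (solve 4 (λ a b c d → (a :* b) :* (c :* d) := (a :* c) :* (b :* d)) refl _ _ _ _)
              (trans (*-cong (mesh-inverse n) (mesh^-inverse m)) (*-identityˡ 1#))

          avgℂ-hat₁ : ∀ a L → Bounded B a → All (Bounded B) L →
            avgℂ (λ j → character a j *ℂ conj (hat L j)) ≈ℂ fromℝ (fromℕ (matches₁ a L))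
          avgℂ-hat₁ a []      pa []         = C.trans (avgℂ-cong (λ j → C.trans (C.*-congˡ (refl , solve 0 (:- 0R := 0R) refl)) (C.zeroʳ _))) avgℂ-0
          avgℂ-hat₁ a (b ∷ L) pa (pb ∷ pL) = C.trans
            (avgℂ-cong (λ j → C.trans (C.*-congˡ (C.sym (conj-+ (character b j) (hat L j)))) (C.distribˡ _ _ _)))
            (C.trans (avgℂ-+ (corr a b) (λ j → character a j *ℂ conj (hat L j)))
            (C.trans (C.+-cong (orthogonality a b pa pb) (avgℂ-hat₁ a L pa pL))
            (C.trans (fromℝ-+ _ _) (sym (fromℕ-+ (δ a b) (matches₁ a L)) , refl))))

          -- Bilinear expansion and orthogonality. It is an exact identity on the grid, valid for
          -- lists with repetitions; hence the count by `matches`.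
          parseval : ∀ L L′ → All (Bounded B) L → All (Bounded B) L′ →
            avgℂ (λ j → hat L j *ℂ conj (hat L′ j)) ≈ℂ fromℝ (fromℕ (matches L L′))
          parseval []      L′ []        pL′ = C.trans (avgℂ-cong (λ j → C.zeroˡ _)) avgℂ-0
          parseval (a ∷ L) L′ (pa ∷ pL) pL′ = C.trans
            (avgℂ-cong (λ j → C.distribʳ _ _ _))
            (C.trans (avgℂ-+ (λ j → character a j *ℂ conj (hat L′ j)) (λ j → hat L j *ℂ conj (hat L′ j)))
            (C.trans (C.+-cong (avgℂ-hat₁ a L′ pa pL′) (parseval L L′ pL pL′))
            (C.trans (fromℝ-+ _ _) (sym (fromℕ-+ (matches₁ a L′) (matches L L′)) , refl))))

-- Sumsets, additive energy and coordinate bounds.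

_+ᵛ_ : ∀ {n} → ℤ^ n → ℤ^ n → ℤ^ n
_+ᵛ_ = Vec.zipWith ℤ._+_

sumset : ∀ {n} → List (ℤ^ n) → List (ℤ^ n) → List (ℤ^ n)
sumset = cartesianProductWith _+ᵛ_

energy : ∀ {n} → List (ℤ^ n) → ℕ
energy L = matches (sumset L L) (sumset L L)

δ-≡ : ∀ {n} (x : ℤ^ n) → δ x x ≡ 1
δ-≡ x with x ≟ᵛ x
... | yes _  = ≡.refl
... | no x≢x = contradiction ≡.refl x≢x

δ-≢ : ∀ {n} {x y : ℤ^ n} → x ≢ y → δ x y ≡ 0
δ-≢ {x = x} {y} x≢y with x ≟ᵛ y
... | yes x≡y = contradiction x≡y x≢y
... | no  _   = ≡.refl

matches₁-∉ : ∀ {n} {x : ℤ^ n} {L} → All (x ≢_) L → matches₁ x L ≡ 0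
matches₁-∉ []          = ≡.refl
matches₁-∉ (x≢y ∷ x∉L) = ≡.cong₂ ℕ._+_ (δ-≢ x≢y) (matches₁-∉ x∉L)

matches₁-∈ : ∀ {n} {x : ℤ^ n} {L} → Unique L → x ∈ˡ L → matches₁ x L ≡ 1
matches₁-∈ (y∉L ∷ uL) (here ≡.refl) = ≡.cong₂ ℕ._+_ (δ-≡ _) (matches₁-∉ y∉L)
matches₁-∈ (y∉L ∷ uL) (there x∈L)   =
  ≡.cong₂ ℕ._+_ (δ-≢ (λ x≡y → All.lookup y∉L x∈L (≡.sym x≡y))) (matches₁-∈ uL x∈L)

matches-⊆ : ∀ {n} {L L′ : List (ℤ^ n)} → Unique L′ → All (_∈ˡ L′) L → matches L L′ ≡ length L
matches-⊆ u []          = ≡.refl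
matches-⊆ u (x∈ ∷ L⊆L′) = ≡.cong₂ ℕ._+_ (matches₁-∈ u x∈) (matches-⊆ u L⊆L′)

Bounded-mono : ∀ {n B B′} {x : ℤ^ n} → B ℕ.≤ B′ → Bounded B x → Bounded B′ x
Bounded-mono B≤B′ = AllV.map (λ p → ℕ.≤-trans p B≤B′)

Bounded-+ : ∀ {n B} (x y : ℤ^ n) → Bounded B x → Bounded B y → Bounded (B ℕ.+ B) (x +ᵛ y)
Bounded-+ []      []      AllV.[]        AllV.[]        = AllV.[]
Bounded-+ (a ∷ x) (b ∷ y) (pa AllV.∷ px) (pb AllV.∷ py) =
  ℕ.≤-trans (ℤ.∣i+j∣≤∣i∣+∣j∣ a b) (ℕ.+-mono-≤ pa pb) AllV.∷ Bounded-+ x y px py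

Bounded-sumset : ∀ {n B} {L L′ : List (ℤ^ n)} → All (Bounded B) L → All (Bounded B) L′ →
                 All (Bounded (B ℕ.+ B)) (sumset L L′)
Bounded-sumset []        pL′ = []
Bounded-sumset {L = x ∷ L} (px ∷ pL) pL′ = All.++⁺ (All.map⁺ (All.map (λ {y} py → Bounded-+ x y px py) pL′)) (Bounded-sumset pL pL′)

bound-vec : ∀ {n} (x : ℤ^ n) → ∃[ B ] Bounded B x
bound-vec []      = 0 , AllV.[]
bound-vec (a ∷ x) with bound-vec x
... | B , p = ℤ.∣ a ∣ ℕ.+ B , (ℕ.m≤m+n ℤ.∣ a ∣ B AllV.∷ Bounded-mono (ℕ.m≤n+m B ℤ.∣ a ∣) p)

bound-list : ∀ {n} (L : List (ℤ^ n)) → ∃[ B ] All (Bounded B) L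
bound-list []      = 0 , []
bound-list (x ∷ L) with bound-vec x | bound-list L
... | B , p | B′ , p′ = B ℕ.+ B′ , (Bounded-mono (ℕ.m≤m+n B B′) p ∷ All.map (Bounded-mono (ℕ.m≤n+m B′ B)) p′)

-- The energy inequality for lists of points of A.

module EnergyBound {c ℓ₁ ℓ₂} (ℝ : RealField c ℓ₁ ℓ₂) where

  open Fourier ℝ public

  -- Test the hypothesis at x = b / v.
  discriminant : ∀ {b u v} → 0# ≤ b → 0# < v →
    (∀ x → 0# ≤ x → x * b + x * b ≤ u + x * x * v) → b * b ≤ u * v
  discriminant {b} {u} {v} 0≤b 0<v h = ≤-resp
    (trans (*-congˡ (inv-* v v#0)) (*-identityʳ _))
    refl
    (≤-by (*-nonneg (<⇒≤ 0<v) (≤⇒0≤- (h (b * v⁻¹) (*-nonneg 0≤b (<⇒≤ (inv-pos v#0 0<v))))))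
      (trans (solve 4 (λ b u i v → u :* v :- b :* b :* (i :* v) := u :* v :- b :* b :* (i :* v) :* (2R :- 1R)) refl b u v⁻¹ v)
      (trans (+-congˡ (-‿cong (*-congˡ (+-congˡ (-‿cong (sym (inv-* v v#0)))))))
        (solve 4 (λ b u i v → u :* v :- b :* b :* (i :* v) :* (2R :- i :* v) :=
           v :* ((u :+ (b :* i) :* (b :* i) :* v) :- ((b :* i) :* b :+ (b :* i) :* b))) refl b u v⁻¹ v))))
    where
    v#0 = pos⇒#0 0<v
    v⁻¹ = inv v v#0

  re-* : ∀ z w → proj₁ (z *ℂ conj w) * proj₁ (z *ℂ conj w) ≤ ∥ z ∥² * ∥ w ∥²
  re-* (a , b) (c , d) = ≤-by (sq-nonneg (a * d - b * c)) (solve 4 (λ a b c d →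
    (a :* a :+ b :* b) :* (c :* c :+ d :* d) :- (a :* c :- b :* (:- d)) :* (a :* c :- b :* (:- d)) :=
    (a :* d :- b :* c) :* (a :* d :- b :* c)) refl a b c d)

  re-conj : ∀ z → proj₁ (z *ℂ conj z) ≈ ∥ z ∥²
  re-conj (a , b) = solve 2 (λ a b → a :* a :- b :* (:- b) := a :* a :+ b :* b) refl a b

  -- The inequality of arithmetic and geometric means for r s and x² r, where s = ∥z∥². After
  -- squaring, the gap is the square of r (s - x²), so ∣z∣ itself never appears. Averaged and fed to
  -- `discriminant`, it becomes a weighted Cauchy-Schwarz inequality.
  young : ∀ z w {r} x → 0# ≤ x → 0# ≤ r → r * r ≈ ∥ w ∥² →
          x * proj₁ (z *ℂ conj w) + x * proj₁ (z *ℂ conj w) ≤ r * ∥ z ∥² + x * x * r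
  young z w {r} x 0≤x 0≤r rr≈ = sq-cancel-≤
    (+-nonneg (*-nonneg 0≤r (∥∥²-nonneg z)) (*-nonneg (sq-nonneg x) 0≤r))
    (≤-trans
      (≤-trans (≤-reflexive (solve 2 (λ x p → (x :* p :+ x :* p) :* (x :* p :+ x :* p) := (2R :* x) :* (2R :* x) :* (p :* p)) refl x (proj₁ (z *ℂ conj w))))
        (≤-trans (*-monoˡ-≤ _ (sq-nonneg (fromℕ 2 * x)) (re-* z w)) (≤-reflexive (*-congˡ (*-congˡ (sym rr≈))))))
      (≤-by (sq-nonneg (r * (∥ z ∥² - x * x)))
        (solve 3 (λ r s x → (r :* s :+ x :* x :* r) :* (r :* s :+ x :* x :* r) :- (2R :* x) :* (2R :* x) :* (s :* (r :* r)) :=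
          (r :* (s :- x :* x)) :* (r :* (s :- x :* x))) refl r ∥ z ∥² x)))

  young′ : ∀ a b x → x * (a * b) + x * (a * b) ≤ b * b + x * x * (a * a)
  young′ a b x = ≤-by (sq-nonneg (b - x * a))
    (solve 3 (λ a b x → (b :* b :+ x :* x :* (a :* a)) :- (x :* (a :* b) :+ x :* (a :* b)) := (b :- x :* a) :* (b :- x :* a)) refl a b x)

  module _ (exp : ℂ → ℂ) (isExp : IsExp exp) (π : Carrier) (isPi : IsPi exp π) where

    open Characters exp isExp π isPi

    module _ (n m : ℕ) where

      open Grid n
      open Average n m

      hat-++ : ∀ (L L′ : List (ℤ^ m)) j → hat (L ++ L′) j ≈ℂ hat L j +ℂ hat L′ j
      hat-++ []      L′ j = C.sym (C.+-identityˡ _)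
      hat-++ (a ∷ L) L′ j = C.trans (C.+-congˡ (hat-++ L L′ j)) (C.sym (C.+-assoc _ _ _))

      hat-map-+ : ∀ (a : ℤ^ m) L j → hat (List.map (a +ᵛ_) L) j ≈ℂ character a j *ℂ hat L j
      hat-map-+ a []      j = C.sym (C.zeroʳ _)
      hat-map-+ a (b ∷ L) j = C.trans (C.+-cong (character-+ a b j) (hat-map-+ a L j)) (C.sym (C.distribˡ _ _ _))

      hat-sumset : ∀ (L L′ : List (ℤ^ m)) j → hat (sumset L L′) j ≈ℂ hat L j *ℂ hat L′ j
      hat-sumset []      L′ j = C.sym (C.zeroˡ _)
      hat-sumset (a ∷ L) L′ j = C.trans (hat-++ (List.map (a +ᵛ_) L′) (sumset L L′) j)
        (C.trans (C.+-cong (hat-map-+ a L′ j) (hat-sumset L L′ j)) (C.sym (C.distribʳ _ _ _)))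

      -- Here `F` is |Â| on the grid. Since |L̂|⁴ is the squared modulus of the transform of the
      -- sumset, whose coordinates reach 2B, exact orthogonality for it asks for 4B < q.
      grid-energy-bound : ∀ B → (B ℕ.+ B) ℕ.+ (B ℕ.+ B) ℕ.< q →
        ∀ {A L : List (ℤ^ m)} → All (Bounded B) A → All (Bounded B) L →
        Unique A → All (_∈ˡ A) L → 0 ℕ.< length A →
        ∀ (F : Vec (Fin q) m → Carrier) → (∀ j → 0# ≤ F j) → (∀ j → F j * F j ≈ ∥ hat A j ∥²) →
        ∀ V → 0# < V → avg F ≤ V →
        let b = fromℕ (length L) in
        (b * b) * (b * b) ≤ (fromℕ (energy L) * fromℕ (length A)) * (V * V)
      grid-energy-bound B 4B<q {A} {L} pA pL uA L⊆A 0<A F 0≤F FF V 0<V avgF≤V = ≤-trans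
        (*-mono-≤ (*-nonneg 0≤b 0≤b) (*-nonneg 0≤b 0≤b) bb≤UV bb≤UV)
        (≤-trans (≤-reflexive (solve 2 (λ u v → (u :* v) :* (u :* v) := (v :* v) :* (u :* u)) refl U V))
        (≤-trans (*-monoˡ-≤ _ (sq-nonneg V) UU≤) (≤-reflexive (*-comm _ _))))
        where
        b = fromℕ (length L)
        0≤b = fromℕ-nonneg (length L)
        2B<q : B ℕ.+ B ℕ.< q
        2B<q = ℕ.≤-<-trans (ℕ.m≤m+n (B ℕ.+ B) (B ℕ.+ B)) 4B<q
        L² = sumset L L

        G : Vec (Fin q) m → Carrier
        G j = ∥ hat L j ∥²

        U = avg (λ j → F j * G j)

        0≤U : 0# ≤ U
        0≤U = avg-nonneg (λ j → *-nonneg (0≤F j) (∥∥²-nonneg (hat L j)))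

        b≈ : avg (λ j → proj₁ (hat L j *ℂ conj (hat A j))) ≈ b
        b≈ = trans (sym (re-avgℂ (λ j → hat L j *ℂ conj (hat A j)))) (trans (re≈ (parseval B 2B<q L A pL pA))
          (reflexive (≡.cong fromℕ (matches-⊆ uA L⊆A))))

        avgFF : avg (λ j → F j * F j) ≈ fromℕ (length A)
        avgFF = trans (avg-cong (λ j → trans (FF j) (sym (re-conj (hat A j)))))
          (trans (sym (re-avgℂ (λ j → hat A j *ℂ conj (hat A j)))) (trans (re≈ (parseval B 2B<q A A pA pA))
          (reflexive (≡.cong fromℕ (matches-⊆ uA (All.tabulate (λ x → x)))))))

        avgGG : avg (λ j → G j * G j) ≈ fromℕ (energy L)
        avgGG = trans (avg-cong (λ j → trans (sym (∥∥²-* (hat L j) (hat L j)))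
            (trans (∥∥²-cong (C.sym (hat-sumset L L j))) (sym (re-conj (hat L² j))))))
          (trans (sym (re-avgℂ (λ j → hat L² j *ℂ conj (hat L² j))))
            (re≈ (parseval (B ℕ.+ B) 4B<q L² L² (Bounded-sumset pL pL) (Bounded-sumset pL pL))))

        avg-young : ∀ x (f g h : Vec (Fin q) m → Carrier) →
          (∀ j → x * f j + x * f j ≤ g j + x * x * h j) → x * avg f + x * avg f ≤ avg g + x * x * avg h
        avg-young x f g h p = ≤-resp
          (trans (avg-+ (λ j → x * f j) (λ j → x * f j)) (+-cong (avg-* x f) (avg-* x f)))
          (trans (avg-+ g (λ j → x * x * h j)) (+-congˡ (avg-* (x * x) h)))
          (avg-mono p)

        -- Cauchy-Schwarz with weight `F`. The positive `V` stands in for `avg F`, because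
        -- `discriminant` divides by it.
        bb≤UV : b * b ≤ U * V
        bb≤UV = discriminant 0≤b 0<V (λ x 0≤x → ≤-trans
          (≤-resp (+-cong (*-congˡ b≈) (*-congˡ b≈)) refl
            (avg-young x (λ j → proj₁ (hat L j *ℂ conj (hat A j))) (λ j → F j * G j) F (λ j → young (hat L j) (hat A j) x 0≤x (0≤F j) (FF j))))
          (+-mono-≤ ≤-refl (*-monoˡ-≤ (x * x) (sq-nonneg x) avgF≤V)))

        -- Plain Cauchy-Schwarz; the averages of G² and F² are the energy of `L` and the size of `A`
        -- by Parseval.
        UU≤ : U * U ≤ fromℕ (energy L) * fromℕ (length A)
        UU≤ = discriminant 0≤U (0<fromℕ (length A) {{ℕ.>-nonZero 0<A}}) (λ x 0≤x →
          ≤-resp refl (+-cong avgGG (*-congˡ avgFF))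
            (avg-young x (λ j → F j * G j) (λ j → G j * G j) (λ j → F j * F j) (λ j → young′ (F j) (G j) x)))

  module _ {m : ℕ} {A : FiniteSet (ℤ^ m)} (A≢∅ : Nonempty A) {N : Carrier} (norm : IsFourierL1Norm A N) where

    open IsFourierL1Norm norm using (exp; isExp; π; isPi; ∣Â∣; isModulus; isIntegral)
    open FiniteSet A renaming (elements to As)

    open Characters exp isExp π isPi

    private
      0<∣A∣ : 0 ℕ.< length As
      0<∣A∣ with As | proj₂ A≢∅
      ... | _ ∷ _ | _ = ℕ.s≤s ℕ.z≤n

      F : ∀ n → Vec (Fin (suc n)) m → Carrier
      F n j = ∣Â∣ (Grid.corner n j)

      0≤F : ∀ n j → 0# ≤ F n j
      0≤F n j = proj₁ (isModulus (Grid.corner n j))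

      FF : ∀ n j → F n j * F n j ≈ ∥ Grid.hat n As j ∥²
      FF n j = trans (solve 1 (λ x → x :* x := x :* (x :* 1R)) refl (F n j))
        (trans (proj₂ (isModulus (Grid.corner n j)))
        (trans (solve 2 (λ a b → a :* (a :* 1R) :+ b :* (b :* 1R) := a :* a :+ b :* b) refl _ _)
          (∥∥²-cong (hat≈ As))))
        where
        hat≈ : ∀ L → List.foldr _+ℂ_ 0ℂ (List.map (λ a → e (dot a (Grid.corner n j))) L) ≈ℂ Grid.hat n L j
        hat≈ []      = C.refl
        hat≈ (a ∷ L) = C.+-cong (Grid.e-dot n a j) (hat≈ L)

      tagging : ∀ n → IsTagging n m (Grid.corner n)
      tagging n j i = ≤-refl , ≤-by (<⇒≤ (mesh-pos n))
        (solve 2 (λ k w → (1R :+ k) :* w :- k :* w := w) refl (fromℕ (toℕ (lookup j i))) (mesh n))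

      avgF≥0 : ∀ n → 0# ≤ Average.avg n m (F n)
      avgF≥0 n = Average.avg-nonneg n m (0≤F n)

      avgF<N+ε : ∀ ε (0<ε : 0# < ε) → ∀ n → proj₁ (isIntegral ε 0<ε) ℕ.≤ n → Average.avg n m (F n) < N + ε
      avgF<N+ε ε 0<ε n N₀≤n = <-by (<⇒0<- (proj₁ (proj₂ (isIntegral ε 0<ε) n N₀≤n (Grid.corner n) (tagging n))))
        (solve 3 (λ a n e → (n :+ e) :- a := e :- (a :- n)) refl _ N ε)

    norm-nonneg : 0# ≤ N
    norm-nonneg = ≤-up-to 1# (<⇒≤ 0<1) (λ ε 0<ε _ → ≤-trans (avgF≥0 (proj₁ (isIntegral ε 0<ε)))
      (≤-trans (<⇒≤ (avgF<N+ε ε 0<ε _ ℕ.≤-refl)) (≤-reflexive (+-congˡ (sym (*-identityʳ ε))))))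

    energy-bound : ∀ (L : List (ℤ^ m)) → All (_∈ A) L → let b = fromℕ (length L) in
      (b * b) * (b * b) ≤ (fromℕ (energy L) * fromℕ (card A)) * (N * N)
    -- For ε ≤ 1 one has (N + ε)² ≤ N² + ε (2N + 1).
    energy-bound L L⊆A = ≤-up-to (W * (fromℕ 2 * N + 1#))
      (*-nonneg 0≤W (+-nonneg (*-nonneg (fromℕ-nonneg 2) norm-nonneg) (<⇒≤ 0<1)))
      (λ ε 0<ε ε≤1 → ≤-trans (at ε 0<ε) (≤-by
        (*-nonneg (*-nonneg 0≤W (<⇒≤ 0<ε)) (≤⇒0≤- ε≤1))
        (solve 3 (λ w n e → (w :* (n :* n) :+ e :* (w :* (2R :* n :+ 1R))) :- w :* ((n :+ e) :* (n :+ e)) := w :* e :* (1R :- e)) refl W N ε)))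
      where
      b = fromℕ (length L)
      W = fromℕ (energy L) * fromℕ (card A)
      0≤W = *-nonneg (fromℕ-nonneg (energy L)) (fromℕ-nonneg (card A))
      at : ∀ ε → 0# < ε → (b * b) * (b * b) ≤ W * ((N + ε) * (N + ε))
      at ε 0<ε with bound-list As | bound-list L
      ... | B₁ , p₁ | B₂ , p₂ = grid-energy-bound exp isExp π isPi n m B (ℕ.s≤s (ℕ.m≤m+n _ N₀))
          (All.map (Bounded-mono (ℕ.m≤m+n B₁ B₂)) p₁) (All.map (Bounded-mono (ℕ.m≤n+m B₂ B₁)) p₂)
          unique L⊆A 0<∣A∣ (F n) (0≤F n) (FF n) (N + ε)
          (≤-<-trans (avgF≥0 n) avg<) (<⇒≤ avg<)
        where
        B = B₁ ℕ.+ B₂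
        N₀ = proj₁ (isIntegral ε 0<ε)
        -- Large enough for exact orthogonality, 4B < n + 1, and for the Riemann sum to be within ε
        -- of `N`.
        n = ((B ℕ.+ B) ℕ.+ (B ℕ.+ B)) ℕ.+ N₀
        avg< = avgF<N+ε ε 0<ε n (ℕ.m≤n+m N₀ _)

-- Energy, hyperplane sections and orthogonality in the integer lattice.

module LatticeGeometry where

  open ≡ using (refl; sym; trans; cong; cong₂)
  open +-*-Solver using (solve; _:=_; _:+_; _:*_; _:-_; :-_; con)
  module Σℤ = SemiringSum ℤ.+-*-semiring

  open CommutativeSemigroup ℕ.+-commutativeSemigroup using (interchange)
  open AbelianGroupProperties ℤ.+-0-abelianGroup using (∙-cancelˡ; ∙-cancelʳ)

  Σᴸ : ∀ {a} {X : Set a} → List X → (X → ℕ) → ℕ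
  Σᴸ L f = ℕ.sum (List.map f L)

  Σᴸ-cong : ∀ {a} {X : Set a} (L : List X) {f g} → (∀ x → f x ≡ g x) → Σᴸ L f ≡ Σᴸ L g
  Σᴸ-cong L f≗g = cong ℕ.sum (List.map-cong f≗g L)

  Σᴸ-mono : ∀ {a} {X : Set a} (L : List X) {f g} → (∀ {x} → x ∈ˡ L → f x ℕ.≤ g x) → Σᴸ L f ℕ.≤ Σᴸ L g
  Σᴸ-mono []      f≤g = ℕ.z≤n
  Σᴸ-mono (x ∷ L) f≤g = ℕ.+-mono-≤ (f≤g (here refl)) (Σᴸ-mono L (f≤g ∘ there))

  Σᴸ-const : ∀ {a} {X : Set a} (L : List X) k → Σᴸ L (λ _ → k) ≡ length L ℕ.* k
  Σᴸ-const []      k = refl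
  Σᴸ-const (x ∷ L) k = cong (k ℕ.+_) (Σᴸ-const L k)

  Σᴸ-+ : ∀ {a} {X : Set a} (L : List X) f g → Σᴸ L (λ x → f x ℕ.+ g x) ≡ Σᴸ L f ℕ.+ Σᴸ L g
  Σᴸ-+ []      f g = refl
  Σᴸ-+ (x ∷ L) f g = trans (cong ((f x ℕ.+ g x) ℕ.+_) (Σᴸ-+ L f g)) (interchange (f x) (g x) (Σᴸ L f) (Σᴸ L g))

  Σᴸ-*ʳ : ∀ {a} {X : Set a} (L : List X) f k → Σᴸ L (λ x → f x ℕ.* k) ≡ Σᴸ L f ℕ.* k
  Σᴸ-*ʳ []      f k = refl
  Σᴸ-*ʳ (x ∷ L) f k = trans (cong ((f x ℕ.* k) ℕ.+_) (Σᴸ-*ʳ L f k)) (sym (ℕ.*-distribʳ-+ k (f x) (Σᴸ L f)))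

  Σᴸ-swap : ∀ {a b} {X : Set a} {Y : Set b} (L : List X) (K : List Y) (f : X → Y → ℕ) →
            Σᴸ L (λ x → Σᴸ K (f x)) ≡ Σᴸ K (λ y → Σᴸ L (λ x → f x y))
  Σᴸ-swap []      K f = sym (trans (Σᴸ-const K 0) (ℕ.*-zeroʳ (length K)))
  Σᴸ-swap (x ∷ L) K f = trans (cong (Σᴸ K (f x) ℕ.+_) (Σᴸ-swap L K f)) (sym (Σᴸ-+ K (f x) (λ y → Σᴸ L (λ x → f x y))))

  Σᴸ-map : ∀ {a b} {X : Set a} {Y : Set b} (φ : X → Y) (L : List X) f → Σᴸ (List.map φ L) f ≡ Σᴸ L (f ∘ φ)
  Σᴸ-map φ L f = cong ℕ.sum (sym (List.map-∘ L))

  Σᴸ-sumset : ∀ {n} (L K : List (ℤ^ n)) f → Σᴸ (sumset L K) f ≡ Σᴸ L (λ x → Σᴸ K (λ y → f (x +ᵛ y)))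
  Σᴸ-sumset []      K f = refl
  Σᴸ-sumset (x ∷ L) K f = trans (cong ℕ.sum (List.map-++ f (List.map (x +ᵛ_) K) (sumset L K)))
    (trans (ℕ.sum-++ (List.map f (List.map (x +ᵛ_) K)) _)
      (cong₂ ℕ._+_ (Σᴸ-map (x +ᵛ_) K f) (Σᴸ-sumset L K f)))

  matches₁≡Σᴸ : ∀ {n} (x : ℤ^ n) L → matches₁ x L ≡ Σᴸ L (δ x)
  matches₁≡Σᴸ x []      = refl
  matches₁≡Σᴸ x (y ∷ L) = cong (δ x y ℕ.+_) (matches₁≡Σᴸ x L)

  matches≡Σᴸ : ∀ {n} (L K : List (ℤ^ n)) → matches L K ≡ Σᴸ L (λ x → Σᴸ K (δ x))
  matches≡Σᴸ []      K = refl
  matches≡Σᴸ (x ∷ L) K = cong₂ ℕ._+_ (matches₁≡Σᴸ x K) (matches≡Σᴸ L K)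

  energy≡Σᴸ : ∀ {n} (L : List (ℤ^ n)) →
    energy L ≡ Σᴸ L (λ x → Σᴸ L (λ y → Σᴸ L (λ z → Σᴸ L (λ w → δ (x +ᵛ y) (z +ᵛ w)))))
  energy≡Σᴸ L = trans (matches≡Σᴸ (sumset L L) (sumset L L)) (trans (Σᴸ-sumset L L _)
    (Σᴸ-cong L (λ x → Σᴸ-cong L (λ y → Σᴸ-sumset L L (δ (x +ᵛ y))))))

  δ-mono : ∀ {n m} {x y : ℤ^ n} {x′ y′ : ℤ^ m} → (x ≡ y → x′ ≡ y′) → δ x y ℕ.≤ δ x′ y′
  δ-mono {x = x} {y} {x′} {y′} f with x ≟ᵛ y
  ... | no  _   = ℕ.z≤n
  ... | yes x≡y = ℕ.≤-reflexive (sym (trans (cong (δ x′) (sym (f x≡y))) (δ-≡ x′)))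

  -- Each additive quadruple is carried to an additive quadruple. `List.map` keeps repetitions, so
  -- the two fourfold sums are compared term by term.
  energy-map : ∀ {n m} (φ : ℤ^ n → ℤ^ m) (L : List (ℤ^ n)) →
    (∀ {x y z w} → x ∈ˡ L → y ∈ˡ L → z ∈ˡ L → w ∈ˡ L → x +ᵛ y ≡ z +ᵛ w → φ x +ᵛ φ y ≡ φ z +ᵛ φ w) →
    energy L ℕ.≤ energy (List.map φ L)
  energy-map φ L hom = ℕ.≤-trans (ℕ.≤-reflexive (energy≡Σᴸ L)) (ℕ.≤-trans
    (Σᴸ-mono L λ x∈ → Σᴸ-mono L λ y∈ → Σᴸ-mono L λ z∈ → Σᴸ-mono L λ w∈ → δ-mono (hom x∈ y∈ z∈ w∈))
    (ℕ.≤-reflexive (sym (trans (energy≡Σᴸ (List.map φ L))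
      (trans (Σᴸ-map φ L _) (Σᴸ-cong L λ x → trans (Σᴸ-map φ L _) (Σᴸ-cong L λ y →
        trans (Σᴸ-map φ L _) (Σᴸ-cong L λ z → Σᴸ-map φ L _))))))))

  -- Euclidean geometry of ℤ^ n

  infixl 6 _-ᵛ_
  infixl 7 _*ᵛ_

  _-ᵛ_ : ∀ {n} → ℤ^ n → ℤ^ n → ℤ^ n
  _-ᵛ_ = Vec.zipWith ℤ._-_

  _*ᵛ_ : ∀ {n} → ℤ → ℤ^ n → ℤ^ n
  a *ᵛ x = Vec.map (a ℤ.*_) x

  ⟪_,_⟫ : ∀ {n} → ℤ^ n → ℤ^ n → ℤ
  ⟪ [] , [] ⟫       = + 0
  ⟪ a ∷ x , b ∷ y ⟫ = a ℤ.* b ℤ.+ ⟪ x , y ⟫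

  normSq≡⟪⟫ : ∀ {n} (x : ℤ^ n) → normSq x ≡ ⟪ x , x ⟫
  normSq≡⟪⟫ []      = refl
  normSq≡⟪⟫ (a ∷ x) = cong (ℤ._+_ (a ℤ.* a)) (normSq≡⟪⟫ x)

  ⟪⟫-comm : ∀ {n} (x y : ℤ^ n) → ⟪ x , y ⟫ ≡ ⟪ y , x ⟫
  ⟪⟫-comm []      []      = refl
  ⟪⟫-comm (a ∷ x) (b ∷ y) = cong₂ ℤ._+_ (ℤ.*-comm a b) (⟪⟫-comm x y)

  ⟪⟫--ˡ : ∀ {n} (x y z : ℤ^ n) → ⟪ x -ᵛ y , z ⟫ ≡ ⟪ x , z ⟫ ℤ.- ⟪ y , z ⟫
  ⟪⟫--ˡ []      []      []      = refl
  ⟪⟫--ˡ (a ∷ x) (b ∷ y) (c ∷ z) = trans (cong (ℤ._+_ ((a ℤ.- b) ℤ.* c)) (⟪⟫--ˡ x y z))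
    (solve 5 (λ a b c p q → (a :- b) :* c :+ (p :- q) := (a :* c :+ p) :- (b :* c :+ q)) refl a b c ⟪ x , z ⟫ ⟪ y , z ⟫)

  ⟪⟫--ʳ : ∀ {n} (x y z : ℤ^ n) → ⟪ x , y -ᵛ z ⟫ ≡ ⟪ x , y ⟫ ℤ.- ⟪ x , z ⟫
  ⟪⟫--ʳ x y z = trans (⟪⟫-comm x (y -ᵛ z)) (trans (⟪⟫--ˡ y z x) (cong₂ ℤ._-_ (⟪⟫-comm y x) (⟪⟫-comm z x)))

  ⟪⟫-*ˡ : ∀ {n} a (x z : ℤ^ n) → ⟪ a *ᵛ x , z ⟫ ≡ a ℤ.* ⟪ x , z ⟫
  ⟪⟫-*ˡ a []      []      = sym (ℤ.*-zeroʳ a)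
  ⟪⟫-*ˡ a (b ∷ x) (c ∷ z) = trans (cong (ℤ._+_ (a ℤ.* b ℤ.* c)) (⟪⟫-*ˡ a x z))
    (solve 4 (λ a b c p → a :* b :* c :+ a :* p := a :* (b :* c :+ p)) refl a b c ⟪ x , z ⟫)

  ⟪⟫-- : ∀ {n} (x y z w : ℤ^ n) →
    ⟪ x -ᵛ y , z -ᵛ w ⟫ ≡ (⟪ x , z ⟫ ℤ.- ⟪ x , w ⟫) ℤ.- (⟪ y , z ⟫ ℤ.- ⟪ y , w ⟫)
  ⟪⟫-- x y z w = trans (⟪⟫--ˡ x y (z -ᵛ w)) (cong₂ ℤ._-_ (⟪⟫--ʳ x z w) (⟪⟫--ʳ y z w))

  square≡+ : ∀ a → a ℤ.* a ≡ + (ℤ.∣ a ∣ ℕ.* ℤ.∣ a ∣)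
  square≡+ (+ n)    = sym (ℤ.pos-* n n)
  square≡+ -[1+ n ] = refl

  ⟪x,x⟫≡+ : ∀ {n} (x : ℤ^ n) → ∃[ k ] (⟪ x , x ⟫ ≡ + k × (k ≡ 0 → x ≡ Vec.replicate n (+ 0)))
  ⟪x,x⟫≡+ [] = 0 , refl , λ _ → refl
  ⟪x,x⟫≡+ (a ∷ x) with ⟪x,x⟫≡+ x
  ... | k , eq , zero⇒ = ℤ.∣ a ∣ ℕ.* ℤ.∣ a ∣ ℕ.+ k ,
    trans (cong₂ ℤ._+_ (square≡+ a) eq) (sym (ℤ.pos-+ (ℤ.∣ a ∣ ℕ.* ℤ.∣ a ∣) k)) ,
    λ sum≡0 → cong₂ _∷_
      (ℤ.∣i∣≡0⇒i≡0 ([ (λ p → p) , (λ p → p) ]′ (ℕ.m*n≡0⇒m≡0∨n≡0 ℤ.∣ a ∣ (ℕ.m+n≡0⇒m≡0 _ sum≡0))))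
      (zero⇒ (ℕ.m+n≡0⇒n≡0 (ℤ.∣ a ∣ ℕ.* ℤ.∣ a ∣) sum≡0))

  ⟪x,x⟫≡0⇒x≡0 : ∀ {n} (x : ℤ^ n) → ⟪ x , x ⟫ ≡ + 0 → x ≡ Vec.replicate n (+ 0)
  ⟪x,x⟫≡0⇒x≡0 x eq with ⟪x,x⟫≡+ x
  ... | k , eq′ , zero⇒ = zero⇒ (ℤ.+-injective (trans (sym eq′) eq))

  ⟪0,x⟫≡0 : ∀ {n} (x : ℤ^ n) → ⟪ Vec.replicate n (+ 0) , x ⟫ ≡ + 0
  ⟪0,x⟫≡0 []      = refl
  ⟪0,x⟫≡0 (a ∷ x) = cong₂ ℤ._+_ (ℤ.*-zeroˡ a) (⟪0,x⟫≡0 x)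

  x-y≡0⇒x≡y : ∀ {n} (x y : ℤ^ n) → x -ᵛ y ≡ Vec.replicate n (+ 0) → x ≡ y
  x-y≡0⇒x≡y []      []      _  = refl
  x-y≡0⇒x≡y (a ∷ x) (b ∷ y) eq = cong₂ _∷_ (ℤ.i-j≡0⇒i≡j a b (Vec.∷-injectiveˡ eq)) (x-y≡0⇒x≡y x y (Vec.∷-injectiveʳ eq))

  dist≡0⇒≡ : ∀ {n} (x y : ℤ^ n) → ⟪ x -ᵛ y , x -ᵛ y ⟫ ≡ + 0 → x ≡ y
  dist≡0⇒≡ x y eq = x-y≡0⇒x≡y x y (⟪x,x⟫≡0⇒x≡0 (x -ᵛ y) eq)

  +ᵛ-solve : ∀ {n} (x y z w : ℤ^ n) → x +ᵛ y ≡ z +ᵛ w → y ≡ w -ᵛ (x -ᵛ z)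
  +ᵛ-solve []      []      []      []      _  = refl
  +ᵛ-solve (a ∷ x) (b ∷ y) (c ∷ z) (d ∷ w) eq = cong₂ _∷_
    (trans (solve 3 (λ a b c → b := (a :+ b) :- c :- (a :- c)) refl a b c)
      (trans (cong (λ s → s ℤ.- c ℤ.- (a ℤ.- c)) (Vec.∷-injectiveˡ eq))
        (solve 3 (λ a c d → (c :+ d) :- c :- (a :- c) := d :- (a :- c)) refl a c d)))
    (+ᵛ-solve x y z w (Vec.∷-injectiveʳ eq))

  -- The points w for which both w and w + z − x can lie on one sphere about 0.
  Bisector : ∀ {n} → ℤ^ n → ℤ^ n → ℤ^ n → Set
  Bisector x z w = ⟪ w , x -ᵛ z ⟫ ℤ.+ ⟪ w , x -ᵛ z ⟫ ≡ ⟪ x -ᵛ z , x -ᵛ z ⟫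

  bisector? : ∀ {n} (x z w : ℤ^ n) → Dec (Bisector x z w)
  bisector? x z w = _ ℤ.≟ _

  -- Put v = x - z, so that y = w - v. Expanding |w - v|² = |w|² leaves 2⟪w, v⟫ = ⟪v, v⟫.
  sphere⇒bisector : ∀ {n R} {x y z w : ℤ^ n} → OnSphere R y → OnSphere R w → x +ᵛ y ≡ z +ᵛ w → Bisector x z w
  sphere⇒bisector {R = R} {x} {y} {z} {w} y∈ w∈ eq = ℤ-cancel (begin
    (⟪ w , v ⟫ ℤ.+ ⟪ w , v ⟫) ℤ.- ⟪ v , v ⟫
      ≡⟨ solve 3 (λ p q r → (q :+ q) :- r := p :- ((p :- q) :- (q :- r))) refl ⟪ w , w ⟫ ⟪ w , v ⟫ ⟪ v , v ⟫ ⟩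
    ⟪ w , w ⟫ ℤ.- ((⟪ w , w ⟫ ℤ.- ⟪ w , v ⟫) ℤ.- (⟪ w , v ⟫ ℤ.- ⟪ v , v ⟫))
      ≡⟨ cong (λ s → ⟪ w , w ⟫ ℤ.- ((⟪ w , w ⟫ ℤ.- ⟪ w , v ⟫) ℤ.- (s ℤ.- ⟪ v , v ⟫))) (⟪⟫-comm w v) ⟩
    ⟪ w , w ⟫ ℤ.- ((⟪ w , w ⟫ ℤ.- ⟪ w , v ⟫) ℤ.- (⟪ v , w ⟫ ℤ.- ⟪ v , v ⟫))
      ≡⟨ cong (ℤ._-_ ⟪ w , w ⟫) (⟪⟫-- w v w v) ⟨
    ⟪ w , w ⟫ ℤ.- ⟪ w -ᵛ v , w -ᵛ v ⟫
      ≡⟨ cong (λ u → ⟪ w , w ⟫ ℤ.- ⟪ u , u ⟫) (+ᵛ-solve x y z w eq) ⟨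
    ⟪ w , w ⟫ ℤ.- ⟪ y , y ⟫
      ≡⟨ cong₂ ℤ._-_ (trans (sym (normSq≡⟪⟫ w)) w∈) (trans (sym (normSq≡⟪⟫ y)) y∈) ⟩
    + (R ℕ.^ 2) ℤ.- + (R ℕ.^ 2)
      ≡⟨ ℤ.+-inverseʳ (+ (R ℕ.^ 2)) ⟩
    + 0 ∎)
    where
    open ≡.≡-Reasoning
    v = x -ᵛ z
    ℤ-cancel : ∀ {i j} → i ℤ.- j ≡ + 0 → i ≡ j
    ℤ-cancel {i} {j} = ℤ.i-j≡0⇒i≡j i j

  -- Additive energy on a sphere

  -- The alternative `K ≡ 0` accommodates the empty list, where nothing attains the default value.
  argmax : ∀ {a} {X : Set a} (f : X → ℕ) (L : List X) →
    ∃[ K ] ((∀ {x} → x ∈ˡ L → f x ℕ.≤ K) × (K ≡ 0 ⊎ ∃[ x ] (x ∈ˡ L × K ≡ f x)))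
  argmax f []      = 0 , (λ ()) , inj₁ refl
  argmax f (x ∷ L) with argmax f L
  ... | K , bound , attained with ℕ.≤-total (f x) K
  ...   | inj₁ fx≤K = K , (λ { (here refl) → fx≤K ; (there y∈) → bound y∈ }) ,
          [ inj₁ , (λ (y , y∈ , eq) → inj₂ (y , there y∈ , eq)) ]′ attained
  ...   | inj₂ K≤fx = f x , (λ { (here refl) → ℕ.≤-refl ; (there y∈) → ℕ.≤-trans (bound y∈) K≤fx }) ,
          inj₂ (x , here refl , refl)

  section : ∀ {n} → List (ℤ^ n) → ℤ^ n → ℤ^ n → List (ℤ^ n)
  section S x z = filter (bisector? x z) S

  -- Zero when x = z, where every point satisfies Bisector.
  sectionSize : ∀ {n} → List (ℤ^ n) → ℤ^ n × ℤ^ n → ℕ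
  sectionSize S (x , z) with x ≟ᵛ z
  ... | yes _ = 0
  ... | no  _ = length (section S x z)

  Σᴸ≤length-filter : ∀ {n} {P : ℤ^ n → Set} (P? : ∀ x → Dec (P x)) L (f : ℤ^ n → ℕ) →
    (∀ {x} → x ∈ˡ L → P x → f x ℕ.≤ 1) → (∀ {x} → x ∈ˡ L → ¬ P x → f x ≡ 0) →
    Σᴸ L f ℕ.≤ length (filter P? L)
  Σᴸ≤length-filter P? []      f f≤1 f≡0 = ℕ.z≤n
  Σᴸ≤length-filter P? (x ∷ L) f f≤1 f≡0 with P? x
  ... | yes p = ℕ.+-mono-≤ (f≤1 (here refl) p) (Σᴸ≤length-filter P? L f (f≤1 ∘ there) (f≡0 ∘ there))
  ... | no ¬p = ℕ.≤-trans (ℕ.≤-reflexive (cong (ℕ._+ Σᴸ L f) (f≡0 (here refl) ¬p)))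
    (Σᴸ≤length-filter P? L f (f≤1 ∘ there) (f≡0 ∘ there))

  matches₁≤1 : ∀ {n} (x : ℤ^ n) {L} → Unique L → matches₁ x L ℕ.≤ 1
  matches₁≤1 x {[]}    []       = ℕ.z≤n
  matches₁≤1 x {y ∷ L} (y∉ ∷ u) with x ≟ᵛ y
  ... | yes refl = ℕ.≤-reflexive (cong suc (matches₁-∉ y∉))
  ... | no  _    = matches₁≤1 x u

  module _ {n R : ℕ} {S : List (ℤ^ n)} (unique : Unique S) (onSphere : ∀ {x} → x ∈ˡ S → OnSphere R x) where

    -- For x = z the equation forces y = w, giving |S| solutions. For x ≠ z each w determines y, and
    -- only the w in the section admit a y on the sphere.
    pair-sum≤ : ∀ x z → Σᴸ S (λ y → Σᴸ S (λ w → δ (x +ᵛ y) (z +ᵛ w))) ℕ.≤ δ x z ℕ.* length S ℕ.+ sectionSize S (x , z)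
    pair-sum≤ x z with x ≟ᵛ z
    ... | yes refl = ℕ.≤-trans
      (Σᴸ-mono S (λ {y} _ → Σᴸ-mono S (λ {w} _ → δ-mono (cancelˡ x y w))))
      (ℕ.≤-reflexive (trans (sym (matches≡Σᴸ S S)) (trans (matches-⊆ unique (All.tabulate (λ p → p)))
        (sym (trans (ℕ.+-identityʳ _) (ℕ.+-identityʳ _))))))
      where
      cancelˡ : ∀ {n} (x y w : ℤ^ n) → x +ᵛ y ≡ x +ᵛ w → y ≡ w
      cancelˡ []      []      []      _  = refl
      cancelˡ (a ∷ x) (b ∷ y) (c ∷ w) eq =
        cong₂ _∷_ (∙-cancelˡ a b c (Vec.∷-injectiveˡ eq)) (cancelˡ x y w (Vec.∷-injectiveʳ eq))
    ... | no _ = ℕ.≤-trans (ℕ.≤-reflexive (Σᴸ-swap S S (λ y w → δ (x +ᵛ y) (z +ᵛ w))))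
      (Σᴸ≤length-filter (bisector? x z) S (λ w → Σᴸ S (λ y → δ (x +ᵛ y) (z +ᵛ w)))
        (λ {w} _ _ → ℕ.≤-trans
          (Σᴸ-mono S (λ {y} _ → δ-mono (sym ∘ +ᵛ-solve x y z w)))
          (ℕ.≤-trans (ℕ.≤-reflexive (sym (matches₁≡Σᴸ (w -ᵛ (x -ᵛ z)) S))) (matches₁≤1 _ unique)))
        (λ {w} w∈ ¬b → ℕ.n≤0⇒n≡0 (ℕ.≤-trans
          (Σᴸ-mono S {g = λ _ → 0} (λ {y} y∈ → ℕ.≤-reflexive (δ-≢ (λ eq →
            ¬b (sphere⇒bisector {R = R} {x = x} {y} {z} {w} (onSphere y∈) (onSphere w∈) eq)))))
          (ℕ.≤-reflexive (trans (Σᴸ-const S 0) (ℕ.*-zeroʳ (length S)))))))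

    -- Summing `pair-sum≤` over x and z, the diagonal contributes |S|² in total and every pair at
    -- most K more; the diagonal accounts for the successor.
    sphere-energy : ∃[ K ] (energy S ℕ.≤ length S ℕ.* length S ℕ.* suc K ×
      (K ≡ 0 ⊎ ∃[ x ] ∃[ z ] (x ∈ˡ S × z ∈ˡ S × x ≢ z × K ≡ length (section S x z))))
    sphere-energy with argmax (sectionSize S) (cartesianProduct S S)
    ... | K , bound , attained = K , energy≤ , attained′ attained
      where
      l = length S
      attained′ : (K ≡ 0 ⊎ ∃[ p ] (p ∈ˡ cartesianProduct S S × K ≡ sectionSize S p)) →
        K ≡ 0 ⊎ ∃[ x ] ∃[ z ] (x ∈ˡ S × z ∈ˡ S × x ≢ z × K ≡ length (section S x z))
      attained′ (inj₁ K≡0) = inj₁ K≡0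
      attained′ (inj₂ ((x , z) , p∈ , eq)) with x ≟ᵛ z
      ... | yes _  = inj₁ eq
      ... | no x≢z = inj₂ (x , z , proj₁ (∈-cartesianProduct⁻ S S p∈) , proj₂ (∈-cartesianProduct⁻ S S p∈) , x≢z , eq)
      energy≤ : energy S ℕ.≤ l ℕ.* l ℕ.* suc K
      energy≤ = begin
        energy S
          ≡⟨ trans (energy≡Σᴸ S) (Σᴸ-cong S (λ x → Σᴸ-swap S S (λ y z → Σᴸ S (λ w → δ (x +ᵛ y) (z +ᵛ w))))) ⟩
        Σᴸ S (λ x → Σᴸ S (λ z → Σᴸ S (λ y → Σᴸ S (λ w → δ (x +ᵛ y) (z +ᵛ w)))))
          ≤⟨ Σᴸ-mono S (λ {x} x∈ → Σᴸ-mono S (λ {z} z∈ → ℕ.≤-trans (pair-sum≤ x z)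
               (ℕ.+-monoʳ-≤ (δ x z ℕ.* l) (bound (∈-cartesianProduct⁺ x∈ z∈))))) ⟩
        Σᴸ S (λ x → Σᴸ S (λ z → δ x z ℕ.* l ℕ.+ K))
          ≡⟨ Σᴸ-cong S (λ x → trans (Σᴸ-+ S (λ z → δ x z ℕ.* l) (λ _ → K)) (cong₂ ℕ._+_ (Σᴸ-*ʳ S (δ x) l) (Σᴸ-const S K))) ⟩
        Σᴸ S (λ x → Σᴸ S (δ x) ℕ.* l ℕ.+ l ℕ.* K)
          ≡⟨ trans (Σᴸ-+ S (λ x → Σᴸ S (δ x) ℕ.* l) (λ _ → l ℕ.* K)) (cong₂ ℕ._+_ (Σᴸ-*ʳ S (λ x → Σᴸ S (δ x)) l) (Σᴸ-const S (l ℕ.* K))) ⟩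
        Σᴸ S (λ x → Σᴸ S (δ x)) ℕ.* l ℕ.+ l ℕ.* (l ℕ.* K)
          ≡⟨ cong (λ k → k ℕ.* l ℕ.+ l ℕ.* (l ℕ.* K)) (trans (sym (matches≡Σᴸ S S)) (matches-⊆ unique (All.tabulate (λ p → p)))) ⟩
        l ℕ.* l ℕ.+ l ℕ.* (l ℕ.* K)
          ≡⟨ cong ((l ℕ.* l) ℕ.+_) (sym (ℕ.*-assoc l l K)) ⟩
        l ℕ.* l ℕ.+ l ℕ.* l ℕ.* K
          ≡⟨ ℕ.*-suc (l ℕ.* l) K ⟨
        l ℕ.* l ℕ.* suc K ∎
        where open ℕ.≤-Reasoning

  -- Orthogonal systems

  -- Fraction-free Gaussian elimination. Given a pivot `v p` with first coordinate a ≠ 0, every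
  -- other vector is replaced by a v_j - b_j v_p, whose first coordinate vanishes. A relation c
  -- among these lifts to coefficients a c_j, with -Σ c_j b_j at the pivot.
  dependent : ∀ n (v : Fin (suc n) → Vector ℤ n) →
    Σ[ c ∈ Vector ℤ (suc n) ] ((Σ[ i ∈ Fin (suc n) ] c i ≢ + 0) × (∀ k → Σℤ.sum (λ j → c j ℤ.* v j k) ≡ + 0))
  dependent zero    v = (λ _ → + 1) , (zero , λ ()) , λ ()
  dependent (suc n) v with Fin.any? (λ i → ¬? (v i zero ℤ.≟ + 0))
  -- All first coordinates vanish: the first vector gets coefficient 0 and the others are handled in
  -- one dimension less.
  ... | no none = c′ , (suc i , ci≢0) , λ where
        zero    → trans (Σℤ.sum-cong-≗ (λ j → trans (cong (c′ j ℤ.*_) (all-zero j)) (ℤ.*-zeroʳ (c′ j)))) (Σℤ.sum-replicate-zero (suc (suc n)))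
        (suc k) → trans (ℤ.+-identityˡ _) (relation k)
    where
    ih = dependent n (λ i k → v (suc i) (suc k))
    c = proj₁ ih
    i = proj₁ (proj₁ (proj₂ ih))
    ci≢0 = proj₂ (proj₁ (proj₂ ih))
    relation = proj₂ (proj₂ ih)
    c′ : Fin (suc (suc n)) → ℤ
    c′ zero    = + 0
    c′ (suc j) = c j
    all-zero : ∀ j → v j zero ≡ + 0
    all-zero j with v j zero ℤ.≟ + 0
    ... | yes eq = eq
    ... | no neq = contradiction (j , neq) none
  ... | yes (p , a≢0) = c′ , (punchIn p i , λ eq → [ a≢0 , ci≢0 ]′ (ℤ.i*j≡0⇒i≡0∨j≡0 a (trans (sym (insertAt-punchIn ac p r i)) eq))) , λ where
        zero    → trans (split zero) (trans (Σℤ.sum-cong-≗ (λ j → solve 3 (λ c a b → c :* (a :* b :- b :* a) := con (+ 0)) refl (c j) a (b j))) (Σℤ.sum-replicate-zero (suc n)))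
        (suc k) → trans (split (suc k)) (relation k)
    where
    a = v p zero
    b : Fin (suc n) → ℤ
    b j = v (punchIn p j) zero
    ih = dependent n (λ j k → a ℤ.* v (punchIn p j) (suc k) ℤ.- b j ℤ.* v p (suc k))
    c = proj₁ ih
    i = proj₁ (proj₁ (proj₂ ih))
    ci≢0 = proj₂ (proj₁ (proj₂ ih))
    relation = proj₂ (proj₂ ih)
    ac : Fin (suc n) → ℤ
    ac j = a ℤ.* c j
    r = ℤ.- Σℤ.sum (λ j → c j ℤ.* b j)
    c′ = insertAt ac p r
    split : ∀ k → Σℤ.sum (λ j → c′ j ℤ.* v j k) ≡ Σℤ.sum (λ j → c j ℤ.* (a ℤ.* v (punchIn p j) k ℤ.- b j ℤ.* v p k))
    split k = begin
      Σℤ.sum (λ j → c′ j ℤ.* v j k)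
        ≡⟨ Σℤ.sum-remove {i = p} (λ j → c′ j ℤ.* v j k) ⟩
      c′ p ℤ.* v p k ℤ.+ Σℤ.sum (λ j → c′ (punchIn p j) ℤ.* v (punchIn p j) k)
        ≡⟨ cong₂ ℤ._+_ (cong (ℤ._* v p k) (insertAt-lookup ac p r)) (Σℤ.sum-cong-≗ (λ j → cong (ℤ._* v (punchIn p j) k) (insertAt-punchIn ac p r j))) ⟩
      r ℤ.* v p k ℤ.+ Σℤ.sum (λ j → ac j ℤ.* v (punchIn p j) k)
        ≡⟨ cong (ℤ._+ Σℤ.sum (λ j → ac j ℤ.* v (punchIn p j) k))
             (trans (solve 2 (λ s x → (:- s) :* x := s :* (:- x)) refl (Σℤ.sum (λ j → c j ℤ.* b j)) (v p k))
               (Σℤ.*-distribʳ-sum (ℤ.- v p k) (λ j → c j ℤ.* b j))) ⟩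
      Σℤ.sum (λ j → c j ℤ.* b j ℤ.* (ℤ.- v p k)) ℤ.+ Σℤ.sum (λ j → ac j ℤ.* v (punchIn p j) k)
        ≡⟨ Σℤ.∑-distrib-+ (λ j → c j ℤ.* b j ℤ.* (ℤ.- v p k)) (λ j → ac j ℤ.* v (punchIn p j) k) ⟨
      Σℤ.sum (λ j → c j ℤ.* b j ℤ.* (ℤ.- v p k) ℤ.+ ac j ℤ.* v (punchIn p j) k)
        ≡⟨ Σℤ.sum-cong-≗ (λ j → solve 5 (λ c b x a y → c :* b :* (:- x) :+ a :* c :* y := c :* (a :* y :- b :* x)) refl (c j) (b j) (v p k) a (v (punchIn p j) k)) ⟩
      Σℤ.sum (λ j → c j ℤ.* (a ℤ.* v (punchIn p j) k ℤ.- b j ℤ.* v p k)) ∎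
      where open ≡.≡-Reasoning

  Orthogonal : ∀ {n} → ℤ^ n → ℤ^ n → Set
  Orthogonal u v = ⟪ u , v ⟫ ≡ + 0

  record Frame {n} (vs : List (ℤ^ n)) : Set where
    constructor _,_
    field
      orthogonal : AllPairs Orthogonal vs
      nonzero    : All (λ v → ⟪ v , v ⟫ ≢ + 0) vs

  ⟪⟫≡sum : ∀ {n} (x y : ℤ^ n) → ⟪ x , y ⟫ ≡ Σℤ.sum (λ k → lookup x k ℤ.* lookup y k)
  ⟪⟫≡sum []      []      = refl
  ⟪⟫≡sum (a ∷ x) (b ∷ y) = cong (ℤ._+_ (a ℤ.* b)) (⟪⟫≡sum x y)

  lookup-orthogonal : ∀ {n} {vs : List (ℤ^ n)} → AllPairs Orthogonal vs →
    ∀ i j → i ≢ j → Orthogonal (List.lookup vs i) (List.lookup vs j)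
  lookup-orthogonal (_ ∷ _)  zero    zero    i≢j = contradiction refl i≢j
  lookup-orthogonal {vs = v ∷ vs} (p ∷ ps) zero    (suc j) i≢j = All.lookup p (∈-lookup {xs = vs} j)
  lookup-orthogonal {vs = v ∷ vs} (p ∷ ps) (suc i) zero    i≢j = trans (⟪⟫-comm (List.lookup vs i) v) (All.lookup p (∈-lookup {xs = vs} i))
  lookup-orthogonal (_ ∷ ps) (suc i) (suc j) i≢j = lookup-orthogonal ps i j (i≢j ∘ cong suc)

  -- Pair a nontrivial relation among n + 1 vectors with a `v i` whose coefficient is nonzero.
  -- Orthogonality leaves c_i ⟪v_i, v_i⟫ = 0, which is impossible.
  frame-length≢ : ∀ {n} (vs : List (ℤ^ n)) → Frame vs → length vs ≢ suc n
  frame-length≢ {n} vs (orth , nz) len = [ ci≢0 , All.lookup nz (∈-lookup (cast i)) ]′ (ℤ.i*j≡0⇒i≡0∨j≡0 (c i) (begin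
      c i ℤ.* ⟪ v i , v i ⟫
        ≡⟨ ℤ.+-identityʳ _ ⟨
      c i ℤ.* ⟪ v i , v i ⟫ ℤ.+ + 0
        ≡⟨ cong (ℤ._+_ (c i ℤ.* ⟪ v i , v i ⟫)) (trans (Σℤ.sum-cong-≗ (λ j → trans (cong (c (punchIn i j) ℤ.*_)
             (lookup-orthogonal orth _ _ (λ eq → Fin.punchInᵢ≢i i j (cast-injective eq)))) (ℤ.*-zeroʳ (c (punchIn i j))))) (Σℤ.sum-replicate-zero n)) ⟨
      c i ℤ.* ⟪ v i , v i ⟫ ℤ.+ Σℤ.sum (λ j → c (punchIn i j) ℤ.* ⟪ v (punchIn i j) , v i ⟫)
        ≡⟨ Σℤ.sum-remove {i = i} (λ j → c j ℤ.* ⟪ v j , v i ⟫) ⟨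
      Σℤ.sum (λ j → c j ℤ.* ⟪ v j , v i ⟫)
        ≡⟨ Σℤ.sum-cong-≗ (λ j → trans (cong (c j ℤ.*_) (⟪⟫≡sum (v j) (v i))) (trans (Σℤ.*-distribˡ-sum (c j) (λ k → lookup (v j) k ℤ.* lookup (v i) k))
             (Σℤ.sum-cong-≗ (λ k → sym (ℤ.*-assoc (c j) (lookup (v j) k) (lookup (v i) k)))))) ⟩
      Σℤ.sum (λ j → Σℤ.sum (λ k → c j ℤ.* lookup (v j) k ℤ.* lookup (v i) k))
        ≡⟨ Σℤ.∑-comm (λ j k → c j ℤ.* lookup (v j) k ℤ.* lookup (v i) k) ⟩
      Σℤ.sum (λ k → Σℤ.sum (λ j → c j ℤ.* lookup (v j) k ℤ.* lookup (v i) k))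
        ≡⟨ Σℤ.sum-cong-≗ (λ k → trans (sym (Σℤ.*-distribʳ-sum (lookup (v i) k) (λ j → c j ℤ.* lookup (v j) k)))
             (trans (cong (ℤ._* lookup (v i) k) (relation k)) (ℤ.*-zeroˡ (lookup (v i) k)))) ⟩
      Σℤ.sum {n} (λ k → + 0)
        ≡⟨ Σℤ.sum-replicate-zero n ⟩
      + 0 ∎))
    where
    open ≡.≡-Reasoning
    cast : Fin (suc n) → Fin (length vs)
    cast = Fin.cast (sym len)
    cast-injective : ∀ {i j} → cast i ≡ cast j → i ≡ j
    cast-injective {i} {j} eq = Fin.toℕ-injective (trans (sym (Fin.toℕ-cast (sym len) i)) (trans (cong Fin.toℕ eq) (Fin.toℕ-cast (sym len) j)))
    v : Fin (suc n) → ℤ^ n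
    v i = List.lookup vs (cast i)
    dep = dependent n (λ i → lookup (v i))
    c = proj₁ dep
    i = proj₁ (proj₁ (proj₂ dep))
    ci≢0 = proj₂ (proj₁ (proj₂ dep))
    relation = proj₂ (proj₂ dep)

  -- The points lie in one hyperplane with normal `v`. Phrased through differences, it passes to
  -- sublists and makes any x - y orthogonal to `v`.
  ConstantOn : ∀ {n} → List (ℤ^ n) → ℤ^ n → Set
  ConstantOn S v = ∀ x y → x ∈ˡ S → y ∈ˡ S → Orthogonal (x -ᵛ y) v

  -- If the combination vanished, then z − x = λ (x − y) with λ (λ + 1) = 0.
  collinear-on-sphere : ∀ {n R} {x y z : ℤ^ n} → OnSphere R x → OnSphere R y → OnSphere R z →
    x ≢ y → x ≢ z → y ≢ z →
    let u = x -ᵛ y ; a = z -ᵛ x in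
    (⟪ u , u ⟫ *ᵛ a) -ᵛ (⟪ a , u ⟫ *ᵛ u) ≢ Vec.replicate n (+ 0)
  collinear-on-sphere {n} {R} {x} {y} {z} x∈ y∈ z∈ x≢y x≢z y≢z w≡0 =
    [ κ≢0 , κ+N≢0 ]′ (ℤ.i*j≡0⇒i≡0∨j≡0 κ κ[κ+N]≡0)
    where
    open ≡.≡-Reasoning
    u = x -ᵛ y
    a = z -ᵛ x
    N = ⟪ u , u ⟫
    κ = ⟪ a , u ⟫
    r = + (R ℕ.^ 2)
    xy = ⟪ x , y ⟫
    xz = ⟪ x , z ⟫
    yz = ⟪ y , z ⟫
    xx : ⟪ x , x ⟫ ≡ r
    xx = trans (sym (normSq≡⟪⟫ x)) x∈
    yy : ⟪ y , y ⟫ ≡ r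
    yy = trans (sym (normSq≡⟪⟫ y)) y∈
    zz : ⟪ z , z ⟫ ≡ r
    zz = trans (sym (normSq≡⟪⟫ z)) z∈
    N≡ : N ≡ (r ℤ.- xy) ℤ.- (xy ℤ.- r)
    N≡ = trans (⟪⟫-- x y x y) (cong₂ ℤ._-_ (cong (ℤ._- xy) xx) (cong₂ ℤ._-_ (⟪⟫-comm y x) yy))
    aa≡ : ⟪ a , a ⟫ ≡ (r ℤ.- xz) ℤ.- (xz ℤ.- r)
    aa≡ = trans (⟪⟫-- z x z x) (cong₂ ℤ._-_ (cong₂ ℤ._-_ zz (⟪⟫-comm z x)) (cong (ℤ._-_ xz) xx))
    κ≡ : κ ≡ (xz ℤ.- yz) ℤ.- (r ℤ.- xy)
    κ≡ = trans (⟪⟫-- z x x y) (cong₂ ℤ._-_ (cong₂ ℤ._-_ (⟪⟫-comm z x) (⟪⟫-comm z y)) (cong (ℤ._- xy) xx))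
    zy≡ : ⟪ y -ᵛ z , y -ᵛ z ⟫ ≡ (r ℤ.- yz) ℤ.- (yz ℤ.- r)
    zy≡ = trans (⟪⟫-- y z y z) (cong₂ ℤ._-_ (cong (ℤ._- yz) yy) (cong₂ ℤ._-_ (⟪⟫-comm z y) zz))
    Na-κu : ∀ t → N ℤ.* ⟪ a , t ⟫ ℤ.- κ ℤ.* ⟪ u , t ⟫ ≡ + 0
    Na-κu t = trans (sym (trans (⟪⟫--ˡ (N *ᵛ a) (κ *ᵛ u) t) (cong₂ ℤ._-_ (⟪⟫-*ˡ N a t) (⟪⟫-*ˡ κ u t))))
      (trans (cong (λ w → ⟪ w , t ⟫) w≡0) (⟪0,x⟫≡0 t))
    ax≡ : ⟪ a , x ⟫ ≡ xz ℤ.- r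
    ax≡ = trans (⟪⟫--ˡ z x x) (cong₂ ℤ._-_ (⟪⟫-comm z x) xx)
    ux≡ : ⟪ u , x ⟫ ≡ r ℤ.- xy
    ux≡ = trans (⟪⟫--ˡ x y x) (cong₂ ℤ._-_ xx (⟪⟫-comm y x))
    N≢0 : N ≢ + 0
    N≢0 eq = x≢y (dist≡0⇒≡ x y eq)
    -- ⟪a,a⟫ + 2⟪a,x⟫ = 0 since z = x + a lies on the sphere, and ⟪u,u⟫ = 2⟪u,x⟫ since x − u does.
    κ[κ+N]≡0 : κ ℤ.* (κ ℤ.+ N) ≡ + 0
    κ[κ+N]≡0 = begin
      κ ℤ.* (κ ℤ.+ N)
        ≡⟨ cong (λ s → κ ℤ.* (κ ℤ.+ s)) (trans N≡ (solve 2 (λ r p → (r :- p) :- (p :- r) := (r :- p) :+ (r :- p)) refl r xy)) ⟩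
      κ ℤ.* (κ ℤ.+ ((r ℤ.- xy) ℤ.+ (r ℤ.- xy)))
        ≡⟨ cong (λ s → κ ℤ.* (κ ℤ.+ (s ℤ.+ s))) ux≡ ⟨
      κ ℤ.* (κ ℤ.+ (⟪ u , x ⟫ ℤ.+ ⟪ u , x ⟫))
        ≡⟨ solve 5 (λ k p n aa ax → k :* (k :+ (p :+ p)) :=
             n :* (aa :+ (ax :+ ax)) :- ((n :* aa :- k :* k) :+ ((n :* ax :- k :* p) :+ (n :* ax :- k :* p)))) refl κ ⟪ u , x ⟫ N ⟪ a , a ⟫ ⟪ a , x ⟫ ⟩
      N ℤ.* (⟪ a , a ⟫ ℤ.+ (⟪ a , x ⟫ ℤ.+ ⟪ a , x ⟫)) ℤ.-
        ((N ℤ.* ⟪ a , a ⟫ ℤ.- κ ℤ.* κ) ℤ.+ ((N ℤ.* ⟪ a , x ⟫ ℤ.- κ ℤ.* ⟪ u , x ⟫) ℤ.+ (N ℤ.* ⟪ a , x ⟫ ℤ.- κ ℤ.* ⟪ u , x ⟫)))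
        ≡⟨ cong₂ ℤ._-_
             (cong (N ℤ.*_) (trans (cong₂ ℤ._+_ aa≡ (cong₂ ℤ._+_ ax≡ ax≡)) (solve 2 (λ r p → ((r :- p) :- (p :- r)) :+ ((p :- r) :+ (p :- r)) := con (+ 0)) refl r xz)))
             (cong₂ ℤ._+_ Naa (cong₂ ℤ._+_ (Na-κu x) (Na-κu x))) ⟩
      N ℤ.* + 0 ℤ.- (+ 0 ℤ.+ (+ 0 ℤ.+ + 0))
        ≡⟨ cong (ℤ._- + 0) (ℤ.*-zeroʳ N) ⟩
      + 0 ∎
      where
      Naa : N ℤ.* ⟪ a , a ⟫ ℤ.- κ ℤ.* κ ≡ + 0
      Naa = trans (cong (λ s → N ℤ.* ⟪ a , a ⟫ ℤ.- κ ℤ.* s) (⟪⟫-comm a u)) (Na-κu a)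
    N*aa≡κκ : N ℤ.* ⟪ a , a ⟫ ≡ κ ℤ.* κ
    N*aa≡κκ = ℤ.i-j≡0⇒i≡j _ _ (trans (cong (λ s → N ℤ.* ⟪ a , a ⟫ ℤ.- κ ℤ.* s) (⟪⟫-comm a u)) (Na-κu a))
    κ≢0 : κ ≢ + 0
    κ≢0 κ≡0 = [ N≢0 , (λ aa≡0 → x≢z (sym (dist≡0⇒≡ z x aa≡0))) ]′
      (ℤ.i*j≡0⇒i≡0∨j≡0 N (trans N*aa≡κκ (trans (cong (ℤ._* κ) κ≡0) (ℤ.*-zeroˡ κ))))
    -- If κ = -N, then N ⟪a, a⟫ = κ² gives ⟪a, a⟫ = N. Hence |y - z|² = |a + u|² = N + 2κ + N = 0.
    κ+N≢0 : κ ℤ.+ N ≢ + 0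
    κ+N≢0 κ+N≡0 = [ N≢0 , (λ eq → y≢z (dist≡0⇒≡ y z (begin
        ⟪ y -ᵛ z , y -ᵛ z ⟫
          ≡⟨ trans zy≡ (solve 4 (λ r p q s → (r :- s) :- (s :- r) :=
               ((r :- q) :- (q :- r)) :+ (((q :- s) :- (r :- p)) :+ ((q :- s) :- (r :- p))) :+ ((r :- p) :- (p :- r))) refl r xy xz yz) ⟩
        ((r ℤ.- xz) ℤ.- (xz ℤ.- r)) ℤ.+ (((xz ℤ.- yz) ℤ.- (r ℤ.- xy)) ℤ.+ ((xz ℤ.- yz) ℤ.- (r ℤ.- xy))) ℤ.+ ((r ℤ.- xy) ℤ.- (xy ℤ.- r))
          ≡⟨ cong₂ ℤ._+_ (cong₂ ℤ._+_ aa≡ (cong₂ ℤ._+_ κ≡ κ≡)) N≡ ⟨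
        ⟪ a , a ⟫ ℤ.+ (κ ℤ.+ κ) ℤ.+ N
          ≡⟨ solve 3 (λ aa k n → aa :+ (k :+ k) :+ n := (aa :- n) :+ ((k :+ n) :+ (k :+ n))) refl ⟪ a , a ⟫ κ N ⟩
        (⟪ a , a ⟫ ℤ.- N) ℤ.+ ((κ ℤ.+ N) ℤ.+ (κ ℤ.+ N))
          ≡⟨ cong₂ ℤ._+_ eq (cong₂ ℤ._+_ κ+N≡0 κ+N≡0) ⟩
        + 0 ∎))) ]′
      (ℤ.i*j≡0⇒i≡0∨j≡0 N {⟪ a , a ⟫ ℤ.- N} (begin
        N ℤ.* (⟪ a , a ⟫ ℤ.- N)
          ≡⟨ solve 3 (λ n aa k → n :* (aa :- n) := (n :* aa :- k :* k) :+ (k :- n) :* (k :+ n)) refl N ⟪ a , a ⟫ κ ⟩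
        (N ℤ.* ⟪ a , a ⟫ ℤ.- κ ℤ.* κ) ℤ.+ (κ ℤ.- N) ℤ.* (κ ℤ.+ N)
          ≡⟨ cong₂ ℤ._+_ (ℤ.i≡j⇒i-j≡0 N*aa≡κκ) (trans (cong ((κ ℤ.- N) ℤ.*_) κ+N≡0) (ℤ.*-zeroʳ (κ ℤ.- N))) ⟩
        + 0 ∎))

  -- Three points would supply two further directions orthogonal to all of `vs`: u = x - y, and w,
  -- the part of z - x orthogonal to u, scaled by ⟪u, u⟫ to stay integral. As the sphere makes w
  -- nonzero, they would extend `vs` to a frame of n + 1 vectors.
  line-sphere-≤2 : ∀ {n R} {S : List (ℤ^ n)} {vs} → Unique S → (∀ {x} → x ∈ˡ S → OnSphere R x) →
    Frame vs → All (ConstantOn S) vs → suc (length vs) ≡ n → length S ℕ.≤ 2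
  line-sphere-≤2 {S = []}             _ _ _ _ _ = ℕ.z≤n
  line-sphere-≤2 {S = _ ∷ []}         _ _ _ _ _ = ℕ.s≤s ℕ.z≤n
  line-sphere-≤2 {S = _ ∷ _ ∷ []}     _ _ _ _ _ = ℕ.≤-refl
  line-sphere-≤2 {n} {R} {x ∷ y ∷ z ∷ S} {vs} ((x≢y ∷ x≢z ∷ _) ∷ (y≢z ∷ _) ∷ _) onSphere (orth , nz) const len =
    contradiction (cong suc len) (frame-length≢ (w ∷ u ∷ vs)
      (((w⊥u ∷ All.map (λ {v} c → w⊥v v (c z x z∈ x∈) (c x y x∈ y∈)) const) ∷ All.map (λ c → c x y x∈ y∈) const ∷ orth)
      , ((λ ww≡0 → collinear-on-sphere {R = R} (onSphere x∈) (onSphere y∈) (onSphere z∈) x≢y x≢z y≢z (⟪x,x⟫≡0⇒x≡0 w ww≡0))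
         ∷ (λ uu≡0 → x≢y (dist≡0⇒≡ x y uu≡0)) ∷ nz)))
    where
    T = x ∷ y ∷ z ∷ S
    x∈ : x ∈ˡ T
    x∈ = here refl
    y∈ : y ∈ˡ T
    y∈ = there (here refl)
    z∈ : z ∈ˡ T
    z∈ = there (there (here refl))
    u = x -ᵛ y
    a = z -ᵛ x
    w = (⟪ u , u ⟫ *ᵛ a) -ᵛ (⟪ a , u ⟫ *ᵛ u)
    expand : ∀ v → ⟪ w , v ⟫ ≡ ⟪ u , u ⟫ ℤ.* ⟪ a , v ⟫ ℤ.- ⟪ a , u ⟫ ℤ.* ⟪ u , v ⟫
    expand v = trans (⟪⟫--ˡ (⟪ u , u ⟫ *ᵛ a) (⟪ a , u ⟫ *ᵛ u) v) (cong₂ ℤ._-_ (⟪⟫-*ˡ ⟪ u , u ⟫ a v) (⟪⟫-*ˡ ⟪ a , u ⟫ u v))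
    w⊥u : Orthogonal w u
    w⊥u = trans (expand u) (solve 2 (λ n k → n :* k :- k :* n := con (+ 0)) refl ⟪ u , u ⟫ ⟪ a , u ⟫)
    w⊥v : ∀ v → Orthogonal a v → Orthogonal u v → Orthogonal w v
    w⊥v v av uv = trans (expand v) (trans (cong₂ (λ s t → ⟪ u , u ⟫ ℤ.* s ℤ.- ⟪ a , u ⟫ ℤ.* t) av uv)
      (solve 2 (λ n k → n :* con (+ 0) :- k :* con (+ 0) := con (+ 0)) refl ⟪ u , u ⟫ ⟪ a , u ⟫))

  -- The difference x - z of two points of `S` is orthogonal to the old normals because they are
  -- constant on `S`. It is itself constant on the section because `Bisector` fixes 2⟪w, x - z⟫.
  section-frame : ∀ {n} {S : List (ℤ^ n)} {vs x z} → x ∈ˡ S → z ∈ˡ S → x ≢ z →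
    Frame vs → All (ConstantOn S) vs → Frame (x -ᵛ z ∷ vs) × All (ConstantOn (section S x z)) (x -ᵛ z ∷ vs)
  section-frame {S = S} {vs} {x} {z} x∈ z∈ x≢z (orth , nz) const =
    ((All.map (λ c → c x z x∈ z∈) const ∷ orth) , ((λ eq → x≢z (dist≡0⇒≡ x z eq)) ∷ nz)) ,
    (constant ∷ All.map (λ c p q p∈ q∈ → c p q (proj₁ (∈-filter⁻ (bisector? x z) p∈)) (proj₁ (∈-filter⁻ (bisector? x z) q∈))) const)
    where
    v = x -ᵛ z
    double-injective : ∀ i j → i ℤ.+ i ≡ j ℤ.+ j → i ℤ.- j ≡ + 0
    double-injective i j eq = [ (λ ()) , (λ p → p) ]′ (ℤ.i*j≡0⇒i≡0∨j≡0 (+ 2) {i ℤ.- j}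
      (trans (solve 2 (λ i j → con (+ 2) :* (i :- j) := (i :+ i) :- (j :+ j)) refl i j) (ℤ.i≡j⇒i-j≡0 eq)))
    constant : ConstantOn (section S x z) v
    constant p q p∈ q∈ = trans (⟪⟫--ˡ p q v) (double-injective ⟪ p , v ⟫ ⟪ q , v ⟫
      (trans (proj₂ (∈-filter⁻ (bisector? x z) {xs = S} p∈)) (sym (proj₂ (∈-filter⁻ (bisector? x z) {xs = S} q∈)))))

  -- Freiman homomorphisms

  +ᵛ-cancelʳ : ∀ {n} (x y s : ℤ^ n) → x +ᵛ s ≡ y +ᵛ s → x ≡ y
  +ᵛ-cancelʳ []      []      []      _  = refl
  +ᵛ-cancelʳ (a ∷ x) (b ∷ y) (c ∷ s) eq = cong₂ _∷_ (∙-cancelʳ c a b (Vec.∷-injectiveˡ eq)) (+ᵛ-cancelʳ x y s (Vec.∷-injectiveʳ eq))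

  +ᵛ-assoc : ∀ {n} (x y z : ℤ^ n) → (x +ᵛ y) +ᵛ z ≡ x +ᵛ (y +ᵛ z)
  +ᵛ-assoc = Vec.zipWith-assoc {f = ℤ._+_} ℤ.+-assoc

  -- Pad both sides with h - 2 copies of the same point of `D`, apply the order-h property, and
  -- cancel the common image of the padding.
  freiman-order-2 : ∀ {m d h} {D : FiniteSet (ℤ^ m)} {φ : ℤ^ m → ℤ^ d} → 2 ℕ.≤ h → IsFreimanHom h D φ →
    ∀ {x y z w} → x ∈ D → y ∈ D → z ∈ D → w ∈ D → x +ᵛ y ≡ z +ᵛ w → φ x +ᵛ φ y ≡ φ z +ᵛ φ w
  freiman-order-2 {D = D} {φ} (ℕ.s≤s (ℕ.s≤s {n = h} _)) hom {x} {y} {z} {w} x∈ y∈ z∈ w∈ eq =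
    +ᵛ-cancelʳ (φ x +ᵛ φ y) (φ z +ᵛ φ w) (sumVectors (Vec.map φ pad))
      (trans (+ᵛ-assoc (φ x) (φ y) _) (trans
        (hom (x ∷ y ∷ pad) (z ∷ w ∷ pad) (x∈ AllV.∷ y∈ AllV.∷ pad∈ h) (z∈ AllV.∷ w∈ AllV.∷ pad∈ h)
          (trans (sym (+ᵛ-assoc x y (sumVectors pad))) (trans (cong (_+ᵛ sumVectors pad) eq) (+ᵛ-assoc z w (sumVectors pad)))))
        (sym (+ᵛ-assoc (φ z) (φ w) _))))
    where
    pad = Vec.replicate h x
    pad∈ : ∀ h → AllV.All (_∈ D) (Vec.replicate h x)
    pad∈ zero    = AllV.[]
    pad∈ (suc h) = x∈ AllV.∷ pad∈ h

-- Iterated sections and the final estimates.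

open LatticeGeometry

Unique-map : ∀ {a b} {X : Set a} {Y : Set b} (f : X → Y) {L : List X} →
  (∀ {x y} → x ∈ˡ L → y ∈ˡ L → f x ≡ f y → x ≡ y) → Unique L → Unique (List.map f L)
Unique-map f inj []       = []
Unique-map f inj (x∉ ∷ u) =
  All.map⁺ (All.tabulate (λ y∈ fx≡fy → All.lookup x∉ y∈ (inj (here ≡.refl) (there y∈) fx≡fy)))
  ∷ Unique-map f (λ x∈ y∈ → inj (there x∈) (there y∈)) u

-- Pulls a list of points of the sphere back to `D`, where the Fourier estimate is available.
All-map-preimage : ∀ {a b} {X : Set a} {Y : Set b} (f : X → Y) {D : List X} {K : List Y} →
  All (_∈ˡ List.map f D) K → ∃[ L ] (All (_∈ˡ D) L × List.map f L ≡ K)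
All-map-preimage f []        = [] , [] , ≡.refl
All-map-preimage f (y∈ ∷ K⊆) with ∈-map⁻ f y∈ | All-map-preimage f K⊆
... | x , x∈ , ≡.refl | L , L⊆ , ≡.refl = x ∷ L , x∈ ∷ L⊆ , ≡.refl

energy-singleton : ∀ {n} (x : ℤ^ n) → energy (x ∷ []) ≡ 1
energy-singleton x = ≡.cong (λ k → k ℕ.+ 0 ℕ.+ 0) (δ-≡ (x +ᵛ x))

1≤2^ : ∀ k → 1 ℕ.≤ 2 ℕ.^ k
1≤2^ k = ℕ.m^n>0 2 k

module Main {c ℓ₁ ℓ₂} (ℝ : RealField c ℓ₁ ℓ₂) where

  open EnergyBound ℝ public
  open CommutativeSemiringExp commutativeSemiring using (^-homo-*; ^-distrib-*; ^-congˡ)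

  1^≈1 : ∀ n → 1# ^ n ≈ 1#
  1^≈1 zero    = refl
  1^≈1 (suc n) = trans (*-identityˡ _) (1^≈1 n)

  ^-double : ∀ x e → x ^ (2 ℕ.* e) ≈ (x * x) ^ e
  ^-double x e = trans (^-homo-* x e (e ℕ.+ 0)) (trans
    (*-congˡ (reflexive (≡.cong (x ^_) (ℕ.+-identityʳ e)))) (sym (^-distrib-* x x e)))

  fourthPower : ℕ → Carrier
  fourthPower n = (fromℕ n * fromℕ n) * (fromℕ n * fromℕ n)

  module SphereBound {d R} (S₀ : List (ℤ^ d)) (onSphere : ∀ {x} → x ∈ˡ S₀ → OnSphere R x)
    (M : Carrier) (1≤M : 1# ≤ M)
    (energy≥ : ∀ {S} → Unique S → All (_∈ˡ S₀) S → fourthPower (length S) ≤ M * fromℕ (energy S)) where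

    0<M : 0# < M
    0<M = <-≤-trans 0<1 1≤M

    -- The factor 2 absorbs the `suc K` of the energy estimate, since suc K ≤ 2K for K ≥ 1.
    Y = fromℕ 2 * M

    1≤Y : 1# ≤ Y
    1≤Y = ≤-trans 1≤M (≤-by (<⇒≤ 0<M) (solve 1 (λ m → 2R :* m :- m := m) refl M))

    0<Y : 0# < Y
    0<Y = <-≤-trans 0<1 1≤Y

    -- Combines |S|⁴ ≤ M E(S) with E(S) ≤ |S|² (K + 1) and cancels |S|².
    square-bound : ∀ {S} → Unique S → All (_∈ˡ S₀) S → ∀ K → energy S ℕ.≤ length S ℕ.* length S ℕ.* suc K →
      fromℕ (length S) * fromℕ (length S) ≤ M * fromℕ (suc K)
    square-bound {[]}    _ _  K _ = ≤-trans (≤-reflexive (zeroˡ _)) (*-nonneg (<⇒≤ 0<M) (fromℕ-nonneg (suc K)))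
    square-bound {S@(_ ∷ _)} u S⊆ K E≤ = *-cancelˡ-≤ (b * b) (*-pos 0<b 0<b) (≤-trans (energy≥ u S⊆)
      (≤-trans (*-monoˡ-≤ M (<⇒≤ 0<M) (fromℕ-mono-≤ E≤))
        (≤-reflexive (trans (*-congˡ (trans (fromℕ-* (l ℕ.* l) (suc K)) (*-congʳ (fromℕ-* l l))))
          (solve 3 (λ m b k → m :* (b :* k) := b :* (m :* k)) refl M (b * b) (fromℕ (suc K)))))))
      where
      l = length S
      b = fromℕ l
      0<b = 0<fromℕ l

    -- The inductive bound b ^ (2 ^ k) ≤ 2 Y ^ (2 ^ k − 1), multiplied by Y.
    Claim : ℕ → Carrier → Set _
    Claim e x = Y * x ^ e ≤ fromℕ 2 * Y ^ e

    Claim-1 : ∀ e → 1 ℕ.≤ e → Claim e 1#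
    Claim-1 (suc e) _ = ≤-trans (≤-reflexive (trans (*-congˡ (1^≈1 (suc e))) (*-identityʳ Y)))
      (≤-trans (≤-trans (≤-reflexive (sym (*-identityʳ Y))) (*-monoˡ-≤ Y (<⇒≤ 0<Y) (1≤^ e 1≤Y)))
        (≤-by (^-nonneg (suc e) (<⇒≤ 0<Y)) (solve 1 (λ y → 2R :* y :- y := y) refl (Y ^ suc e))))

    -- Y x^(2e) ≤ Y (Y y)^e = Y^e (Y y^e) ≤ 2 Y^(2e).
    Claim-square : ∀ e {x y} → 0# ≤ x → x * x ≤ Y * y → Claim e y → Claim (2 ℕ.* e) x
    Claim-square e {x} {y} 0≤x xx≤Yy claim = ≤-trans (≤-reflexive (*-congˡ (^-double x e)))
        (≤-trans (*-monoˡ-≤ Y (<⇒≤ 0<Y) (^-mono-≤ e (*-nonneg 0≤x 0≤x) xx≤Yy))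
        (≤-trans (≤-reflexive (trans (*-congˡ (^-distrib-* Y y e))
          (solve 3 (λ m u v → m :* (u :* v) := u :* (m :* v)) refl Y (Y ^ e) (y ^ e))))
        (≤-trans (*-monoˡ-≤ (Y ^ e) (^-nonneg e (<⇒≤ 0<Y)) claim)
        (≤-reflexive (trans (solve 2 (λ u t → u :* (t :* u) := t :* (u :* u)) refl (Y ^ e) (fromℕ 2))
          (*-congˡ (trans (sym (^-distrib-* Y Y e)) (sym (^-double Y e)))))))))

    -- `k` counts the sections still to be taken and `vs` holds the normals of those already taken.
    -- At k = 0 there are d - 1 normals, so at most two points remain.
    claim : ∀ k {S vs} → Unique S → All (_∈ˡ S₀) S → Frame vs → All (ConstantOn S) vs →
      suc (length vs ℕ.+ k) ≡ d → Claim (2 ℕ.^ k) (fromℕ (length S))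
    claim zero {S} {vs} u S⊆ frame const len = ≤-trans
      (*-monoˡ-≤ Y (<⇒≤ 0<Y) (≤-trans (≤-reflexive (*-identityʳ _)) (fromℕ-mono-≤
        (line-sphere-≤2 {R = R} u (onSphere ∘ All.lookup S⊆) frame const
          (≡.trans (≡.cong suc (≡.sym (ℕ.+-identityʳ (length vs)))) len)))))
      (≤-reflexive (solve 1 (λ y → y :* 2R := 2R :* (y :* 1R)) refl Y))
    claim (suc k) {S} {vs} u S⊆ frame const len =
      step (sphere-energy {R = R} u (onSphere ∘ All.lookup S⊆))
      where
      b = fromℕ (length S)
      step : ∃[ K ] (energy S ℕ.≤ length S ℕ.* length S ℕ.* suc K ×
               (K ≡ 0 ⊎ ∃[ x ] ∃[ z ] (x ∈ˡ S × z ∈ˡ S × x ≢ z × K ≡ length (section S x z)))) →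
             Claim (2 ℕ.^ suc k) b
      -- Here |S|² ≤ M already, and the number 1 takes the place of the size of a section.
      step (zero , E≤ , _) = Claim-square (2 ℕ.^ k) (fromℕ-nonneg (length S))
        (≤-trans (square-bound u S⊆ 0 E≤) (≤-by (<⇒≤ 0<M)
          (solve 1 (λ m → 2R :* m :* 1R :- m :* (1R :+ 0R) := m) refl M)))
        (Claim-1 (2 ℕ.^ k) (1≤2^ k))
      step (suc K , E≤ , inj₁ ())
      step (suc K , E≤ , inj₂ (x , z , x∈ , z∈ , x≢z , size)) = Claim-square (2 ℕ.^ k) (fromℕ-nonneg (length S))
        (≤-trans (square-bound u S⊆ (suc K) E≤) (≤-by (*-nonneg (<⇒≤ 0<M) (fromℕ-nonneg K))
          (solve 2 (λ m k → 2R :* m :* (1R :+ k) :- m :* (1R :+ (1R :+ k)) := m :* k) refl M (fromℕ K))))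
        (≡.subst (λ n → Claim (2 ℕ.^ k) (fromℕ n)) (≡.sym size)
          (claim k (Unique.filter⁺ (bisector? x z) u)
            (All.tabulate (λ p∈ → All.lookup S⊆ (proj₁ (∈-filter⁻ (bisector? x z) {xs = S} p∈))))
            (proj₁ frame′) (proj₂ frame′)
            (≡.trans (≡.cong suc (≡.sym (ℕ.+-suc (length vs) k))) len)))
        where
        frame′ = section-frame x∈ z∈ x≢z frame const

    -- No section has been taken at the start, so k = d - 1. As 2^(d-1) = 1 + t, the extra factor Y
    -- in `Claim` cancels one power on the right.
    sphere-bound : 2 ℕ.≤ d → Unique S₀ → fromℕ (length S₀) ^ suc (exponent d) ≤ fromℕ 2 * Y ^ exponent d
    sphere-bound 2≤d u = *-cancelˡ-≤ Y 0<Y (≤-trans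
      (≡.subst (λ e → Claim e (fromℕ (length S₀))) (≡.sym (ℕ.m+[n∸m]≡n (1≤2^ (d ℕ.∸ 1))))
        (claim (d ℕ.∸ 1) u (All.tabulate (λ p → p)) ([] , []) [] (ℕ.m+[n∸m]≡n (ℕ.≤-trans (ℕ.s≤s ℕ.z≤n) 2≤d))))
      (≤-reflexive (solve 3 (λ t y z → t :* (y :* z) := y :* (t :* z)) refl (fromℕ 2) Y (Y ^ exponent d))))

  module Model {d m} (2≤d : 2 ℕ.≤ d) {A : FiniteSet (ℤ^ m)} (A≢∅ : Nonempty A) (model : SphericalModel d A)
    {N : Carrier} (norm : IsFourierL1Norm A N) where

    open SphericalModel model
    open IsFreimanIso φ-iso

    t = exponent d
    Ds = FiniteSet.elements D
    a = fromℕ (card A)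
    b = fromℕ (card D)
    a#0 = card#0 A A≢∅
    α = density A≢∅ model
    α#0 = density#0 A≢∅ model
    -- One factor 2 for the two points on a line, and t more from Y^t = (2M)^t.
    C = fromℕ 2 ^ suc t

    card-pos : ∀ {X : Set} (B : FiniteSet X) → Nonempty B → 0# < fromℕ (card B)
    card-pos B B≢∅ = nonneg#0⇒pos (fromℕ-nonneg (card B)) (card#0 B B≢∅)

    0<a : 0# < a
    0<a = card-pos A A≢∅

    0<b : 0# < b
    0<b = card-pos D D-nonempty

    0<α : 0# < α
    0<α = *-pos 0<b (inv-pos a#0 0<a)

    b≈αa : b ≈ α * a
    b≈αa = sym (trans (*-assoc b (inv a a#0) a) (trans (*-congˡ (inv-* a a#0)) (*-identityʳ b)))

    S₀ : List (ℤ^ d)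
    S₀ = List.map φ Ds

    M : Carrier
    M = a * (N * N)

    S₀-onSphere : ∀ {x} → x ∈ˡ S₀ → OnSphere R x
    S₀-onSphere x∈ with ∈-map⁻ φ x∈
    ... | y , y∈ , ≡.refl = S-onSphere (mapsTo y∈)

    energy≥ : ∀ {S} → All (_∈ˡ S₀) S → fourthPower (length S) ≤ M * fromℕ (energy S)
    energy≥ {S} S⊆ = from-preimage (All-map-preimage φ S⊆)
      where
      from-preimage : ∃[ L ] (All (_∈ˡ Ds) L × List.map φ L ≡ S) → fourthPower (length S) ≤ M * fromℕ (energy S)
      from-preimage (L , L⊆D , ≡.refl) = ≤-trans
        (≤-reflexive (*-cong (*-cong len len) (*-cong len len)))
        (≤-trans (energy-bound A≢∅ norm L (All.map D⊆A L⊆D))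
        (≤-trans (≤-reflexive (solve 3 (λ e a n → (e :* a) :* n := (a :* n) :* e) refl (fromℕ (energy L)) a (N * N)))
          (*-monoˡ-≤ M (*-nonneg (<⇒≤ 0<a) (sq-nonneg N)) (fromℕ-mono-≤ (energy-map φ L
            (λ x∈ y∈ z∈ w∈ → freiman-order-2 {D = D} order≥2 hom
              (All.lookup L⊆D x∈) (All.lookup L⊆D y∈) (All.lookup L⊆D z∈) (All.lookup L⊆D w∈)))))))
        where
        len : fromℕ (length (List.map φ L)) ≈ fromℕ (length L)
        len = reflexive (≡.cong fromℕ (List.length-map φ L))

    -- The energy inequality for a single point of the model, whose energy is 1.
    1≤M : 1# ≤ M
    1≤M = ≤-resp (solve 0 ((1R :+ 0R) :* (1R :+ 0R) :* ((1R :+ 0R) :* (1R :+ 0R)) := 1R) refl)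
      (trans (*-congˡ (trans (reflexive (≡.cong fromℕ (energy-singleton x))) (+-identityʳ 1#))) (*-identityʳ M))
      (energy≥ (∈-map⁺ φ (proj₂ D-nonempty) ∷ []))
      where x = φ (proj₁ D-nonempty)

    open SphereBound {R = R} S₀ S₀-onSphere M 1≤M (λ _ → energy≥) using (Y; sphere-bound)

    -- `sphere-bound` with |D| = α a and M = a N²: the common a^t cancels and one factor a survives.
    -- Both conclusions of the theorem are read off from this.
    density-bound : α ^ suc t * a ≤ C * (N * N) ^ t
    density-bound = *-cancelˡ-≤ (a ^ t) (^-pos t 0<a) (≤-resp
      (trans (^-congˡ (suc t) (trans (reflexive (≡.cong fromℕ (List.length-map φ Ds))) b≈αa))
        (trans (^-distrib-* α a (suc t)) (solve 3 (λ x a y → x :* (a :* y) := y :* (x :* a)) refl (α ^ suc t) a (a ^ t))))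
      (trans (*-congˡ (trans (^-distrib-* (fromℕ 2) M t) (*-congˡ (^-distrib-* a (N * N) t))))
        (solve 4 (λ w x y z → w :* (x :* (y :* z)) := y :* (w :* x :* z)) refl (fromℕ 2) (fromℕ 2 ^ t) (a ^ t) ((N * N) ^ t)))
      (sphere-bound 2≤d (Unique-map φ injective (FiniteSet.unique D))))

    0≤N : 0# ≤ N
    0≤N = norm-nonneg A≢∅ norm

    card-bound : ∀ {η} (0<η : 0# < η) → η < 1# → let η⁻¹ = inv η (pos⇒#0 0<η) in
      b ≤ C * (η⁻¹ ^ 2 * (N ^ 2 * inv α α#0)) ^ t
    card-bound {η} 0<η η<1 = ≤-trans
      (≤-resp
        (trans (solve 4 (λ i x al a → i :* (al :* x :* a) := (i :* x) :* (al :* a)) refl (i ^ t) (α ^ t) α a)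
          (trans (*-cong (trans (sym (^-distrib-* i α t)) (trans (^-congˡ t (inv-* α α#0)) (1^≈1 t))) (sym b≈αa)) (*-identityˡ b)))
        (trans (solve 3 (λ i c x → i :* (c :* x) := c :* (i :* x)) refl (i ^ t) C ((N * N) ^ t))
          (*-congˡ (trans (sym (^-distrib-* i (N * N) t)) (^-congˡ t (solve 2 (λ i n → i :* (n :* n) := (n :* (n :* 1R)) :* i) refl i N)))))
        (*-monoˡ-≤ (i ^ t) (^-nonneg t 0≤i) density-bound))
      (*-monoˡ-≤ C (^-nonneg (suc t) (fromℕ-nonneg 2)) (^-mono-≤ t 0≤X
        (≤-trans (≤-reflexive (sym (*-identityˡ X))) (*-mono-≤ (<⇒≤ 0<1) 0≤X (1≤^ 2 1≤η⁻¹) ≤-refl))))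
      where
      i = inv α α#0
      0≤i = <⇒≤ (inv-pos α#0 0<α)
      η⁻¹ = inv η (pos⇒#0 0<η)
      X = N ^ 2 * i
      0≤X : 0# ≤ X
      0≤X = *-nonneg (^-nonneg 2 0≤N) 0≤i
      -- From η < 1; thus the factor η⁻² may be inserted on the right.
      1≤η⁻¹ : 1# ≤ η⁻¹
      1≤η⁻¹ = ≤-resp (inv-* η (pos⇒#0 0<η)) (*-identityʳ η⁻¹)
        (*-monoˡ-≤ η⁻¹ (<⇒≤ (inv-pos (pos⇒#0 0<η) 0<η)) (<⇒≤ η<1))

    pointSubspace : ℤ^ d → AffineSubspace d
    pointSubspace x = record
      { dim         = 0
      ; point       = λ i → fromℤ (lookup x i)
      ; basis       = λ ()
      ; independent = λ _ _ ()
      }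

    -- Indexed by `D` rather than by `S`, so that the number of subspaces is the very quantity
    -- bounded by `card-bound`.
    points : Fin (card D) → AffineSubspace d
    points j = pointSubspace (φ (List.lookup Ds j))

    points-cover : IsIntersection S S points
    points-cover s = mk⇔ (λ s∈ → s∈ , covered (surjective s∈)) proj₁
      where
      covered : ∃[ x ] (x ∈ D × φ x ≡ s) → ∃[ j ] s ∈ᴬ points j
      covered (x , x∈ , φx≡s) = Any.index x∈ , (λ ()) , λ i → trans
        (reflexive (≡.cong (λ y → fromℤ (lookup y i)) (≡.trans (≡.sym φx≡s) (≡.cong φ (lookup-index x∈)))))
        (sym (+-identityʳ _))

    -- Compare 2t-th powers using `density-bound`. The constant h = 1/2 works because t ≥ 1 gives 2t
    -- ≥ t + 1, so h^(2t) ≤ h^(t+1), which cancels C = 2^(t+1).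
    norm-bound : ∀ r s → IsRationalPower a 1 (2 ℕ.* t) r → IsRationalPower α (t ℕ.+ 1) (2 ℕ.* t) s →
      mesh 1 * r * s ≤ N
    norm-bound r s (0≤r , r^≈) (0≤s , s^≈) = ^-cancel-≤ (2 ℕ.* t) {{ℕ.>-nonZero (ℕ.*-mono-≤ {1} {2} (ℕ.s≤s ℕ.z≤n) 1≤t)}} 0≤N
      (≤-trans (≤-reflexive (trans (^-distrib-* (h * r) s (2 ℕ.* t)) (*-cong (trans (^-distrib-* h r (2 ℕ.* t))
          (*-congˡ (trans r^≈ (*-identityʳ a)))) (trans s^≈ (reflexive (≡.cong (α ^_) (ℕ.+-comm t 1)))))))
      (≤-trans (≤-reflexive (solve 3 (λ h a x → h :* a :* x := h :* (x :* a)) refl (h ^ (2 ℕ.* t)) a (α ^ suc t)))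
      (≤-trans (*-mono-≤ (^-nonneg (2 ℕ.* t) 0≤h) (*-nonneg (^-nonneg (suc t) (<⇒≤ 0<α)) (<⇒≤ 0<a)) h^≤ density-bound)
      (≤-reflexive (trans (sym (*-assoc (h ^ suc t) C _)) (trans (*-congʳ (trans (sym (^-distrib-* h (fromℕ 2) (suc t)))
        (trans (^-congˡ (suc t) (mesh-inverse 1)) (1^≈1 (suc t))))) (trans (*-identityˡ _) (sym (^-double N t)))))))))
      where
      h = mesh 1
      0≤h = <⇒≤ (mesh-pos 1)
      1≤t : 1 ℕ.≤ t
      1≤t = ℕ.∸-monoˡ-≤ 1 (ℕ.^-monoʳ-≤ 2 {1} (ℕ.∸-monoˡ-≤ 1 2≤d))
      h≤1 : h ≤ 1#
      h≤1 = ≤-resp (*-identityʳ h) (mesh-inverse 1) (*-monoˡ-≤ h 0≤h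
        (≤-by (<⇒≤ 0<1) (solve 0 (2R :- 1R := 1R) refl)))
      ^-anti : ∀ {m n} → m ℕ.≤ n → h ^ n ≤ h ^ m
      ^-anti {n = n} ℕ.z≤n = ≤-resp refl (1^≈1 n) (^-mono-≤ n 0≤h h≤1)
      ^-anti (ℕ.s≤s m≤n)   = *-monoˡ-≤ h 0≤h (^-anti m≤n)
      h^≤ : h ^ (2 ℕ.* t) ≤ h ^ suc t
      h^≤ = ^-anti (ℕ.≤-trans (ℕ.+-monoˡ-≤ t 1≤t) (ℕ.≤-reflexive (≡.cong (t ℕ.+_) (≡.sym (ℕ.+-identityʳ t)))))

    covering : ∀ η (0<η : 0# < η) → η < 1# → ∃[ J ] Σ[ P ∈ (Fin J → AffineSubspace d) ]
      ((∀ j → dim (P j) ℕ.≤ 1) ×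
       (∃[ T ] (IsIntersection T S P × (1# - η) * fromℕ (card S) ≤ fromℕ (card T))) ×
       fromℕ J ≤ C * (inv η (pos⇒#0 0<η) ^ 2 * (N ^ 2 * inv α α#0)) ^ t)
    covering η 0<η η<1 = card D , points , (λ _ → ℕ.z≤n) ,
      (S , points-cover , ≤-by (*-nonneg (<⇒≤ 0<η) (fromℕ-nonneg (card S)))
        (solve 2 (λ s h → s :- (1R :- h) :* s := h :* s) refl (fromℕ (card S)) η)) ,
      card-bound 0<η η<1

theorem6 : ∀ {c ℓ₁ ℓ₂} (ℝ : RealField c ℓ₁ ℓ₂) → let open Analysis ℝ in
  ∀ (d : ℕ) → 2 ℕ.≤ d → let t = exponent d in
  ∃[ C ] ∃[ c′ ] (0# < C × 0# < c′ ×
    (∀ (m : ℕ) → 1 ℕ.≤ m →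
     ∀ (A : FiniteSet (ℤ^ m)) (A≢∅ : Nonempty A) (M : SphericalModel d A) →
     ∀ (‖A‖ : Carrier) → IsFourierL1Norm A ‖A‖ →
     let open SphericalModel M using (S)
         α   = density A≢∅ M
         α#0 = density#0 A≢∅ M in
     (∀ η (0<η : 0# < η) → η < 1# →
        let η⁻¹ = inv η (pos⇒#0 0<η) in
        ∃[ J ] Σ[ P ∈ (Fin J → AffineSubspace d) ]
          ((∀ j → dim (P j) ℕ.≤ 1) ×
           (∃[ T ] (IsIntersection T S P ×
                    (1# - η) * fromℕ (card S) ≤ fromℕ (card T))) ×
           fromℕ J ≤ C * (η⁻¹ ^ 2 * (‖A‖ ^ 2 * inv α α#0)) ^ t)) ×
     (∀ r s →
        IsRationalPower (fromℕ (card A)) 1 (2 ℕ.* t) r →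
        IsRationalPower α (t ℕ.+ 1) (2 ℕ.* t) s →
        c′ * r * s ≤ ‖A‖)))
theorem6 ℝ d 2≤d = fromℕ 2 ^ suc (exponent d) , mesh 1 , ^-pos (suc (exponent d)) (0<fromℕ 2) , mesh-pos 1 ,
  λ m 1≤m A A≢∅ model ‖A‖ norm →
    Model.covering 2≤d A≢∅ model norm , Model.norm-bound 2≤d A≢∅ model norm
  where open Main ℝ
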